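{- Let $k\ge 3$ and $n\ge 2k$ be integers. If $\mathcal A,\mathcal B\subset\binom{[n]}{k}$ are non-trivial cross-intersecting families, then $$|\mathcal A||\mathcal B|\le h(n,k)^2,\qquad\text{where } h(n,k)=\binom{n-1}{k-1}-\binom{n-k-1}{k-1}+1 .$$
   Context: $[n]=\{1,\dots,n\}$ and $\binom{[n]}{k}$ is the collection of all $k$-element subsets of $[n]$. A family is a star if all of its members contain a common fixed element; it is non-trivial if it is not a star. Families $\mathcal A,\mathcal B$ are cross-intersecting if $A\cap B\neq\emptyset$ for all $A\in\mathcal A$, $B\in\mathcal B$; they are non-trivial cross-intersecting if moreover neither $\mathcal A$ nor $\mathcal B$ is a star. -}

module Defs where

open import Data.Fin.Subset using (Subset; _∈_; _∩_; ∣_∣; Nonempty)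
open import Data.List using (List; length)
open import Data.List.Membership.Propositional using () renaming (_∈_ to _∈ˡ_)
open import Data.List.Relation.Unary.Unique.Propositional using (Unique)
open import Data.Nat using (ℕ; _+_; _∸_)
open import Data.Nat.Combinatorics using (_C_)
open import Data.Product using (_×_; ∃-syntax)
open import Relation.Binary.PropositionalEquality using (_≡_)
open import Relation.Nullary using (¬_)

-- The ground set [n] is Fin n.  A set of k-subsets of [n] is listed without
-- repetition, so that its cardinality is the length of the list.
record Family (n k : ℕ) : Set where
  field
    members : List (Subset n)
    unique  : Unique members
    uniform : ∀ {A} → A ∈ˡ members → ∣ A ∣ ≡ k

open Family public

infix 4 _∈ᶠ_

_∈ᶠ_ : ∀ {n k} → Subset n → Family n k → Set
A ∈ᶠ 𝒜 = A ∈ˡ members 𝒜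

card : ∀ {n k} → Family n k → ℕ
card 𝒜 = length (members 𝒜)

Star : ∀ {n k} → Family n k → Set
Star {n} 𝒜 = ∃[ x ] (∀ {A : Subset n} → A ∈ᶠ 𝒜 → x ∈ A)

NonTrivial : ∀ {n k} → Family n k → Set
NonTrivial 𝒜 = ¬ Star 𝒜

CrossIntersecting : ∀ {n k l} → Family n k → Family n l → Set
CrossIntersecting 𝒜 ℬ = ∀ {A B} → A ∈ᶠ 𝒜 → B ∈ᶠ ℬ → Nonempty (A ∩ B)

NonTrivialCrossIntersecting : ∀ {n k l} → Family n k → Family n l → Set
NonTrivialCrossIntersecting 𝒜 ℬ =
  CrossIntersecting 𝒜 ℬ × NonTrivial 𝒜 × NonTrivial ℬ

-- For 1 ≤ k < n no subtraction here is truncated at zero.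
h : ℕ → ℕ → ℕ
h n k = ((n ∸ 1) C (k ∸ 1) ∸ (n ∸ k ∸ 1) C (k ∸ 1)) + 1

{-# OPTIONS --safe #-}

-- Let d = C(n-2,k-2) and h = h n k.  Sort the members of ℬ by the first element of a fixed A ∈ 𝒜
-- that they contain.  Since 𝒜 is not a star, log-concavity of t ↦ C(t,k-2) gives d |ℬ| ≤ (h-1)², which settles the
-- case |𝒜| ≤ d; for shifted families the same works for |𝒜| ≤ d + 1.  Otherwise both families are shifted.
--
-- If they become shifted without one of them turning into a star, then |𝒜| + |ℬ| ≤ 2h, by induction on n through
-- removal of the largest element n.  For n = 2k this is the pairing of complements.  In the step, a shifted family
-- with at least d members confines a family cross-intersecting it to at most as many sets as meet a fixed pair,
-- and with this all the bounds obey Pascal's rule exactly.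
--
-- If a shift turns 𝒜 into a star, then 𝒜 is covered by a pair {1,2}, and no set avoiding 1 and 2 can be completed
-- to a member of 𝒜 by 1 as well as by 2.  Splitting both families according to 1 and 2, and applying to the parts
-- the bounds |P| + |Q| ≤ h and |P| + |Q| ≤ h - d that follow from the shifted case, leaves an elementary inequality.
module Submission where

open import Defs
open import Data.Bool using (Bool; true; false; not; _∧_; _∨_; T; if_then_else_)
open import Data.Bool.Properties using (∧-zeroʳ; ∧-identityʳ)
import Data.Bool.Properties as Bool
open import Data.Empty using (⊥; ⊥-elim)
open import Data.Fin using (Fin; fromℕ) renaming (zero to 0F; suc to sucF)
open import Data.Fin.Subset using (Subset; inside; outside; ∣_∣; ∁; _∈_; _∪_)
open import Data.Fin.Subset.Properties using (∣p∣≤n; x∈p∩q⁻)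
open import Data.List using (List; length) renaming ([] to []ˡ; _∷_ to _∷ˡ_)
open import Data.List.Membership.Propositional using () renaming (_∈_ to _∈ˡ_)
import Data.List.Membership.DecPropositional as DecMembership
open import Data.List.Relation.Unary.All using () renaming (lookup to lookupᴬ)
open import Data.List.Relation.Unary.AllPairs using ([]; _∷_)
open import Data.List.Relation.Unary.Unique.Propositional using (Unique)
open import Data.Nat using (ℕ; zero; suc; _+_; _*_; _^_; _∸_; _≤_; _≥_; _<_; z≤n; s≤s; _≡ᵇ_; _<ᵇ_; _≤ᵇ_; _≤?_; _<?_; NonZero; >-nonZero)
open import Data.Nat.Combinatorics using (_C_; nCk+nC[k+1]≡[n+1]C[k+1]; k>n⇒nCk≡0)
open import Data.Nat.Properties
open import Data.Nat.Tactic.RingSolver using (solve-∀)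
open import Data.Product using (_×_; _,_; ∃; ∃-syntax; proj₁; proj₂)
open import Data.Sum using (_⊎_; inj₁; inj₂)
open import Data.Unit using (⊤; tt)
open import Data.Vec using ([]; _∷_; lookup; _[_]≔_; here; there)
open import Data.Vec.Properties using (≡-dec; lookup⇒[]=)
open import Function using (_∘_)
open import Relation.Binary.PropositionalEquality
open import Relation.Nullary using (¬_; Dec; does; yes; no; contradiction)
open import Relation.Nullary.Decidable using (dec-true; from-yes)

-- Binomial coefficients, families and shiftedness

-- Two obstacles shape the proof. A shift may turn a non-trivial family into a star, and
-- `|𝒜| + |ℬ| ≤ 2h` fails when one family is small: two disjoint k-sets against all k-sets that meet
-- both exceed it for large n. So a size threshold is unavoidable. The number d of k-sets through a
-- fixed pair is the right one, because on `k + l` points the sets through a pair and the sets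
-- meeting that pair are tight for the pairing of complements. The subtracted binomial in h has a
-- local origin: a shifted family with a member avoiding 1 contains every k-subset of the first k +
-- 1 points, so each member of the other family has two elements there. In a star at 1 this excludes
-- the C(n-k-1,k-1) sets whose other elements all lie beyond k + 1. The final + 1 makes 2h equal to
-- C(2k,k) at n = 2k. The lower bounds that the induction needs do not rest on Kruskal-Katona; for
-- this one threshold a shadow estimate follows from shiftedness alone.

lin : ∀ {u v x y} s → u ≤ v → x + v + s ≡ y + u → x ≤ y
-- A certificate for linear arithmetic: the hypothesis `u ≤ v`, usually a sum of several
-- inequalities, and the slack `s` are supplied by hand; the identity combining them is left to the
-- ring solver.
lin {u} {v} {x} {y} s p eq = +-cancelʳ-≤ v x y (begin
  x + v      ≤⟨ m≤m+n (x + v) s ⟩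
  x + v + s  ≡⟨ eq ⟩
  y + u      ≤⟨ +-monoʳ-≤ y p ⟩
  y + v      ∎)
  where open ≤-Reasoning

-- Pascal's recursion holds by computation here, which fits the splitting of a family at the largest
-- element; `binom-C` leads back to `_C_`.
binom : ℕ → ℕ → ℕ
binom n       zero    = 1
binom zero    (suc k) = 0
binom (suc n) (suc k) = binom n k + binom n (suc k)

binom-zero : ∀ {n k} → n < k → binom n k ≡ 0
binom-zero {zero}  {suc k} _       = refl
binom-zero {suc n} {suc k} (s≤s p) = cong₂ _+_ (binom-zero p) (binom-zero (m≤n⇒m≤1+n p))

binom-diag : ∀ n → binom n n ≡ 1
binom-diag zero    = refl
binom-diag (suc n) = cong₂ _+_ (binom-diag n) (binom-zero (n<1+n n))

binom-sym : ∀ a b → binom (a + b) a ≡ binom (a + b) b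
binom-sym zero    b       = sym (binom-diag b)
binom-sym (suc a) zero    = trans (cong (λ x → binom (suc x) (suc a)) (+-identityʳ a)) (binom-diag (suc a))
binom-sym (suc a) (suc b) = begin
  binom (a + suc b) a + binom (a + suc b) (suc a)  ≡⟨ cong₂ _+_ (binom-sym a (suc b)) eq ⟩
  binom (a + suc b) (suc b) + binom (a + suc b) b  ≡⟨ +-comm (binom (a + suc b) (suc b)) _ ⟩
  binom (a + suc b) b + binom (a + suc b) (suc b)  ∎
  where
  open ≡-Reasoning
  eq : binom (a + suc b) (suc a) ≡ binom (a + suc b) b
  eq rewrite +-suc a b = binom-sym (suc a) b

binom-pos : ∀ {n k} → k ≤ n → 1 ≤ binom n k
binom-pos {n}     {zero}  _       = s≤s z≤n
binom-pos {suc n} {suc k} (s≤s p) = ≤-trans (binom-pos p) (m≤m+n _ _)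

-- C(n - 2, k - 2) and C(n - 2, k - 1), with value 0 where an argument would be negative.
bothOf oneOf : ℕ → ℕ → ℕ
bothOf (suc (suc n)) (suc (suc k)) = binom n k
bothOf _             _             = 0
oneOf  (suc (suc n)) (suc k)       = binom n k
oneOf  _             _             = 0

bothOf-pascal : ∀ {n} k → 2 ≤ n → bothOf (suc n) (suc k) ≡ bothOf n k + bothOf n (suc k)
bothOf-pascal zero          (s≤s (s≤s _)) = refl
bothOf-pascal (suc zero)    (s≤s (s≤s _)) = refl
bothOf-pascal (suc (suc k)) (s≤s (s≤s _)) = refl

oneOf-pascal : ∀ {n} k → 2 ≤ n → oneOf (suc n) (suc k) ≡ oneOf n k + oneOf n (suc k)
oneOf-pascal zero    (s≤s (s≤s _)) = refl
oneOf-pascal (suc k) (s≤s (s≤s _)) = refl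

star-split : ∀ {n} k → 2 ≤ n → bothOf n (suc k) + oneOf n (suc k) ≡ binom (n ∸ 1) k
star-split zero    (s≤s (s≤s _)) = refl
star-split (suc k) (s≤s (s≤s _)) = refl

bothOf-pos : ∀ {n k} → 2 ≤ k → k ≤ n → 1 ≤ bothOf n k
bothOf-pos (s≤s (s≤s _)) (s≤s (s≤s p)) = binom-pos p

-- A Boolean predicate makes removal of the largest element a partial application, and shifting a
-- pointwise `∧` or `∨`.
Fam : ℕ → Set
Fam n = Subset n → Bool

infix 4 _∋_
_∋_ : ∀ {n} → Fam n → Subset n → Set
f ∋ A = f A ≡ true

lo hi : ∀ {n} → Fam (suc n) → Fam n
lo f A = f (outside ∷ A)
hi f A = f (inside ∷ A)

∑ : ∀ {n} → (Subset n → ℕ) → ℕ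
∑ {zero}  u = u []
∑ {suc n} u = ∑ (λ A → u (outside ∷ A)) + ∑ (λ A → u (inside ∷ A))

∑-mono : ∀ {n} {u v : Subset n → ℕ} → (∀ A → u A ≤ v A) → ∑ u ≤ ∑ v
∑-mono {zero}  p = p []
∑-mono {suc n} p = +-mono-≤ (∑-mono (λ A → p (outside ∷ A))) (∑-mono (λ A → p (inside ∷ A)))

∑-cong : ∀ {n} {u v : Subset n → ℕ} → (∀ A → u A ≡ v A) → ∑ u ≡ ∑ v
∑-cong {zero}  p = p []
∑-cong {suc n} p = cong₂ _+_ (∑-cong (λ A → p (outside ∷ A))) (∑-cong (λ A → p (inside ∷ A)))

∑-+ : ∀ {n} (u v : Subset n → ℕ) → ∑ (λ A → u A + v A) ≡ ∑ u + ∑ v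
∑-+ {zero}  u v = refl
∑-+ {suc n} u v = trans (cong₂ _+_ (∑-+ (λ A → u (outside ∷ A)) (λ A → v (outside ∷ A)))
                                   (∑-+ (λ A → u (inside ∷ A)) (λ A → v (inside ∷ A))))
                        (interchange (∑ (λ A → u (outside ∷ A))) _ _ _)
  where
  interchange : ∀ a b c d → (a + b) + (c + d) ≡ (a + c) + (b + d)
  interchange = solve-∀

⟦_⟧ : Bool → ℕ
⟦ false ⟧ = 0
⟦ true  ⟧ = 1

count : ∀ {n} → Fam n → ℕ
count f = ∑ (λ A → ⟦ f A ⟧)

⟦⟧-mono : ∀ {a b} → (a ≡ true → b ≡ true) → ⟦ a ⟧ ≤ ⟦ b ⟧
⟦⟧-mono {false}         _ = z≤n
⟦⟧-mono {true}  {true}  _ = ≤-refl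
⟦⟧-mono {true}  {false} p = contradiction (p refl) λ ()

count-mono : ∀ {n} {f g : Fam n} → (∀ A → f ∋ A → g ∋ A) → count f ≤ count g
count-mono p = ∑-mono (λ A → ⟦⟧-mono (p A))

search : ∀ {n} (f : Fam n) → (∃[ A ] f ∋ A) ⊎ (∀ A → f A ≡ false)
search {zero}  f with f [] in eq
... | true  = inj₁ ([] , eq)
... | false = inj₂ λ { [] → eq }
search {suc n} f with search (lo f) | search (hi f)
... | inj₁ (A , p) | _            = inj₁ (outside ∷ A , p)
... | inj₂ _       | inj₁ (A , p) = inj₁ (inside ∷ A , p)
... | inj₂ p       | inj₂ q       = inj₂ λ { (outside ∷ A) → p A ; (inside ∷ A) → q A }

count-none : ∀ {n} {f : Fam n} → (∀ A → f A ≡ false) → count f ≡ 0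
count-none {zero}  p = cong ⟦_⟧ (p [])
count-none {suc n} p = cong₂ _+_ (count-none (λ A → p (outside ∷ A))) (count-none (λ A → p (inside ∷ A)))

false-of : ∀ {b} → ¬ (b ≡ true) → b ≡ false
false-of {false} _ = refl
false-of {true}  p = contradiction refl p

count-empty : ∀ {n} {f : Fam n} → (∀ A → ¬ f ∋ A) → count f ≡ 0
count-empty p = count-none (λ A → false-of (p A))

count-pos : ∀ {n} {f : Fam n} A → f ∋ A → 1 ≤ count f
count-pos {f = f} []            p = ≤-reflexive (sym (cong ⟦_⟧ p))
count-pos {f = f} (outside ∷ A) p = ≤-trans (count-pos {f = lo f} A p) (m≤m+n _ _)
count-pos {f = f} (inside ∷ A)  p = ≤-trans (count-pos {f = hi f} A p) (m≤n+m _ _)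

count-witness : ∀ {n} {f : Fam n} → 1 ≤ count f → ∃[ A ] f ∋ A
count-witness {f = f} p with search f
... | inj₁ w = w
... | inj₂ q = contradiction p (subst (λ x → ¬ 1 ≤ x) (sym (count-none q)) λ ())

Uni : ∀ {n} → ℕ → Fam n → Set
Uni k f = ∀ A → f ∋ A → ∣ A ∣ ≡ k

uni-lo : ∀ {n k} {f : Fam (suc n)} → Uni k f → Uni k (lo f)
uni-lo u A = u (outside ∷ A)

uni-hi : ∀ {n k} {f : Fam (suc n)} → Uni (suc k) f → Uni k (hi f)
uni-hi u A p = suc-injective (u (inside ∷ A) p)

uni-hi-zero : ∀ {n} {f : Fam (suc n)} → Uni 0 f → ∀ A → ¬ hi f ∋ A
uni-hi-zero u A p with () ← u (inside ∷ A) p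

size : ∀ {n} → ℕ → Fam n
size k A = ∣ A ∣ ≡ᵇ k

≡ᵇ-true : ∀ {m n} → m ≡ n → (m ≡ᵇ n) ≡ true
≡ᵇ-true {zero}  refl = refl
≡ᵇ-true {suc m} refl = ≡ᵇ-true {m} refl

true-≡ᵇ : ∀ m n → (m ≡ᵇ n) ≡ true → m ≡ n
true-≡ᵇ m n p = ≡ᵇ⇒≡ m n (subst T (sym p) tt)

count-size : ∀ n k → count {n} (size k) ≡ binom n k
count-size zero    zero    = refl
count-size zero    (suc k) = refl
count-size (suc n) zero    = cong₂ _+_ (count-size n 0) (count-empty {f = hi (size {suc n} 0)} (λ A ()))
count-size (suc n) (suc k) = trans (cong₂ _+_ (count-size n (suc k)) (count-size n k)) (+-comm (binom n (suc k)) _)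

count-∁ : ∀ {n} (f : Fam n) → count (f ∘ ∁) ≡ count f
count-∁ {zero}  f = refl
count-∁ {suc n} f = trans (cong₂ _+_ (count-∁ (hi f)) (count-∁ (lo f))) (+-comm (count (hi f)) _)

data Meet : ∀ {n} → Subset n → Subset n → Set where
  here  : ∀ {n} {A B : Subset n} → Meet (inside ∷ A) (inside ∷ B)
  there : ∀ {n s t} {A B : Subset n} → Meet A B → Meet (s ∷ A) (t ∷ B)

Meet-∁ : ∀ {n} {A : Subset n} → ¬ Meet A (∁ A)
Meet-∁ {A = _ ∷ A} (there m) = Meet-∁ m

∣∁∣ : ∀ {n} (A : Subset n) → ∣ ∁ A ∣ + ∣ A ∣ ≡ n
∣∁∣ []            = refl
∣∁∣ (outside ∷ A) = cong suc (∣∁∣ A)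
∣∁∣ (inside ∷ A)  = trans (+-suc ∣ ∁ A ∣ ∣ A ∣) (cong suc (∣∁∣ A))

Cross : ∀ {n} → Fam n → Fam n → Set
Cross f g = ∀ A B → f ∋ A → g ∋ B → Meet A B

meet-sym : ∀ {n} {A B : Subset n} → Meet A B → Meet B A
meet-sym here      = here
meet-sym (there m) = there (meet-sym m)

cross-sym : ∀ {n} {f g : Fam n} → Cross f g → Cross g f
cross-sym c A B p q = meet-sym (c B A q p)

-- A set and its complement are disjoint, so no set lies in f while its complement lies in g.
cross-complement : ∀ {n k l} {f g : Fam n} → n ≡ k + l → Uni k f → Uni l g → Cross f g →
  count f + count g ≤ binom n k
cross-complement {n} {k} {l} {f} {g} n≡k+l uf ug c = begin
  count f + count g                      ≡⟨ cong (count f +_) (sym (count-∁ g)) ⟩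
  count f + count (g ∘ ∁)                ≡⟨ sym (∑-+ (λ A → ⟦ f A ⟧) (λ A → ⟦ g (∁ A) ⟧)) ⟩
  ∑ (λ A → ⟦ f A ⟧ + ⟦ g (∁ A) ⟧)        ≤⟨ ∑-mono pointwise ⟩
  count {n} (size k)                     ≡⟨ count-size n k ⟩
  binom n k                              ∎
  where
  open ≤-Reasoning
  eq : ∀ A → g ∋ ∁ A → ∣ A ∣ ≡ k
  eq A q = +-cancelˡ-≡ l _ _ (trans (cong (_+ ∣ A ∣) (sym (ug (∁ A) q))) (trans (∣∁∣ A) (trans n≡k+l (+-comm k l))))
  pointwise : ∀ A → ⟦ f A ⟧ + ⟦ g (∁ A) ⟧ ≤ ⟦ size k A ⟧
  pointwise A with f A in p | g (∁ A) in q
  ... | false | false = z≤n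
  ... | true  | false rewrite ≡ᵇ-true (uf A p) = ≤-refl
  ... | true  | true  = ⊥-elim (Meet-∁ (c A (∁ A) p q))
  ... | false | true  rewrite ≡ᵇ-true (eq A q) = ≤-refl

cross-lo-lo : ∀ {n} {f g : Fam (suc n)} → Cross f g → Cross (lo f) (lo g)
cross-lo-lo c A B p q with there m ← c _ _ p q = m

cross-lo-hi : ∀ {n} {f g : Fam (suc n)} → Cross f g → Cross (lo f) (hi g)
cross-lo-hi c A B p q with there m ← c _ _ p q = m

cross-hi-lo : ∀ {n} {f g : Fam (suc n)} → Cross f g → Cross (hi f) (lo g)
cross-hi-lo c A B p q with there m ← c _ _ p q = m

-- Shifted families and the threshold C(n-2,k-2)

infix 4 _⋖_
data _⋖_ : ∀ {n} → Subset n → Subset n → Set where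
  add  : ∀ {n} {A : Subset n} → (outside ∷ A) ⋖ (inside ∷ A)
  keep : ∀ {n s} {A B : Subset n} → A ⋖ B → (s ∷ A) ⋖ (s ∷ B)

⋖-size : ∀ {n} {A B : Subset n} → A ⋖ B → ∣ B ∣ ≡ suc ∣ A ∣
⋖-size add                  = refl
⋖-size (keep {s = true} p)  = cong suc (⋖-size p)
⋖-size (keep {s = false} p) = ⋖-size p

-- The head of a vector is the largest element of the ground set and its last entry the smallest;
-- the condition on hi and lo says that the largest element can be replaced by any smaller one.
Shifted : ∀ {n} → Fam n → Set
Shifted {zero}  f = ⊤
Shifted {suc n} f = Shifted (lo f) × Shifted (hi f) × (∀ {A B} → A ⋖ B → hi f ∋ A → lo f ∋ B)

avoid-or-meet : ∀ {n} (A B : Subset n) → ∣ A ∣ + ∣ B ∣ < n → Meet A B ⊎ ∃[ A′ ] (A ⋖ A′ × ¬ Meet A′ B)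
avoid-or-meet []            []            ()
avoid-or-meet (inside ∷ A)  (inside ∷ B)  p = inj₁ here
avoid-or-meet (inside ∷ A)  (outside ∷ B) (s≤s p) with avoid-or-meet A B p
... | inj₁ m            = inj₁ (there m)
... | inj₂ (A′ , c , ¬m) = inj₂ (inside ∷ A′ , keep c , λ { (there m) → ¬m m })
avoid-or-meet (outside ∷ A) (inside ∷ B)  p with avoid-or-meet A B (≤-trans (≤-reflexive (sym (+-suc ∣ A ∣ ∣ B ∣))) (≤-pred p))
... | inj₁ m            = inj₁ (there m)
... | inj₂ (A′ , c , ¬m) = inj₂ (outside ∷ A′ , keep c , λ { (there m) → ¬m m })
avoid-or-meet (outside ∷ A) (outside ∷ B) p with search-meet A B
  where
  search-meet : ∀ {n} (A B : Subset n) → Meet A B ⊎ ¬ Meet A B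
  search-meet []            []            = inj₂ λ ()
  search-meet (inside ∷ A)  (inside ∷ B)  = inj₁ here
  search-meet (outside ∷ A) (t ∷ B)       with search-meet A B
  ... | inj₁ m  = inj₁ (there m)
  ... | inj₂ ¬m = inj₂ λ { (there m) → ¬m m }
  search-meet (inside ∷ A)  (outside ∷ B) with search-meet A B
  ... | inj₁ m  = inj₁ (there m)
  ... | inj₂ ¬m = inj₂ λ { (there m) → ¬m m }
... | inj₁ m  = inj₁ (there m)
... | inj₂ ¬m = inj₂ (inside ∷ A , add , λ { (there m) → ¬m m })

-- Suppose `A` and `B` are disjoint. As `k + l < n`, some point lies in neither, and in the member
-- `inside ∷ A` of `f` the largest element can be replaced by that point. The result misses
-- `inside ∷ B`.
cross-hi-hi : ∀ {n k l} {f g : Fam (suc n)} → Shifted f → Uni (suc k) f → Uni (suc l) g →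
  k + l < n → Cross f g → Cross (hi f) (hi g)
cross-hi-hi {n} (_ , _ , sh) uf ug k+l<n c A B p q
  with avoid-or-meet A B (subst₂ (λ x y → x + y < n) (sym (uni-hi uf A p)) (sym (uni-hi ug B q)) k+l<n)
... | inj₁ m             = m
... | inj₂ (A′ , A⋖A′ , ¬m) with there m ← c _ _ (sh A⋖A′ p) q = contradiction m ¬m

up-exists : ∀ {n} (A : Subset n) → ∣ A ∣ < n → ∃[ B ] A ⋖ B
up-exists []            ()
up-exists (outside ∷ A) _       = inside ∷ A , add
up-exists (inside ∷ A)  (s≤s p) with up-exists A p
... | B , c = inside ∷ B , keep c

≤-other : ∀ {a b x y} → a + b ≤ x + y → ¬ b ≤ x → a ≤ y
≤-other {a} {b} {x} {y} p q = <⇒≤ (lin 0 (+-mono-≤ p (≰⇒> q)) (eq a b x y))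
  where
  eq : ∀ a b x y → suc a + (x + y + b) + 0 ≡ y + (a + b + suc x)
  eq = solve-∀

bothOf-small : ∀ {n k} → n ≤ 1 → 2 ≤ k → bothOf (suc n) (suc k) ≡ 0
bothOf-small z≤n       _             = refl
bothOf-small (s≤s z≤n) (s≤s (s≤s _)) = refl

-- By Pascal's rule, if too few members lack the largest element, then many contain it;
-- `shadow-bound` applies to these, because shiftedness puts everything above a set of `hi f` into
-- `lo f`. For `k = 2` the threshold is 1 and a single member suffices.
lo-bound : ∀ n {k} {f : Fam (suc n)} → 2 ≤ n → 2 ≤ k → Shifted f → Uni k f →
  bothOf (suc n) k ≤ count f → bothOf n k ≤ count (lo f)
-- Adding the largest element embeds `lo f` in `hi g`, and `lo g` contains everything above `lo f`;
-- so both summands of Pascal's rule are supplied by `lo f`, which is large by `lo-bound`.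
shadow-bound : ∀ n {k} {f g : Fam n} → 2 ≤ n → 2 ≤ k → Shifted f → Uni k f →
  (∀ {A B} → A ⋖ B → f ∋ A → g ∋ B) → bothOf n k ≤ count f → bothOf n (suc k) ≤ count g

lo-bound n {suc (suc zero)} {f} 2≤n@(s≤s (s≤s _)) _ sh u p with count-witness {f = f} p
... | outside ∷ A , q = count-pos {f = lo f} A q
... | inside ∷ A  , q with up-exists A (subst (_< n) (sym (uni-hi u A q)) 2≤n)
...   | B , A⋖B = count-pos {f = lo f} B (proj₂ (proj₂ sh) A⋖B q)
lo-bound n {suc (suc (suc j))} {f} 2≤n _ sh@(_ , sh-hi , up) u p with bothOf n (3 + j) ≤? count (lo f)
... | yes q = q
... | no ¬q = shadow-bound n 2≤n (s≤s (s≤s z≤n)) sh-hi (uni-hi u) up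
                (≤-other (subst (_≤ count f) (bothOf-pascal (2 + j) 2≤n) p) ¬q)
lo-bound n {suc zero} _ (s≤s ())

shadow-bound (suc n) {k} {f} {g} 2≤sn 2≤k sh u up p with 2 ≤? n
... | no ¬q = ≤-trans (≤-reflexive (bothOf-small (≤-pred (≰⇒> ¬q)) 2≤k)) z≤n
... | yes 2≤n = begin
  bothOf (suc n) (suc k)             ≡⟨ bothOf-pascal k 2≤n ⟩
  bothOf n k + bothOf n (suc k)      ≤⟨ +-mono-≤ (≤-trans (lo-bound n 2≤n 2≤k sh u p) (count-mono {f = lo f} {g = hi g} (λ A → up add)))
                                                 (shadow-bound n 2≤n 2≤k (proj₁ sh) (uni-lo u) (λ c → up (keep c)) (lo-bound n 2≤n 2≤k sh u p)) ⟩
  count (hi g) + count (lo g)        ≡⟨ +-comm (count (hi g)) _ ⟩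
  count g                            ∎
  where open ≤-Reasoning

binom-split₂ : ∀ n l → binom (2 + n) l ≡ bothOf (2 + n) l + 2 * oneOf (2 + n) l + binom n l
binom-split₂ n zero          = refl
binom-split₂ n (suc zero)    = refl
binom-split₂ n (suc (suc l)) = eq (binom n l) _ _
  where
  eq : ∀ a b c → a + b + (b + c) ≡ a + 2 * b + c
  eq = solve-∀

-- bothOf n l + 2 * oneOf n l is the number of l-sets that meet a fixed pair of points.
cross-bound : ∀ n {k l} {f g : Fam n} → 2 ≤ k → k + l ≤ n → Shifted f → Uni k f → Uni l g → Cross f g →
  bothOf n k ≤ count f → count g ≤ bothOf n l + 2 * oneOf n l
cross-bound n {suc (suc k)} {l} {f} {g} 2≤k k+l≤n sh uf ug c p with m≤n⇒m<n∨m≡n k+l≤n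
-- On `k + l` points the complements of the members of `f` are lost for `g`. By symmetry C(n-2,k-2)
-- = C(n-2,l), the number of l-sets that miss the pair, so the loss is exactly right.
... | inj₂ refl = lin 0 (+-mono-≤ (cross-complement {g = f} (+-comm (2 + k) l) ug uf (cross-sym c)) p) (begin
  count g + (binom (2 + (k + l)) l + count f) + 0                    ≡⟨ cong (λ x → count g + (x + count f) + 0) split ⟩
  count g + (b₂ + 2 * b₁ + binom (k + l) k + count f) + 0            ≡⟨ eq (count g) b₂ b₁ (binom (k + l) k) (count f) ⟩
  b₂ + 2 * b₁ + (count g + count f + binom (k + l) k)                ∎)
  where
  open ≡-Reasoning
  b₂ = bothOf (2 + (k + l)) l
  b₁ = oneOf (2 + (k + l)) l
  split : binom (2 + (k + l)) l ≡ b₂ + 2 * b₁ + binom (k + l) k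
  split = trans (binom-split₂ (k + l) l) (cong (b₂ + 2 * b₁ +_) (sym (binom-sym k l)))
  eq : ∀ g a b c f → g + (a + 2 * b + c + f) + 0 ≡ a + 2 * b + (g + f + c)
  eq = solve-∀
cross-bound (suc n) {k} {zero} {f} {g} 2≤k _ sh uf ug c p | inj₁ (s≤s k+l≤n) = begin
  count (lo g) + count (hi g)                  ≡⟨ cong (count (lo g) +_) (count-empty {f = hi g} (uni-hi-zero ug)) ⟩
  count (lo g) + 0                             ≤⟨ +-mono-≤ (cross-bound n 2≤k k+l≤n (proj₁ sh) (uni-lo uf) (uni-lo ug) (cross-lo-lo c) q) z≤n ⟩
  bothOf n 0 + 2 * oneOf n 0 + 0               ≡⟨ zeros 2≤n ⟩
  0                                            ≤⟨ z≤n ⟩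
  bothOf (suc n) 0 + 2 * oneOf (suc n) 0       ∎
  where
  open ≤-Reasoning
  2≤n : 2 ≤ n
  2≤n = ≤-trans 2≤k (≤-trans (m≤m+n k 0) k+l≤n)
  q = lo-bound n 2≤n 2≤k sh uf p
  zeros : ∀ {n} → 2 ≤ n → bothOf n 0 + 2 * oneOf n 0 + 0 ≡ 0
  zeros (s≤s (s≤s _)) = refl
-- Both halves of `g` are compared with `lo f`, which stays above the threshold by `lo-bound`.
cross-bound (suc n) {k} {suc l} {f} {g} 2≤k _ sh uf ug c p | inj₁ (s≤s k+l≤n) = begin
  count (lo g) + count (hi g)
    ≤⟨ +-mono-≤ (cross-bound n 2≤k k+l≤n (proj₁ sh) (uni-lo uf) (uni-lo ug) (cross-lo-lo c) q)
                (cross-bound n {g = hi g} 2≤k k+l≤n′ (proj₁ sh) (uni-lo uf) (uni-hi ug) (cross-lo-hi c) q) ⟩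
  (bothOf n (suc l) + 2 * oneOf n (suc l)) + (bothOf n l + 2 * oneOf n l)
    ≡⟨ eq (bothOf n (suc l)) (oneOf n (suc l)) (bothOf n l) (oneOf n l) ⟩
  (bothOf n l + bothOf n (suc l)) + 2 * (oneOf n l + oneOf n (suc l))
    ≡⟨ cong₂ (λ x y → x + 2 * y) (sym (bothOf-pascal l 2≤n)) (sym (oneOf-pascal l 2≤n)) ⟩
  bothOf (suc n) (suc l) + 2 * oneOf (suc n) (suc l)  ∎
  where
  open ≤-Reasoning
  k+l≤n′ : k + l ≤ n
  k+l≤n′ = ≤-trans (+-monoʳ-≤ k (n≤1+n l)) k+l≤n
  2≤n : 2 ≤ n
  2≤n = ≤-trans 2≤k (≤-trans (m≤m+n k l) k+l≤n′)
  q : bothOf n k ≤ count (lo f)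
  q = lo-bound n 2≤n 2≤k sh uf p
  eq : ∀ a b c d → (a + 2 * b) + (c + 2 * d) ≡ (c + a) + 2 * (d + b)
  eq = solve-∀
cross-bound n {suc zero} (s≤s ())

meet-outside : ∀ {n t} {A B : Subset n} → Meet (outside ∷ A) (t ∷ B) → Meet A B
meet-outside (there m) = m

count-singletons : ∀ {n} {f : Fam n} (B : Subset n) → Uni 1 f → (∀ A → f ∋ A → Meet A B) → count f ≤ ∣ B ∣
count-singletons {f = f} [] u m = ≤-reflexive (count-empty {f = f} λ { [] p → contradiction (m [] p) λ () })
count-singletons {suc n} {f} (outside ∷ B) u m = begin
  count (lo f) + count (hi f)  ≡⟨ cong (count (lo f) +_) (count-empty {f = hi f} none) ⟩
  count (lo f) + 0             ≡⟨ +-identityʳ _ ⟩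
  count (lo f)                 ≤⟨ count-singletons {f = lo f} B (uni-lo u) (λ A p → meet-outside (m _ p)) ⟩
  ∣ B ∣                        ∎
  where
  open ≤-Reasoning
  no-meet : ∀ {n} (A B : Subset n) → ∣ A ∣ ≡ 0 → ¬ Meet A B
  no-meet (outside ∷ A) (t ∷ B) e (there m) = no-meet A B e m
  none : ∀ A → ¬ hi f ∋ A
  none A p with there q ← m _ p = no-meet A B (uni-hi u A p) q
count-singletons {suc n} {f} (inside ∷ B) u m = begin
  count (lo f) + count (hi f)  ≤⟨ +-mono-≤ (count-singletons {f = lo f} B (uni-lo u) (λ A p → meet-outside (m _ p)))
                                           (≤-trans (count-mono {f = hi f} {g = size 0} (λ A p → ≡ᵇ-true (uni-hi u A p)))
                                                    (≤-reflexive (count-size n 0))) ⟩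
  ∣ B ∣ + 1                    ≡⟨ +-comm ∣ B ∣ 1 ⟩
  suc ∣ B ∣                    ∎
  where
  open ≤-Reasoning

middle-binom : ∀ {n} k → n ≡ suc k + suc k → binom n (suc k) ≡ 2 * binom (n ∸ 1) k
middle-binom k refl = cong (binom (k + suc k) k +_) (trans (sym (binom-sym k (suc k))) (sym (+-identityʳ _)))

-- The thresholds rule out a tiny family against a huge one, where the sum can be larger. They pass
-- to the `lo` parts by `lo-bound`, and the `hi` parts remain cross-intersecting by `cross-hi-hi`.
-- For 1-sets `bothOf` is 0, hence the separate conditions `1 ≤ count`.
sum-bound : ∀ n {k} {f g : Fam n} → suc k + suc k ≤ n → Shifted f → Shifted g → Uni (suc k) f → Uni (suc k) g →
  Cross f g → 1 ≤ count f → 1 ≤ count g → bothOf n (suc k) ≤ count f → bothOf n (suc k) ≤ count g →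
  count f + count g ≤ 2 * binom (n ∸ 1) k
sum-bound n {zero} {f} {g} _ _ _ uf ug c 1≤f 1≤g _ _
  with count-witness {f = f} 1≤f | count-witness {f = g} 1≤g
... | A , p | B , q = +-mono-≤ (≤-trans (count-singletons B uf (λ A r → c A B r q)) (≤-reflexive (ug B q)))
                               (≤-trans (count-singletons A ug (λ B r → meet-sym (c A B p r))) (≤-reflexive (uf A p)))
sum-bound n {k@(suc k′)} {f} {g} 2k≤n sf sg uf ug c _ _ pf pg with m≤n⇒m<n∨m≡n 2k≤n
... | inj₂ eq = ≤-trans (cross-complement (sym eq) uf ug c) (≤-reflexive (middle-binom k (sym eq)))
sum-bound (suc n) {k@(suc k′)} {f} {g} _ sf sg uf ug c _ _ pf pg | inj₁ (s≤s 2k≤n) =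
  ≤-trans (≤-reflexive (interchange (count (lo f)) (count (hi f)) (count (lo g)) (count (hi g))))
          (≤-trans (+-mono-≤ lo-part hi-part) (≤-reflexive (trans (eq (binom (n ∸ 1) k) (binom (n ∸ 1) k′)) (cong (2 *_) (pascal (≤-trans (s≤s z≤n) 2≤n))))))
  where
  interchange : ∀ a b c d → (a + b) + (c + d) ≡ (a + c) + (b + d)
  interchange = solve-∀
  eq : ∀ a b → 2 * a + 2 * b ≡ 2 * (b + a)
  eq = solve-∀
  pascal : ∀ {n} → 1 ≤ n → binom (n ∸ 1) k′ + binom (n ∸ 1) k ≡ binom n k
  pascal (s≤s _) = refl
  2≤k : 2 ≤ suc k
  2≤k = s≤s (s≤s z≤n)
  k≤n : suc k ≤ n
  k≤n = ≤-trans (m≤m+n (suc k) (suc k)) 2k≤n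
  2≤n : 2 ≤ n
  2≤n = ≤-trans 2≤k k≤n
  qf = lo-bound n 2≤n 2≤k sf uf pf
  qg = lo-bound n 2≤n 2≤k sg ug pg
  lo-part : count (lo f) + count (lo g) ≤ 2 * binom (n ∸ 1) k
  lo-part = sum-bound n 2k≤n (proj₁ sf) (proj₁ sg) (uni-lo uf) (uni-lo ug) (cross-lo-lo c)
    (≤-trans (bothOf-pos 2≤k k≤n) qf) (≤-trans (bothOf-pos 2≤k k≤n) qg) qf qg
  -- A part below the threshold and a part no larger than the family of all sets meeting a pair:
  -- `a + (a + 2b) = 2(a + b)` is exactly twice a full star.
  other : ∀ {x y} → x ≤ bothOf n k → y ≤ bothOf n k + 2 * oneOf n k → x + y ≤ 2 * binom (n ∸ 1) k′
  other {x} {y} p q = ≤-trans (+-mono-≤ p q) (≤-reflexive (trans (eq′ (bothOf n k) (oneOf n k)) (cong (2 *_) (star-split k′ 2≤n))))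
    where
    eq′ : ∀ a b → a + (a + 2 * b) ≡ 2 * (a + b)
    eq′ = solve-∀
  k+k≤n : suc k + k ≤ n
  k+k≤n = ≤-trans (+-monoʳ-≤ (suc k) (n≤1+n k)) 2k≤n
  -- If one of the two parts has at most bothOf n k members, the other is bounded through lo of the opposite family.
  hi-part : count (hi f) + count (hi g) ≤ 2 * binom (n ∸ 1) k′
  hi-part with bothOf n k <? count (hi f) | bothOf n k <? count (hi g)
  ... | yes p | yes q = sum-bound n (≤-trans (n≤1+n (k + k)) (≤-trans (≤-reflexive (sym (+-suc k k))) (≤-trans (n≤1+n _) 2k≤n)))
                          (proj₁ (proj₂ sf)) (proj₁ (proj₂ sg)) (uni-hi uf) (uni-hi ug)
                          (cross-hi-hi sf uf ug k+k≤n c)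
                          (≤-trans (s≤s z≤n) p) (≤-trans (s≤s z≤n) q) (<⇒≤ p) (<⇒≤ q)
  ... | no ¬p | _     = other (≮⇒≥ ¬p) (cross-bound n 2≤k k+k≤n (proj₁ sf) (uni-lo uf) (uni-hi ug) (cross-lo-hi c) qf)
  ... | yes _ | no ¬q = ≤-trans (≤-reflexive (+-comm (count (hi f)) _))
                          (other (≮⇒≥ ¬q) (cross-bound n 2≤k k+k≤n (proj₁ sg) (uni-lo ug) (uni-hi uf) (cross-sym (cross-hi-lo c)) qg))

-- Shifted families on n points: the bound |f| + |g| ≤ 2h

-- The number of elements of a set among the r smallest ones.
low : ∀ {n} → ℕ → Subset n → ℕ
low         r []      = 0
low {suc n} r (s ∷ A) = ⟦ (n <ᵇ r) ∧ s ⟧ + low r A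

<ᵇ-false : ∀ m r → (m + r <ᵇ r) ≡ false
<ᵇ-false m zero    = refl
<ᵇ-false m (suc r) rewrite +-suc m r = <ᵇ-false m r

<ᵇ-true : ∀ {n r} → n < r → (n <ᵇ r) ≡ true
<ᵇ-true {zero}  (s≤s _) = refl
<ᵇ-true {suc n} (s≤s p) = <ᵇ-true p

low-skip : ∀ m r {s} (A : Subset (m + r)) → low r (s ∷ A) ≡ low r A
low-skip m r A rewrite <ᵇ-false m r = refl

low-full : ∀ {n r} (A : Subset n) → n ≤ r → low r A ≡ ∣ A ∣
low-full []            _ = refl
low-full (outside ∷ A) p rewrite <ᵇ-true p = low-full A (<⇒≤ p)
low-full (inside ∷ A)  p rewrite <ᵇ-true p = cong suc (low-full A (<⇒≤ p))

low≤size : ∀ {n} r (A : Subset n) → low r A ≤ ∣ A ∣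
low≤size r []                    = z≤n
low≤size {suc n} r (outside ∷ A) with n <ᵇ r
... | true  = low≤size r A
... | false = low≤size r A
low≤size {suc n} r (inside ∷ A)  with n <ᵇ r
... | true  = s≤s (low≤size r A)
... | false = m≤n⇒m≤1+n (low≤size r A)

-- There are `r + 1` points here: `r` starts as the uniformity of the other family, which contains
-- all r-subsets of the `r + 1` smallest points, and meeting all of these takes two points. In the
-- inductions `r` stays fixed while the uniformity drops.
TwoLow : ∀ {n} → ℕ → Fam n → Set
TwoLow r f = ∀ A → f ∋ A → 2 ≤ low (suc r) A

twoLow-lo : ∀ m r {f : Fam (suc (m + suc r))} → TwoLow r f → TwoLow r (lo f)
twoLow-lo m r t A p = subst (2 ≤_) (low-skip m (suc r) A) (t (outside ∷ A) p)

twoLow-hi : ∀ m r {f : Fam (suc (m + suc r))} → TwoLow r f → TwoLow r (hi f)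
twoLow-hi m r t A p = subst (2 ≤_) (low-skip m (suc r) A) (t (inside ∷ A) p)

twoLow-empty : ∀ {n r} {f : Fam n} → Uni 1 f → TwoLow r f → count f ≡ 0
twoLow-empty {r = r} {f} u t = count-empty {f = f} λ A p →
  contradiction (≤-trans (t A p) (≤-trans (low≤size (suc r) A) (≤-reflexive (u A p)))) λ { (s≤s ()) }

2≤[m+sr] : ∀ m {r} → 1 ≤ r → 2 ≤ m + suc r
2≤[m+sr] m p = ≤-trans (s≤s p) (m≤n+m _ m)

bound-singletons : ∀ m {n} → 2 ≤ n → 0 + 2 * binom m 0 ≤ bothOf n 1 + 2 * oneOf n 1
bound-singletons m (s≤s (s≤s _)) = ≤-refl

bound-plain : ∀ {x m l y} → m < l → x ≤ y → x + 2 * binom m l ≤ y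
bound-plain {x} {m} {l} m<l p rewrite binom-zero m<l = ≤-trans (≤-reflexive (+-identityʳ x)) p

bound-step : ∀ {x₀ x₁} m {n} l → 2 ≤ n →
  x₀ + 2 * binom m (suc l) ≤ bothOf n (2 + l) + 2 * oneOf n (2 + l) →
  x₁ + 2 * binom m l ≤ bothOf n (suc l) + 2 * oneOf n (suc l) →
  (x₀ + x₁) + 2 * binom (suc m) (suc l) ≤ bothOf (suc n) (2 + l) + 2 * oneOf (suc n) (2 + l)
bound-step {x₀} {x₁} m {n} l 2≤n p q
  rewrite bothOf-pascal {n} (suc l) 2≤n | oneOf-pascal {n} (suc l) 2≤n =
  lin 0 (+-mono-≤ p q) (eq x₀ x₁ (binom m l) (binom m (suc l)) (bothOf n (suc l)) (oneOf n (suc l)) (bothOf n (2 + l)) (oneOf n (2 + l)))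
  where
  eq : ∀ x y b c d e f g → (x + y) + 2 * (b + c) + ((f + 2 * g) + (d + 2 * e)) + 0
                         ≡ (d + f) + 2 * (e + g) + ((x + 2 * c) + (y + 2 * b))
  eq = solve-∀

-- The term `2 * binom m l` counts the sets that meet the pair {1,2} but have no second element
-- among the `r + 1` smallest: 1 or 2 with `l` of the `m` larger points. Once `m < l` it vanishes
-- and `cross-bound` is enough; because of `k < r` this happens before the complement pairing is
-- reached.
cross-bound-low : ∀ m r {k} l {f g : Fam (m + suc r)} → 2 ≤ k → k < r → k + suc l ≤ m + suc r →
  Shifted f → Uni k f → Uni (suc l) g → TwoLow r g → Cross f g → bothOf (m + suc r) k ≤ count f →
  count g + 2 * binom m l ≤ bothOf (m + suc r) (suc l) + 2 * oneOf (m + suc r) (suc l)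
cross-bound-low m r zero {g = g} 2≤k k<r _ _ _ ug t _ _ rewrite twoLow-empty {f = g} ug t =
  bound-singletons m (2≤[m+sr] m (≤-trans (s≤s z≤n) k<r))
cross-bound-low m r {k} (suc l) 2≤k k<r k+l≤n sf uf ug t c p with m <? suc l
... | yes m<l = bound-plain m<l (cross-bound (m + suc r) 2≤k k+l≤n sf uf ug c p)
cross-bound-low zero r (suc l) _ _ _ _ _ _ _ _ _ | no ¬q = contradiction (s≤s z≤n) ¬q
cross-bound-low (suc m) r {k} (suc l) {f} {g} 2≤k k<r k+l≤n sf uf ug t c p | no m≮l =
  bound-step {count (lo g)} {count (hi g)} m l 2≤n
    (cross-bound-low m r (suc l) 2≤k k<r k+l≤n′ (proj₁ sf) (uni-lo uf) (uni-lo ug) (twoLow-lo m r t) (cross-lo-lo c) q)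
    (cross-bound-low m r l {g = hi g} 2≤k k<r (≤-trans (+-monoʳ-≤ k (n≤1+n (suc l))) k+l≤n′) (proj₁ sf) (uni-lo uf) (uni-hi ug)
      (twoLow-hi m r t) (cross-lo-hi c) q)
  where
  2≤n : 2 ≤ m + suc r
  2≤n = 2≤[m+sr] m (≤-trans (s≤s z≤n) k<r)
  q : bothOf (m + suc r) k ≤ count (lo f)
  q = lo-bound (m + suc r) 2≤n 2≤k sf uf p
  k+l≤n′ : k + suc (suc l) ≤ m + suc r
  k+l≤n′ = lin 0 (+-mono-≤ k<r (≤-pred (≮⇒≥ m≮l))) (eq k l r m)
    where
    eq : ∀ k l r m → k + suc (suc l) + (r + m) + 0 ≡ m + suc r + (suc k + l)
    eq = solve-∀

-- Some member of the family does not contain the smallest element.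
Avoids₁ : ∀ {n} → Fam n → Set
Avoids₁ f = ∃[ A ] (f ∋ A × low 1 A ≡ 0)

up-avoiding₁ : ∀ {n} (A : Subset n) → low 1 A ≡ 0 → suc ∣ A ∣ < n → ∃[ B ] (A ⋖ B × low 1 B ≡ 0)
up-avoiding₁ {suc zero}    (outside ∷ []) _ (s≤s ())
up-avoiding₁ {suc zero}    (inside ∷ [])  () _
up-avoiding₁ {suc (suc n)} (outside ∷ A)  e _       = inside ∷ A , add , e
up-avoiding₁ {suc (suc n)} (inside ∷ A)   e (s≤s p) with up-avoiding₁ A e p
... | B , c , e′ = inside ∷ B , keep c , e′

avoids₁-lo : ∀ {n k} {f : Fam (suc n)} → Shifted f → Uni k f → k < n → Avoids₁ f → Avoids₁ (lo f)
avoids₁-lo {suc n} sf uf k<n (outside ∷ A , p , e) = A , p , e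
avoids₁-lo {suc n} (_ , _ , up) uf k<n (inside ∷ A , p , e)
  with up-avoiding₁ A e (subst (_< suc n) (sym (uf _ p)) k<n)
... | B , c , e′ = B , up c p , e′

full-unique : ∀ {n} (A B : Subset n) → ∣ A ∣ ≡ n → ∣ B ∣ ≡ n → A ≡ B
full-unique []            []            _ _ = refl
full-unique (outside ∷ A) _             p _ = contradiction (≤-trans (≤-reflexive (sym p)) (∣p∣≤n A)) 1+n≰n
full-unique (inside ∷ A)  (outside ∷ B) _ q = contradiction (≤-trans (≤-reflexive (sym q)) (∣p∣≤n B)) 1+n≰n
full-unique (inside ∷ A)  (inside ∷ B)  p q = cong (inside ∷_) (full-unique A B (suc-injective p) (suc-injective q))

⋖-full : ∀ {n} (A B : Subset n) → suc ∣ A ∣ ≡ n → ∣ B ∣ ≡ n → A ⋖ B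
⋖-full (s ∷ A)       (outside ∷ B) _ q = contradiction (≤-trans (≤-reflexive (sym q)) (∣p∣≤n B)) 1+n≰n
⋖-full (inside ∷ A)  (inside ∷ B)  p q = keep (⋖-full A B (suc-injective p) (suc-injective q))
⋖-full (outside ∷ A) (inside ∷ B)  p q rewrite full-unique A B (suc-injective p) (suc-injective q) = add

low₁-size : ∀ {n} (A : Subset (suc n)) → low 1 A ≡ 0 → ∣ A ∣ ≤ n
low₁-size (outside ∷ [])        _ = z≤n
low₁-size (inside ∷ [])         ()
low₁-size (outside ∷ A@(_ ∷ _)) e = m≤n⇒m≤1+n (low₁-size A e)
low₁-size (inside ∷ A@(_ ∷ _))  e = s≤s (low₁-size A e)

-- On `k + 1` points a member that avoids 1 can only be {2,...,k+1}, which is last in the shifting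
-- order, so that all other k-sets arise from it.
all-subsets : ∀ k {f : Fam (suc k)} → Shifted f → Uni k f → Avoids₁ f → ∀ A → ∣ A ∣ ≡ k → f ∋ A
all-subsets zero    sf uf (outside ∷ [] , p , _) (outside ∷ []) _ = p
all-subsets (suc k) sf uf (outside ∷ A₀ , p , e) A             q =
  contradiction (≤-trans (≤-reflexive (sym (uf _ p))) (low₁-size A₀ e)) 1+n≰n
all-subsets (suc k) sf uf (inside ∷ A₀ , p , e)  (inside ∷ A)  q =
  all-subsets k (proj₁ (proj₂ sf)) (uni-hi uf) (A₀ , p , e) A (suc-injective q)
all-subsets (suc k) sf uf (inside ∷ A₀ , p , e)  (outside ∷ A) q =
  proj₂ (proj₂ sf) (⋖-full A₀ A (uf _ p) q) p

meet-nonempty : ∀ {n} {A B : Subset n} → Meet A B → 1 ≤ ∣ B ∣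
meet-nonempty here                       = s≤s z≤n
meet-nonempty (there {t = inside} m)     = s≤s z≤n
meet-nonempty (there {t = outside} m)    = meet-nonempty m

-- Removing large points leaves the `k + 1` smallest, where `f` contains every k-set by
-- `all-subsets`; a set with at most one point there misses one of these. That a member avoiding 1
-- persists is `avoids₁-lo`.
twoLow : ∀ m k {f : Fam (m + suc k)} → Shifted f → Uni k f → Avoids₁ f →
  ∀ B → (∀ A → f ∋ A → Meet A B) → 2 ≤ low (suc k) B
twoLow zero k {f} sf uf ns B c = subst (2 ≤_) (sym (low-full B ≤-refl)) (two ∣ B ∣ refl)
  where
  two : ∀ b → ∣ B ∣ ≡ b → 2 ≤ b
  two zero          e = contradiction (≤-trans (meet-nonempty (c _ (proj₁ (proj₂ ns)))) (≤-reflexive e)) λ ()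
  two (suc zero)    e = contradiction (meet-sym (c (∁ B) (all-subsets k sf uf ns (∁ B)
    (suc-injective (trans (+-comm 1 ∣ ∁ B ∣) (trans (cong (∣ ∁ B ∣ +_) (sym e)) (∣∁∣ B))))))) Meet-∁
  two (suc (suc b)) e = s≤s (s≤s z≤n)
twoLow (suc m) k {f} sf uf ns (s ∷ B) c = subst (2 ≤_) (sym (low-skip m (suc k) B))
  (twoLow m k (proj₁ sf) (uni-lo uf) (avoids₁-lo sf uf (m≤n+m (suc k) m) ns) B (λ A p → meet-outside (c _ p)))

twoLow-of : ∀ m k {f g : Fam (m + suc k)} → Shifted f → Uni k f → Avoids₁ f → Cross f g → TwoLow k g
twoLow-of m k sf uf ns c B q = twoLow m k sf uf ns B (λ A p → c A B p q)

bothOf-diag : ∀ k → bothOf (2 + k) (suc k) + 2 ≡ binom (2 + k) (suc k)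
bothOf-diag zero    = refl
bothOf-diag (suc k) = begin
  binom (suc k) k + 2                                                           ≡⟨ eq (binom (suc k) k) ⟩
  (binom (suc k) k + 1) + (1 + 0)                                               ≡⟨ sym (cong₂ (λ x y → (binom (suc k) k + x) + (x + y))
                                                                                     (binom-diag (suc k)) (binom-zero (n<1+n (suc k)))) ⟩
  binom (3 + k) (2 + k)                                                         ∎
  where
  open ≡-Reasoning
  eq : ∀ a → a + 2 ≡ (a + 1) + (1 + 0)
  eq = solve-∀

-- The two extra sets are {1,3,…,k+1} and {2,3,…,k+1}.
shadow-bound₂ : ∀ m k {f g : Fam (m + suc (suc k))} → 2 ≤ k → Shifted f → Uni k f → Shifted g → Uni (suc k) g → Avoids₁ g →
  (∀ {A B} → A ⋖ B → f ∋ A → g ∋ B) → bothOf (m + suc (suc k)) k ≤ count f →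
  bothOf (m + suc (suc k)) (suc k) + 2 ≤ count g
shadow-bound₂ zero k {f} {g} 2≤k sf uf sg ug ns up p = begin
  bothOf (2 + k) (suc k) + 2     ≡⟨ bothOf-diag k ⟩
  binom (2 + k) (suc k)          ≡⟨ sym (count-size (2 + k) (suc k)) ⟩
  count {2 + k} (size (suc k))   ≤⟨ count-mono {f = size (suc k)} {g = g} (λ A e → all-subsets (suc k) sg ug ns A (true-≡ᵇ ∣ A ∣ (suc k) e)) ⟩
  count g                        ∎
  where open ≤-Reasoning
shadow-bound₂ (suc m) k {f} {g} 2≤k sf uf sg ug ns up p = begin
  bothOf (suc n) (suc k) + 2                  ≡⟨ cong (_+ 2) (bothOf-pascal k 2≤n) ⟩
  bothOf n k + bothOf n (suc k) + 2           ≡⟨ +-assoc (bothOf n k) _ 2 ⟩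
  bothOf n k + (bothOf n (suc k) + 2)         ≤⟨ +-mono-≤ (≤-trans q (count-mono {f = lo f} {g = hi g} (λ A → up add)))
                                                   (shadow-bound₂ m k 2≤k (proj₁ sf) (uni-lo uf) (proj₁ sg) (uni-lo ug)
                                                     (avoids₁-lo sg ug (m≤n+m (2 + k) m) ns) (λ c → up (keep c)) q) ⟩
  count (hi g) + count (lo g)                 ≡⟨ +-comm (count (hi g)) _ ⟩
  count g                                     ∎
  where
  open ≤-Reasoning
  n = m + suc (suc k)
  2≤n : 2 ≤ n
  2≤n = 2≤[m+sr] m (s≤s z≤n)
  q : bothOf n k ≤ count (lo f)
  q = lo-bound n 2≤n 2≤k sf uf p

lo-bound₂ : ∀ m k {f : Fam (suc m + suc (suc k))} → 2 ≤ k → Shifted f → Uni (suc k) f → Avoids₁ f →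
  bothOf (suc m + suc (suc k)) (suc k) + 2 ≤ count f → bothOf (m + suc (suc k)) (suc k) + 2 ≤ count (lo f)
lo-bound₂ m k {f} 2≤k sf@(s₀ , s₁ , up) uf ns p with bothOf (m + suc (suc k)) (suc k) + 2 ≤? count (lo f)
... | yes q = q
... | no ¬q = shadow-bound₂ m k 2≤k s₁ (uni-hi uf) s₀ (uni-lo uf) (avoids₁-lo sf uf (m≤n+m (2 + k) m) ns) up
  (≤-other (≤-trans (≤-reflexive (trans (sym (+-assoc (bothOf n k) _ 2)) (cong (_+ 2) (sym (bothOf-pascal k (2≤[m+sr] m (s≤s z≤n))))))) p) ¬q)
  where n = m + suc (suc k)

binom-complement : ∀ n k l → n ≡ (2 + l) + (2 + k) →
  binom n (2 + l) ≡ bothOf n (2 + l) + 2 * oneOf n (2 + l) + bothOf n (2 + k)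
binom-complement _ k l refl = trans (binom-split₂ (l + (2 + k)) (2 + l)) (cong (bothOf n (2 + l) + 2 * oneOf n (2 + l) +_)
  (subst (λ x → binom x (2 + l) ≡ binom x k) (eq k l) (sym (binom-sym k (2 + l)))))
  where
  n = 2 + l + (2 + k)
  eq : ∀ k l → k + (2 + l) ≡ l + (2 + k)
  eq = solve-∀

-- Now `r` equals the uniformity of `f`, and the induction does reach the complement pairing, at
-- `m = l`. There the correction is `2 * binom l l = 2`, paid for by two members of `f` beyond the
-- threshold; `lo-bound₂` preserves this surplus on the way.
cross-bound-top : ∀ m k l {f g : Fam (m + suc (suc k))} → 2 ≤ k → l ≤ m →
  Shifted f → Uni (suc k) f → Avoids₁ f → Uni (suc l) g → TwoLow (suc k) g → Cross f g →
  bothOf (m + suc (suc k)) (suc k) + 2 ≤ count f →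
  count g + 2 * binom m l ≤ bothOf (m + suc (suc k)) (suc l) + 2 * oneOf (m + suc (suc k)) (suc l)
cross-bound-top m k zero {g = g} 2≤k _ _ _ _ ug t _ _ rewrite twoLow-empty {f = g} ug t =
  bound-singletons m (2≤[m+sr] m (s≤s z≤n))
cross-bound-top (suc m) k@(suc k′) (suc l) {f} {g} 2≤k l≤m sf uf ns ug t c p with m≤n⇒m<n∨m≡n l≤m
... | inj₁ (s≤s l<m) =
  bound-step {count (lo g)} {count (hi g)} m l (2≤[m+sr] m (s≤s z≤n))
    (cross-bound-top m k (suc l) 2≤k l<m (proj₁ sf) (uni-lo uf) ns₀ (uni-lo ug) (twoLow-lo m (suc k) t) (cross-lo-lo c) q)
    (cross-bound-top m k l {g = hi g} 2≤k (<⇒≤ l<m) (proj₁ sf) (uni-lo uf) ns₀ (uni-hi ug) (twoLow-hi m (suc k) t) (cross-lo-hi c) q)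
  where
  ns₀ = avoids₁-lo sf uf (m≤n+m (2 + k) m) ns
  q = lo-bound₂ m k 2≤k sf uf ns p
... | inj₂ refl = begin
  count g + 2 * binom (suc l) (suc l)  ≡⟨ cong (λ x → count g + 2 * x) (binom-diag (suc l)) ⟩
  count g + 2                          ≤⟨ lin 0 (+-mono-≤ (cross-complement {g = f} n≡ ug uf (cross-sym c)) p) (begin-equality
      count g + 2 + (binom n (2 + l) + count f) + 0
        ≡⟨ cong (λ x → count g + 2 + (x + count f) + 0) split ⟩
      count g + 2 + (b₂ + 2 * b₁ + bothOf n (suc k) + count f) + 0
        ≡⟨ eq (count g) b₂ b₁ (bothOf n (suc k)) (count f) ⟩
      b₂ + 2 * b₁ + (count g + count f + (bothOf n (suc k) + 2)) ∎) ⟩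
  b₂ + 2 * b₁  ∎
  where
  open ≤-Reasoning
  n = suc l + suc (suc k)
  n≡ : n ≡ (2 + l) + (2 + k′)
  n≡ = cong suc (+-suc l (2 + k′))
  b₂ = bothOf n (2 + l)
  b₁ = oneOf n (2 + l)
  split : binom n (2 + l) ≡ b₂ + 2 * b₁ + bothOf n (suc k)
  split = binom-complement n k′ l n≡
  eq : ∀ g a b c f → g + 2 + (a + 2 * b + c + f) + 0 ≡ a + 2 * b + (g + f + (c + 2))
  eq = solve-∀

star-combine : ∀ {x y a b g s} → a + b ≡ s → x ≤ a → y + 2 * g ≤ a + 2 * b → x + y + 2 * g ≤ 2 * s
star-combine {x} {y} {a} {b} {g} refl p q = lin 0 (+-mono-≤ p q) (eq x y a b g)
  where
  eq : ∀ x y a b g → x + y + 2 * g + (a + (a + 2 * b)) + 0 ≡ 2 * (a + b) + (x + (y + 2 * g))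
  eq = solve-∀

-- A star at 1 loses the `binom m k` members whose other elements all lie beyond the `r + 1`
-- smallest points, and the bound is that of two such stars. The induction follows `sum-bound`,
-- which takes over once `m` is too small for the correction; by `suc k < r` this precedes the
-- pairing of complements.
sum-bound-low : ∀ m r k {f g : Fam (m + suc r)} → suc k < r → suc k + suc k ≤ m + suc r →
  Shifted f → Shifted g → Uni (suc k) f → Uni (suc k) g → TwoLow r f → TwoLow r g → Cross f g →
  1 ≤ count f → 1 ≤ count g → bothOf (m + suc r) (suc k) ≤ count f → bothOf (m + suc r) (suc k) ≤ count g →
  count f + count g + 2 * binom m k ≤ 2 * binom (m + r) k
sum-bound-low m r zero {f} {g} _ _ _ _ uf ug tf tg _ _ _ _ _
  rewrite twoLow-empty {f = f} uf tf | twoLow-empty {f = g} ug tg = ≤-refl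
sum-bound-low m r (suc k) {f} {g} k<r 2k≤n sf sg uf ug tf tg c 1≤f 1≤g pf pg with m <? suc k
... | yes m<k = bound-plain m<k (subst (λ x → count f + count g ≤ 2 * binom (x ∸ 1) (suc k)) (+-suc m r)
                  (sum-bound (m + suc r) 2k≤n sf sg uf ug c 1≤f 1≤g pf pg))
sum-bound-low zero r (suc k) _ _ _ _ _ _ _ _ _ _ _ _ _ | no ¬q = contradiction (s≤s z≤n) ¬q
sum-bound-low (suc m) r (suc k) {f} {g} k<r _ sf sg uf ug tf tg c _ _ pf pg | no m≮k =
  lin 0 (+-mono-≤ lo-part hi-part) (eq (count (lo f)) (count (hi f)) (count (lo g)) (count (hi g)) (binom m k) (binom m (suc k)) (binom (m + r) k) (binom (m + r) (suc k)))
  where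
  eq : ∀ a b c d x y u v → (a + b) + (c + d) + 2 * (x + y) + (2 * v + 2 * u) + 0
                         ≡ 2 * (u + v) + ((a + c + 2 * y) + (b + d + 2 * x))
  eq = solve-∀
  n = m + suc r
  K = 2 + k
  k≤m : k ≤ m
  k≤m = ≤-pred (≮⇒≥ m≮k)
  2≤n : 2 ≤ n
  2≤n = 2≤[m+sr] m (≤-trans (s≤s z≤n) k<r)
  2k≤n : K + K ≤ n
  2k≤n = lin 0 (+-mono-≤ k<r k≤m) (eq′ k m r)
    where
    eq′ : ∀ k m r → (2 + k) + (2 + k) + (r + m) + 0 ≡ m + suc r + (suc (2 + k) + k)
    eq′ = solve-∀
  k≤n : K ≤ n
  k≤n = ≤-trans (m≤m+n K K) 2k≤n
  K+k≤n : K + suc k ≤ n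
  K+k≤n = ≤-trans (+-monoʳ-≤ K (n≤1+n (suc k))) 2k≤n
  2≤K : 2 ≤ K
  2≤K = s≤s (s≤s z≤n)
  qf : bothOf n K ≤ count (lo f)
  qf = lo-bound n 2≤n 2≤K sf uf pf
  qg : bothOf n K ≤ count (lo g)
  qg = lo-bound n 2≤n 2≤K sg ug pg
  lo-part : count (lo f) + count (lo g) + 2 * binom m (suc k) ≤ 2 * binom (m + r) (suc k)
  lo-part = sum-bound-low m r (suc k) k<r 2k≤n (proj₁ sf) (proj₁ sg) (uni-lo uf) (uni-lo ug)
    (twoLow-lo m r tf) (twoLow-lo m r tg) (cross-lo-lo c)
    (≤-trans (bothOf-pos 2≤K k≤n) qf) (≤-trans (bothOf-pos 2≤K k≤n) qg) qf qg
  other : ∀ {x y} → x ≤ bothOf n (suc k) → y + 2 * binom m k ≤ bothOf n (suc k) + 2 * oneOf n (suc k) →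
    x + y + 2 * binom m k ≤ 2 * binom (m + r) k
  other {x} {y} p q = star-combine {x} {y} {bothOf n (suc k)} {oneOf n (suc k)} {binom m k} (subst (λ z → bothOf n (suc k) + oneOf n (suc k) ≡ binom (z ∸ 1) k) (+-suc m r) (star-split k 2≤n)) p q
  hi-part : count (hi f) + count (hi g) + 2 * binom m k ≤ 2 * binom (m + r) k
  hi-part with bothOf n (suc k) <? count (hi f) | bothOf n (suc k) <? count (hi g)
  ... | yes p | yes q = sum-bound-low m r k (<⇒≤ k<r) (≤-trans (+-monoˡ-≤ (suc k) (n≤1+n (suc k))) K+k≤n)
                          (proj₁ (proj₂ sf)) (proj₁ (proj₂ sg)) (uni-hi uf) (uni-hi ug)
                          (twoLow-hi m r tf) (twoLow-hi m r tg) (cross-hi-hi sf uf ug K+k≤n c)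
                          (≤-trans (s≤s z≤n) p) (≤-trans (s≤s z≤n) q) (<⇒≤ p) (<⇒≤ q)
  ... | no ¬p | _     = other (≮⇒≥ ¬p) (cross-bound-low m r k {g = hi g} 2≤K k<r K+k≤n
                          (proj₁ sf) (uni-lo uf) (uni-hi ug) (twoLow-hi m r tg) (cross-lo-hi c) qf)
  ... | yes _ | no ¬q = subst (λ z → z + 2 * binom m k ≤ 2 * binom (m + r) k) (+-comm (count (hi g)) (count (hi f)))
                          (other (≮⇒≥ ¬q) (cross-bound-low m r k {g = hi f} 2≤K k<r K+k≤n
                            (proj₁ sg) (uni-lo ug) (uni-hi uf) (twoLow-hi m r tf) (cross-sym (cross-hi-lo c)) qg))

-- Here `m = n - r - 1` for the uniformity `r = 2 + k`, so the bound is 2h. At `n = 2r` the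
-- correction is 2 and cancels the final `+ 2`, leaving the complement pairing. In the step that 2
-- goes to the `lo` parts; the `hi` parts have uniformity below `r` and satisfy the sharper
-- `sum-bound-low`.
sum-bound-top : ∀ m k {f g : Fam (m + suc (2 + k))} → 1 ≤ k → suc k ≤ m →
  Shifted f → Shifted g → Uni (2 + k) f → Uni (2 + k) g → Avoids₁ f → Avoids₁ g → Cross f g →
  bothOf (m + suc (2 + k)) (2 + k) + 2 ≤ count f → bothOf (m + suc (2 + k)) (2 + k) + 2 ≤ count g →
  count f + count g + 2 * binom m (suc k) ≤ 2 * binom (m + (2 + k)) (suc k) + 2
sum-bound-top m k {f} {g} 1≤k k≤m sf sg uf ug nf ng c pf pg with m≤n⇒m<n∨m≡n k≤m
... | inj₂ refl = begin
  count f + count g + 2 * binom (suc k) (suc k)  ≡⟨ cong (λ x → count f + count g + 2 * x) (binom-diag (suc k)) ⟩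
  count f + count g + 2                          ≤⟨ +-monoˡ-≤ 2 (cross-complement n≡ uf ug c) ⟩
  binom (m + suc (2 + k)) (2 + k) + 2            ≡⟨ cong (_+ 2) (middle-binom (suc k) n≡) ⟩
  2 * binom (m + suc (2 + k) ∸ 1) (suc k) + 2    ≡⟨ cong (λ x → 2 * binom x (suc k) + 2) (+-suc k (2 + k)) ⟩
  2 * binom (m + (2 + k)) (suc k) + 2            ∎
  where
  open ≤-Reasoning
  n≡ : m + suc (2 + k) ≡ (2 + k) + (2 + k)
  n≡ = cong suc (+-suc k (2 + k))
sum-bound-top (suc m) k@(suc _) {f} {g} 1≤k _ sf sg uf ug nf ng c pf pg | inj₁ (s≤s k<m) =
  lin 0 (+-mono-≤ lo-part hi-part) (eq (count (lo f)) (count (hi f)) (count (lo g)) (count (hi g)) (binom m k) (binom m (suc k)) (binom (m + r) k) (binom (m + r) (suc k)))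
  where
  eq : ∀ a b c d x y u v → (a + b) + (c + d) + 2 * (x + y) + (2 * v + 2 + 2 * u) + 0
                         ≡ 2 * (u + v) + 2 + ((a + c + 2 * y) + (b + d + 2 * x))
  eq = solve-∀
  r = 2 + k
  n = m + suc r
  2≤k′ : 2 ≤ suc k
  2≤k′ = s≤s 1≤k
  2≤n : 2 ≤ n
  2≤n = 2≤[m+sr] m (s≤s z≤n)
  nf₀ : Avoids₁ (lo f)
  nf₀ = avoids₁-lo sf uf (m≤n+m (suc r) m) nf
  ng₀ : Avoids₁ (lo g)
  ng₀ = avoids₁-lo sg ug (m≤n+m (suc r) m) ng
  tf : TwoLow r (hi f)
  tf = twoLow-hi m r (twoLow-of (suc m) r sg ug ng (cross-sym c))
  tg : TwoLow r (hi g)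
  tg = twoLow-hi m r (twoLow-of (suc m) r sf uf nf c)
  qf : bothOf n r + 2 ≤ count (lo f)
  qf = lo-bound₂ m (suc k) 2≤k′ sf uf nf pf
  qg : bothOf n r + 2 ≤ count (lo g)
  qg = lo-bound₂ m (suc k) 2≤k′ sg ug ng pg
  lo-part : count (lo f) + count (lo g) + 2 * binom m (suc k) ≤ 2 * binom (m + r) (suc k) + 2
  lo-part = sum-bound-top m k 1≤k k<m (proj₁ sf) (proj₁ sg) (uni-lo uf) (uni-lo ug) nf₀ ng₀ (cross-lo-lo c) qf qg
  r+k<n : r + suc k ≤ n
  r+k<n = lin 1 k<m (eq′ m k)
    where
    eq′ : ∀ m k → (2 + k) + suc k + m + 1 ≡ m + suc (2 + k) + suc k
    eq′ = solve-∀
  other : ∀ {x y} → x ≤ bothOf n (suc k) → y + 2 * binom m k ≤ bothOf n (suc k) + 2 * oneOf n (suc k) →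
    x + y + 2 * binom m k ≤ 2 * binom (m + r) k
  other {x} {y} p q = star-combine {x} {y} {bothOf n (suc k)} {oneOf n (suc k)} {binom m k} (subst (λ z → bothOf n (suc k) + oneOf n (suc k) ≡ binom (z ∸ 1) k) (+-suc m r) (star-split k 2≤n)) p q
  hi-part : count (hi f) + count (hi g) + 2 * binom m k ≤ 2 * binom (m + r) k
  hi-part with bothOf n (suc k) <? count (hi f) | bothOf n (suc k) <? count (hi g)
  ... | yes p | yes q = sum-bound-low m r k ≤-refl (≤-trans (+-monoˡ-≤ (suc k) (n≤1+n (suc k))) r+k<n)
                          (proj₁ (proj₂ sf)) (proj₁ (proj₂ sg)) (uni-hi uf) (uni-hi ug)
                          tf tg (cross-hi-hi sf uf ug r+k<n c)
                          (≤-trans (s≤s z≤n) p) (≤-trans (s≤s z≤n) q) (<⇒≤ p) (<⇒≤ q)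
  ... | no ¬p | _     = other (≮⇒≥ ¬p) (cross-bound-top m (suc k) k {g = hi g} 2≤k′ (<⇒≤ k<m)
                          (proj₁ sf) (uni-lo uf) nf₀ (uni-hi ug) tg (cross-lo-hi c) qf)
  ... | yes _ | no ¬q = subst (λ z → z + 2 * binom m k ≤ 2 * binom (m + r) k) (+-comm (count (hi g)) (count (hi f)))
                          (other (≮⇒≥ ¬q) (cross-bound-top m (suc k) k {g = hi f} 2≤k′ (<⇒≤ k<m)
                            (proj₁ sg) (uni-lo ug) ng₀ (uni-hi uf) tf (cross-sym (cross-hi-lo c)) qg))

-- Shifting

-- A pair of adjacent entries in a vector of length n + 2.
data Pos : ℕ → Set where
  here  : ∀ {n} → Pos n
  there : ∀ {n} → Pos n → Pos (suc n)

insert : ∀ {n} → Pos n → Bool → Bool → Subset n → Subset (2 + n)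
insert here      s t A       = s ∷ t ∷ A
insert (there p) s t (x ∷ A) = x ∷ insert p s t A

data Split {n : ℕ} (p : Pos n) : Subset (2 + n) → Set where
  split : ∀ s t A → Split p (insert p s t A)

splitAt : ∀ {n} (p : Pos n) A → Split p A
splitAt here      (s ∷ t ∷ A) = split s t A
splitAt (there p) (x ∷ A) with splitAt p A
... | split s t B = split s t (x ∷ B)

shift : ∀ {n} → Pos n → Fam (2 + n) → Fam (2 + n)
shift here      f (false ∷ false ∷ A) = f (false ∷ false ∷ A)
shift here      f (false ∷ true  ∷ A) = f (false ∷ true ∷ A) ∨ f (true ∷ false ∷ A)
shift here      f (true  ∷ false ∷ A) = f (true ∷ false ∷ A) ∧ f (false ∷ true ∷ A)
shift here      f (true  ∷ true  ∷ A) = f (true ∷ true ∷ A)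
shift (there p) f (s ∷ A)             = shift p (λ B → f (s ∷ B)) A

shift-tt : ∀ {n} (p : Pos n) f A → shift p f (insert p true true A) ≡ f (insert p true true A)
shift-tt here      f A       = refl
shift-tt (there p) f (x ∷ A) = shift-tt p _ A

shift-ff : ∀ {n} (p : Pos n) f A → shift p f (insert p false false A) ≡ f (insert p false false A)
shift-ff here      f A       = refl
shift-ff (there p) f (x ∷ A) = shift-ff p _ A

shift-tf : ∀ {n} (p : Pos n) f A → shift p f (insert p true false A) ≡ f (insert p true false A) ∧ f (insert p false true A)
shift-tf here      f A       = refl
shift-tf (there p) f (x ∷ A) = shift-tf p _ A

shift-ft : ∀ {n} (p : Pos n) f A → shift p f (insert p false true A) ≡ f (insert p false true A) ∨ f (insert p true false A)
shift-ft here      f A       = refl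
shift-ft (there p) f (x ∷ A) = shift-ft p _ A

∧-true : ∀ {a b} → a ∧ b ≡ true → a ≡ true × b ≡ true
∧-true {true} {true} _ = refl , refl

∨-true : ∀ {a b} → a ∨ b ≡ true → a ≡ true ⊎ b ≡ true
∨-true {true}  _ = inj₁ refl
∨-true {false} p = inj₂ p

∨-trueˡ : ∀ {a b} → a ≡ true → a ∨ b ≡ true
∨-trueˡ refl = refl

∨-trueʳ : ∀ {a b} → b ≡ true → a ∨ b ≡ true
∨-trueʳ {true}  _ = refl
∨-trueʳ {false} p = p

from-shift : ∀ {n} (p : Pos n) f s t A → shift p f ∋ insert p s t A → f ∋ insert p s t A ⊎ f ∋ insert p t s A
from-shift p f true  true  A m = inj₁ (trans (sym (shift-tt p f A)) m)
from-shift p f false false A m = inj₁ (trans (sym (shift-ff p f A)) m)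
from-shift p f true  false A m = inj₁ (proj₁ (∧-true (trans (sym (shift-tf p f A)) m)))
from-shift p f false true  A m = ∨-true (trans (sym (shift-ft p f A)) m)

to-shift : ∀ {n} (p : Pos n) f s t A → f ∋ insert p s t A → shift p f ∋ insert p s t A ⊎ shift p f ∋ insert p t s A
to-shift p f true  true  A m = inj₁ (trans (shift-tt p f A) m)
to-shift p f false false A m = inj₁ (trans (shift-ff p f A) m)
to-shift p f true  false A m = inj₂ (trans (shift-ft p f A) (∨-trueʳ m))
to-shift p f false true  A m = inj₁ (trans (shift-ft p f A) (∨-trueˡ m))

count-∧∨ : ∀ {n} (f g : Fam n) → count (λ A → g A ∧ f A) + count (λ A → f A ∨ g A) ≡ count f + count g
count-∧∨ f g = trans (sym (∑-+ (λ A → ⟦ g A ∧ f A ⟧) (λ A → ⟦ f A ∨ g A ⟧)))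
  (trans (∑-cong (λ A → pointwise (f A) (g A))) (∑-+ (λ A → ⟦ f A ⟧) (λ A → ⟦ g A ⟧)))
  where
  pointwise : ∀ a b → ⟦ b ∧ a ⟧ + ⟦ a ∨ b ⟧ ≡ ⟦ a ⟧ + ⟦ b ⟧
  pointwise false false = refl
  pointwise false true  = refl
  pointwise true  false = refl
  pointwise true  true  = refl

quad : ∀ {n} → Pos n → Bool → Bool → Fam (2 + n) → Fam n
quad p s t f A = f (insert p s t A)

count-quad : ∀ {n} (p : Pos n) f → count f ≡
  (count (quad p false false f) + count (quad p false true f)) + (count (quad p true false f) + count (quad p true true f))
count-quad here      f = refl
count-quad (there p) f = trans (cong₂ _+_ (count-quad p (lo f)) (count-quad p (hi f)))
  (eq (count (quad p false false (lo f))) (count (quad p false true (lo f))) (count (quad p true false (lo f))) _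
      (count (quad p false false (hi f))) (count (quad p false true (hi f))) (count (quad p true false (hi f))) _)
  where
  eq : ∀ a b c d x y z w → ((a + b) + (c + d)) + ((x + y) + (z + w)) ≡ ((a + x) + (b + y)) + ((c + z) + (d + w))
  eq = solve-∀

count-shift : ∀ {n} (p : Pos n) f → count (shift p f) ≡ count f
count-shift here      f = eq (count (quad here false false f)) {count (quad here false true f)} {c = count (quad here true false f)} (count-∧∨ (quad here false true f) (quad here true false f))
  where
  eq : ∀ a {b b′ c c′ d} → c′ + b′ ≡ b + c → (a + b′) + (c′ + d) ≡ (a + b) + (c + d)
  eq a {b} {b′} {c} {c′} {d} e = trans (l a b′ c′ d) (trans (cong (λ x → a + x + d) e) (sym (r a b c d)))
    where
    l : ∀ a b c d → (a + b) + (c + d) ≡ a + (c + b) + d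
    l = solve-∀
    r : ∀ a b c d → (a + b) + (c + d) ≡ a + (b + c) + d
    r = solve-∀
count-shift (there p) f = cong₂ _+_ (count-shift p (lo f)) (count-shift p (hi f))

-- The sum of the elements of all members; shifting decreases it.
weight : ∀ {n} → Fam n → ℕ
weight {zero}  f = 0
weight {suc n} f = weight (lo f) + (weight (hi f) + suc n * count (hi f))

weight-∧∨ : ∀ {n} (f g : Fam n) → weight (λ A → g A ∧ f A) + weight (λ A → f A ∨ g A) ≡ weight f + weight g
weight-∧∨ {zero}  f g = refl
weight-∧∨ {suc n} f g =
  eq n {weight (λ A → lo g A ∧ lo f A)} {weight (λ A → hi g A ∧ hi f A)} {x = weight (lo f)} {weight (hi f)} (weight-∧∨ (lo f) (lo g)) (weight-∧∨ (hi f) (hi g)) (count-∧∨ (hi f) (hi g))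
  where
  l : ∀ n a b c a′ b′ c′ → (a + (b + suc n * c)) + (a′ + (b′ + suc n * c′)) ≡ (a + a′) + ((b + b′) + suc n * (c + c′))
  l = solve-∀
  eq : ∀ n {a b c a′ b′ c′ x y z x′ y′ z′} → a + a′ ≡ x + x′ → b + b′ ≡ y + y′ → c + c′ ≡ z + z′ →
    (a + (b + suc n * c)) + (a′ + (b′ + suc n * c′)) ≡ (x + (y + suc n * z)) + (x′ + (y′ + suc n * z′))
  eq n {a} {b} {c} {a′} {b′} {c′} {x} {y} {z} {x′} {y′} {z′} p q r =
    trans (l n a b c a′ b′ c′) (trans (cong₂ _+_ p (cong₂ (λ u v → u + suc n * v) q r)) (sym (l n x y z x′ y′ z′)))

gap : ∀ {n} → Pos n → Fam (2 + n) → Fam n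
gap p f A = f (insert p true false A) ∧ not (f (insert p false true A))

-- Each set counted by `gap` has one element lowered by one, and all other sets stay. This makes
-- shifting terminate.
weight-shift : ∀ {n} (p : Pos n) f → weight (shift p f) + count (gap p f) ≡ weight f
weight-shift {n} here f =
  eq n (weight (quad here false false f)) (count (quad here true true f))
     {weight F} {weight (λ A → F A ∨ G A)} {weight G} {weight (λ A → G A ∧ F A)}
     {count F} {count (λ A → F A ∨ G A)} {count G} {count (λ A → G A ∧ F A)} {count (gap here f)}
     {weight (quad here true true f)}
     (weight-∧∨ F G) (count-∧∨ F G) split-count
  where
  F = quad here false true f
  G = quad here true false f
  split-count : count (λ A → G A ∧ F A) + count (gap here f) ≡ count G
  split-count = trans (sym (∑-+ (λ A → ⟦ G A ∧ F A ⟧) (λ A → ⟦ gap here f A ⟧))) (∑-cong (λ A → pointwise (G A) (F A)))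
    where
    pointwise : ∀ a b → ⟦ a ∧ b ⟧ + ⟦ a ∧ not b ⟧ ≡ ⟦ a ⟧
    pointwise false b     = refl
    pointwise true  false = refl
    pointwise true  true  = refl
  eq : ∀ n a d {wF wF′ wG wG′ cF cF′ cG cG′ m w} →
    wG′ + wF′ ≡ wF + wG → cG′ + cF′ ≡ cF + cG → cG′ + m ≡ cG →
    (a + (wF′ + suc n * cF′)) + ((wG′ + (w + suc n * d)) + suc (suc n) * (cG′ + d)) + m
      ≡ (a + (wF + suc n * cF)) + ((wG + (w + suc n * d)) + suc (suc n) * (cG + d))
  eq n a d {wF} {wF′} {wG} {wG′} {cF} {cF′} {cG} {cG′} {m} {w} p q r =
    trans (l n a d wF′ cF′ wG′ cG′ m w)
      (trans (cong₂ (λ x y → (a + w + (suc n * d + suc (suc n) * d)) + (x + y)) p (cong₂ (λ x y → suc n * x + y) q r))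
        (sym (l′ n a d wF cF wG cG w)))
    where
    l : ∀ n a d wF cF wG cG m w → (a + (wF + suc n * cF)) + ((wG + (w + suc n * d)) + suc (suc n) * (cG + d)) + m
      ≡ (a + w + (suc n * d + suc (suc n) * d)) + ((wG + wF) + (suc n * (cG + cF) + (cG + m)))
    l = solve-∀
    l′ : ∀ n a d wF cF wG cG w → (a + (wF + suc n * cF)) + ((wG + (w + suc n * d)) + suc (suc n) * (cG + d))
      ≡ (a + w + (suc n * d + suc (suc n) * d)) + ((wF + wG) + (suc n * (cF + cG) + cG))
    l′ = solve-∀
weight-shift {suc n} (there p) f = eq (3 + n) {weight (shift p (lo f))} {weight (shift p (hi f))} {m = count (gap p (lo f))} {count (gap p (hi f))} (weight-shift p (lo f)) (weight-shift p (hi f)) (count-shift p (hi f))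
  where
  eq : ∀ n {a b c x y z m k} → a + m ≡ x → b + k ≡ y → c ≡ z → (a + (b + n * c)) + (m + k) ≡ x + (y + n * z)
  eq n {a} {b} {c} {m = m} {k} refl refl refl = l n a b c m k
    where
    l : ∀ n a b c m k → (a + (b + n * c)) + (m + k) ≡ (a + m) + ((b + k) + n * c)
    l = solve-∀

Stable : ∀ {n} → Fam (2 + n) → Set
Stable f = ∀ p A → f ∋ insert p true false A → f ∋ insert p false true A

-- The largest element descends to the vacant place by adjacent replacements. If the next smaller
-- point is occupied, that point is moved to the vacant place first, and the largest element then
-- takes its position.
stable-up : ∀ {n} {f : Fam (2 + n)} → Stable f → ∀ {A B} → A ⋖ B → hi f ∋ A → lo f ∋ B
stable-up st {A = outside ∷ A}      add              m = st here A m
stable-up {suc n} {f} st {outside ∷ A} {B = _ ∷ B} (keep c) m =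
  stable-up {f = lo f} (λ p C → st (there p) (outside ∷ C)) c (st here A m)
stable-up {suc n} {f} st {inside ∷ A} {B = _ ∷ B} (keep c) m =
  st here B (stable-up {f = hi f} (λ p C → st (there p) (inside ∷ C)) c m)

stable-shifted : ∀ {n} {f : Fam (2 + n)} → Stable f → Shifted f
stable-shifted {zero}  {f} st = (tt , tt , λ ()) , (tt , tt , λ ()) , stable-up {f = f} st
stable-shifted {suc n} {f} st =
  stable-shifted {f = lo f} (λ p C → st (there p) (outside ∷ C)) ,
  stable-shifted {f = hi f} (λ p C → st (there p) (inside ∷ C)) ,
  stable-up {f = f} st

size-insert : ∀ {n} (p : Pos n) s t A → ∣ insert p s t A ∣ ≡ (⟦ s ⟧ + ⟦ t ⟧) + ∣ A ∣
size-insert here true  true  A = refl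
size-insert here true  false A = refl
size-insert here false true  A = refl
size-insert here false false A = refl
size-insert (there p) s t (true ∷ A)  = trans (cong suc (size-insert p s t A)) (sym (+-suc (⟦ s ⟧ + ⟦ t ⟧) ∣ A ∣))
size-insert (there p) s t (false ∷ A) = size-insert p s t A

uni-shift : ∀ {n k} (p : Pos n) {f} → Uni k f → Uni k (shift p f)
uni-shift p {f} u A m with splitAt p A
... | split s t B with from-shift p f s t B m
...   | inj₁ q = u _ q
...   | inj₂ q = trans (size-insert p s t B)
                   (trans (cong (_+ ∣ B ∣) (+-comm ⟦ s ⟧ ⟦ t ⟧)) (trans (sym (size-insert p t s B)) (u _ q)))

meet-insert⁻ : ∀ {n} (p : Pos n) {s t s′ t′ A B} → Meet (insert p s t A) (insert p s′ t′ B) →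
  (s ∧ s′) ∨ (t ∧ t′) ≡ true ⊎ Meet A B
meet-insert⁻ here here              = inj₁ refl
meet-insert⁻ here {s} {s′ = s′} (there here)      = inj₁ (∨-trueʳ {s ∧ s′} refl)
meet-insert⁻ here (there (there m)) = inj₂ m
meet-insert⁻ (there p) {A = _ ∷ _} {B = _ ∷ _} here = inj₂ here
meet-insert⁻ (there p) {A = _ ∷ _} {B = _ ∷ _} (there m) with meet-insert⁻ p m
... | inj₁ e  = inj₁ e
... | inj₂ m′ = inj₂ (there m′)

meet-insert⁺ : ∀ {n} (p : Pos n) {s t s′ t′ A B} → Meet A B → Meet (insert p s t A) (insert p s′ t′ B)
meet-insert⁺ here      m         = there (there m)
meet-insert⁺ (there p) here      = here
meet-insert⁺ (there p) (there m) = there (meet-insert⁺ p m)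

meet-bits : ∀ {n} (p : Pos n) {s t s′ t′} A B → (s ∧ s′) ∨ (t ∧ t′) ≡ true → Meet (insert p s t A) (insert p s′ t′ B)
meet-bits here {true}  {t}    {true}         A B e = here
meet-bits here {true}  {true} {false} {true} A B e = there here
meet-bits here {false} {true} {_} {true}     A B e = there here
meet-bits (there p) (_ ∷ A) (_ ∷ B) e = there (meet-bits p A B e)

quad-cross : ∀ {n} (p : Pos n) s t s′ t′ {f g : Fam (2 + n)} → (s ∧ s′) ∨ (t ∧ t′) ≡ false → Cross f g →
  Cross (quad p s t f) (quad p s′ t′ g)
quad-cross p s t s′ t′ e c A B m m′ with meet-insert⁻ p (c _ _ m m′)
... | inj₁ e′ = contradiction (trans (sym e) e′) λ ()
... | inj₂ r  = r

-- If the bits at `p` do not meet already, the rest must. A set with bits `true false` survives the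
-- shift only if the original family also contains its swap; so against either preimage of the other
-- set a version with disjoint bits is available.
cross-shift : ∀ {n} (p : Pos n) {f g} → Cross f g → Cross (shift p f) (shift p g)
cross-shift p {f} {g} c A′ B′ m m′ with splitAt p A′ | splitAt p B′
... | split s t A | split s′ t′ B with (s ∧ s′) ∨ (t ∧ t′) in e
...   | true  = meet-bits p A B e
...   | false = meet-insert⁺ p (meets s t s′ t′ e m m′)
  where
  both : ∀ {f} A → shift p f ∋ insert p true false A → f ∋ insert p true false A × f ∋ insert p false true A
  both {f} A m = ∧-true (trans (sym (shift-tf p f A)) m)
  meets : ∀ s t s′ t′ → (s ∧ s′) ∨ (t ∧ t′) ≡ false → shift p f ∋ insert p s t A → shift p g ∋ insert p s′ t′ B → Meet A B
  meets false false s′ t′ _ m m′ with from-shift p f false false A m | from-shift p g s′ t′ B m′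
  ... | inj₁ a | inj₁ b = quad-cross p false false s′ t′ refl c A B a b
  ... | inj₁ a | inj₂ b = quad-cross p false false t′ s′ refl c A B a b
  ... | inj₂ a | inj₁ b = quad-cross p false false s′ t′ refl c A B a b
  ... | inj₂ a | inj₂ b = quad-cross p false false t′ s′ refl c A B a b
  meets true  true  false false _ m m′ with from-shift p f true true A m
  ... | inj₁ a = quad-cross p true true false false refl c A B a (trans (sym (shift-ff p g B)) m′)
  ... | inj₂ a = quad-cross p true true false false refl c A B a (trans (sym (shift-ff p g B)) m′)
  meets true  false false false _ m m′ =
    quad-cross p true false false false refl c A B (proj₁ (both A m)) (trans (sym (shift-ff p g B)) m′)
  meets true  false false true  _ m m′ with from-shift p g false true B m′
  ... | inj₁ b = quad-cross p true false false true refl c A B (proj₁ (both A m)) b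
  ... | inj₂ b = quad-cross p false true true false refl c A B (proj₂ (both A m)) b
  meets false true  false false _ m m′ with from-shift p f false true A m
  ... | inj₁ a = quad-cross p false true false false refl c A B a (trans (sym (shift-ff p g B)) m′)
  ... | inj₂ a = quad-cross p true false false false refl c A B a (trans (sym (shift-ff p g B)) m′)
  meets false true  true  false _ m m′ with from-shift p f false true A m
  ... | inj₁ a = quad-cross p false true true false refl c A B a (proj₁ (both B m′))
  ... | inj₂ a = quad-cross p true false false true refl c A B a (proj₂ (both B m′))
  meets true  true  false true  () _ _
  meets true  true  true  _     () _ _

search-pos : ∀ {n} {P Q : Pos n → Set} → (∀ p → P p ⊎ Q p) → (∀ p → P p) ⊎ ∃ Q
search-pos {zero}  d with d here
... | inj₁ x = inj₁ λ { here → x }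
... | inj₂ y = inj₂ (here , y)
search-pos {suc n} d with d here | search-pos (λ p → d (there p))
... | inj₂ y | _            = inj₂ (here , y)
... | inj₁ _ | inj₂ (p , y) = inj₂ (there p , y)
... | inj₁ x | inj₁ xs      = inj₁ λ { here → x ; (there p) → xs p }

stable-or-gap : ∀ {n} (f : Fam (2 + n)) → Stable f ⊎ ∃[ p ] (1 ≤ count (gap p f))
stable-or-gap {n} f = search-pos decide
  where
  no-gap : ∀ {a b} → a ∧ not b ≡ false → a ≡ true → b ≡ true
  no-gap {b = true}  _ _    = refl
  no-gap {b = false} e refl = contradiction e λ ()
  decide : ∀ p → (∀ A → f ∋ insert p true false A → f ∋ insert p false true A) ⊎ (1 ≤ count (gap p f))
  decide p with search (gap p f)
  ... | inj₁ (A , m) = inj₂ (count-pos {f = gap p f} A m)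
  ... | inj₂ e       = inj₁ λ A → no-gap (e A)

-- Shifts are applied only where some set really moves, so the total weight decreases. The exit
-- `Out` serves the case that a shift destroys the invariant `P`; it is `⊥` where this cannot
-- happen.
shift-until : ∀ {n} (P : Fam (2 + n) → Fam (2 + n) → Set) {Out : Set} →
  (∀ p f g → P f g → P (shift p f) (shift p g) ⊎ Out) →
  ∀ f g → P f g → (∃[ f′ ] ∃[ g′ ] (P f′ g′ × Stable f′ × Stable g′)) ⊎ Out
shift-until {n} P {Out} step f₀ g₀ = go (weight f₀ + weight g₀) f₀ g₀ ≤-refl
  where
  Result : Set
  Result = (∃[ f′ ] ∃[ g′ ] (P f′ g′ × Stable f′ × Stable g′)) ⊎ Out
  go : ∀ b f g → weight f + weight g ≤ b → P f g → Result
  next : ∀ b p f g → weight f + weight g ≤ b → 1 ≤ count (gap p f) + count (gap p g) → P f g → Result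
  descend : ∀ b {f g} → weight f + weight g < b → P f g → Result
  smaller : ∀ {a b a′ b′ c d} → a + c ≡ a′ → b + d ≡ b′ → 1 ≤ c + d → suc (a + b) ≤ a′ + b′
  smaller {a} {b} {c = c} {d} refl refl p = lin 0 p (eq a b c d)
    where
    eq : ∀ a b c d → suc (a + b) + (c + d) + 0 ≡ (a + c) + (b + d) + 1
    eq = solve-∀
  go b f g w≤b x with stable-or-gap f | stable-or-gap g
  ... | inj₁ sf      | inj₁ sg      = inj₁ (f , g , x , sf , sg)
  ... | inj₂ (p , m) | _            = next b p f g w≤b (≤-trans m (m≤m+n _ _)) x
  ... | inj₁ _       | inj₂ (p , m) = next b p f g w≤b (≤-trans m (m≤n+m _ _)) x
  next b p f g w≤b m x with step p f g x
  ... | inj₂ o = inj₂ o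
  ... | inj₁ y = descend b (≤-trans (smaller {weight (shift p f)} {weight (shift p g)} {c = count (gap p f)} {count (gap p g)} (weight-shift p f) (weight-shift p g) m) w≤b) y
  descend (suc b) (s≤s q) y = go b _ _ q y

-- The positive form of not being a star, found by search in `nonTrivial⇒nonStar`; its witnesses can
-- be followed through a shift.
NonStar : ∀ {n} → Fam n → Set
NonStar f = ∀ x → ∃[ A ] (f ∋ A × lookup A x ≡ outside)

data Coord {n : ℕ} (p : Pos n) (x : Fin (2 + n)) : Set where
  first  : (∀ s t A → lookup (insert p s t A) x ≡ s) → Coord p x
  second : (∀ s t A → lookup (insert p s t A) x ≡ t) → Coord p x
  other  : ∀ j → (∀ s t A → lookup (insert p s t A) x ≡ lookup A j) → Coord p x

coord : ∀ {n} (p : Pos n) x → Coord p x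
coord here      0F          = first (λ _ _ _ → refl)
coord here      (sucF 0F)    = second (λ _ _ _ → refl)
coord here      (sucF (sucF j)) = other j (λ _ _ _ → refl)
coord (there p) 0F          = other 0F (λ { s t (x ∷ A) → refl })
coord (there p) (sucF x) with coord p x
... | first e   = first (λ { s t (_ ∷ A) → e s t A })
... | second e  = second (λ { s t (_ ∷ A) → e s t A })
... | other j e = other (sucF j) (λ { s t (_ ∷ A) → e s t A })

firstIx secondIx : ∀ {n} → Pos n → Fin (2 + n)
firstIx here      = 0F
firstIx (there p) = sucF (firstIx p)
secondIx here      = sucF 0F
secondIx (there p) = sucF (secondIx p)

lookup-first : ∀ {n} (p : Pos n) s t A → lookup (insert p s t A) (firstIx p) ≡ s
lookup-first here      s t A       = refl
lookup-first (there p) s t (_ ∷ A) = lookup-first p s t A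

lookup-second : ∀ {n} (p : Pos n) s t A → lookup (insert p s t A) (secondIx p) ≡ t
lookup-second here      s t A       = refl
lookup-second (there p) s t (_ ∷ A) = lookup-second p s t A

-- Exactly in this situation does the shift at p turn a family that is not a star into a star.
Collapse : ∀ {n} → Pos n → Fam (2 + n) → Set
Collapse p f = (∀ A → ¬ quad p false false f ∋ A) × (∀ A → quad p true false f ∋ A → ¬ quad p false true f ∋ A)

-- Only the smaller point of the pair can become common to all members. This is prevented by a
-- member without both points, or by two members that differ exactly in the pair: the shift leaves
-- either kind in place, and one such set lacks the smaller point.
nonStar-shift : ∀ {n} (p : Pos n) f → NonStar f → NonStar (shift p f) ⊎ Collapse p f
nonStar-shift p f ns with search (λ A → quad p false false f A ∨ (quad p true false f A ∧ quad p false true f A))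
... | inj₂ none = inj₂ ((λ A m → contradiction (trans (sym (none A)) (∨-trueˡ m)) λ ())
                      , (λ A m m′ → contradiction (trans (sym (none A)) (∨-trueʳ {quad p false false f A} (cong₂ _∧_ m m′))) λ ()))
... | inj₁ (C , m) = inj₁ λ x → missing x (coord p x)
  where
  missing : ∀ x → Coord p x → ∃[ A ] (shift p f ∋ A × lookup A x ≡ outside)
  missing x (first e) with ns x
  ... | A , a , x∉A with splitAt p A
  ...   | split true  t     B = contradiction (trans (sym x∉A) (e true t B)) λ ()
  ...   | split false false B = _ , trans (shift-ff p f B) a , e false false B
  ...   | split false true  B = _ , trans (shift-ft p f B) (∨-trueˡ a) , e false true B
  missing x (second e) with ∨-true m
  ... | inj₁ a = _ , trans (shift-ff p f C) a , e false false C
  ... | inj₂ a = _ , trans (shift-tf p f C) a , e true false C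
  missing x (other j e) with ns x
  ... | A , a , x∉A with splitAt p A
  ...   | split s t B with to-shift p f s t B a
  ...     | inj₁ b = _ , b , x∉A
  ...     | inj₂ b = _ , b , trans (e t s B) (trans (sym (e s t B)) x∉A)

-- Bounds for a pair of families of different uniformity

≤ᵇ-true : ∀ {m n} → m ≤ n → (m ≤ᵇ n) ≡ true
≤ᵇ-true {m} {n} p with m ≤ᵇ n | ≤⇒≤ᵇ p
... | true | _ = refl

true-≤ᵇ : ∀ m n → (m ≤ᵇ n) ≡ true → m ≤ n
true-≤ᵇ m n p = ≤ᵇ⇒≤ m n (subst T (sym p) tt)

-- Adds a new smallest element: A together with it is taken for A in f, and A without it for A in g.
adjoin : ∀ {n} → Fam n → Fam n → Fam (suc n)
adjoin {zero}  f g (s ∷ []) = if s then f [] else g []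
adjoin {suc n} f g (s ∷ A)  = adjoin (λ B → f (s ∷ B)) (λ B → g (s ∷ B)) A

snoc : ∀ {n} → Subset n → Bool → Subset (suc n)
snoc []      t = t ∷ []
snoc (s ∷ A) t = s ∷ snoc A t

data Snoc : ∀ {n} → Subset (suc n) → Set where
  snocs : ∀ {n} (A : Subset n) t → Snoc (snoc A t)

snocView : ∀ {n} (A : Subset (suc n)) → Snoc A
snocView (t ∷ [])        = snocs [] t
snocView (s ∷ A@(_ ∷ _)) = extend (snocView A)
  where
  extend : ∀ {n} {A : Subset (suc n)} → Snoc A → Snoc (s ∷ A)
  extend (snocs B t) = snocs (s ∷ B) t

adjoin-in : ∀ {n} (f g : Fam n) A → adjoin f g (snoc A true) ≡ f A
adjoin-in f g []      = refl
adjoin-in f g (s ∷ A) = adjoin-in _ _ A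

adjoin-out : ∀ {n} (f g : Fam n) A → adjoin f g (snoc A false) ≡ g A
adjoin-out f g []      = refl
adjoin-out f g (s ∷ A) = adjoin-out _ _ A

size-snoc : ∀ {n} (A : Subset n) t → ∣ snoc A t ∣ ≡ ⟦ t ⟧ + ∣ A ∣
size-snoc []          true  = refl
size-snoc []          false = refl
size-snoc (true ∷ A)  t     = trans (cong suc (size-snoc A t)) (sym (+-suc ⟦ t ⟧ ∣ A ∣))
size-snoc (false ∷ A) t     = size-snoc A t

low-snoc : ∀ {n} (A : Subset n) → low 1 (snoc A false) ≡ 0
low-snoc []          = refl
low-snoc (s ∷ [])    = refl
low-snoc (s ∷ t ∷ A) = low-snoc (t ∷ A)

meet-snoc : ∀ {n s t} {A B : Subset n} → Meet A B → Meet (snoc A s) (snoc B t)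
meet-snoc here      = here
meet-snoc (there m) = there (meet-snoc m)

meet-snoc-in : ∀ {n} (A B : Subset n) → Meet (snoc A true) (snoc B true)
meet-snoc-in []      []      = here
meet-snoc-in (_ ∷ A) (_ ∷ B) = there (meet-snoc-in A B)

count-adjoin : ∀ {n} (f g : Fam n) → count (adjoin f g) ≡ count f + count g
count-adjoin {zero}  f g = +-comm ⟦ g [] ⟧ ⟦ f [] ⟧
count-adjoin {suc n} f g = trans (cong₂ _+_ (count-adjoin (lo f) (lo g)) (count-adjoin (hi f) (hi g)))
                                 (eq (count (lo f)) (count (lo g)) (count (hi f)) (count (hi g)))
  where
  eq : ∀ a b c d → (a + b) + (c + d) ≡ (a + c) + (b + d)
  eq = solve-∀

uni-adjoin : ∀ {n k} {f g : Fam n} → Uni k f → Uni (suc k) g → Uni (suc k) (adjoin f g)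
uni-adjoin {f = f} {g} uf ug A m with snocView A
... | snocs B true  = trans (size-snoc B true) (cong suc (uf B (trans (sym (adjoin-in f g B)) m)))
... | snocs B false = trans (size-snoc B false) (ug B (trans (sym (adjoin-out f g B)) m))

cross-adjoin : ∀ {n} {f g f′ g′ : Fam n} → Cross f g′ → Cross g f′ → Cross g g′ → Cross (adjoin f g) (adjoin f′ g′)
cross-adjoin {f = f} {g} {f′} {g′} c₁ c₂ c₃ A′ B′ m m′ with snocView A′ | snocView B′
... | snocs A true  | snocs B true  = meet-snoc-in A B
... | snocs A true  | snocs B false = meet-snoc (c₁ A B (trans (sym (adjoin-in f g A)) m) (trans (sym (adjoin-out f′ g′ B)) m′))
... | snocs A false | snocs B true  = meet-snoc (c₂ A B (trans (sym (adjoin-out f g A)) m) (trans (sym (adjoin-in f′ g′ B)) m′))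
... | snocs A false | snocs B false = meet-snoc (c₃ A B (trans (sym (adjoin-out f g A)) m) (trans (sym (adjoin-out f′ g′ B)) m′))

avoids₁-adjoin : ∀ {n} {f g : Fam n} A → g ∋ A → Avoids₁ (adjoin f g)
avoids₁-adjoin {f = f} {g} A m = snoc A false , trans (adjoin-out f g A) m , low-snoc A

adjoin-mono : ∀ {n} {f g f′ g′ : Fam n} → (∀ A → f ∋ A → f′ ∋ A) → (∀ A → g ∋ A → g′ ∋ A) →
  ∀ A → adjoin f g ∋ A → adjoin f′ g′ ∋ A
adjoin-mono {f = f} {g} {f′} {g′} p q A m with snocView A
... | snocs B true  = trans (adjoin-in f′ g′ B) (p B (trans (sym (adjoin-in f g B)) m))
... | snocs B false = trans (adjoin-out f′ g′ B) (q B (trans (sym (adjoin-out f g B)) m))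

adjoin-up : ∀ {n} {f g f′ g′ : Fam n} → (∀ {A B} → A ⋖ B → f ∋ A → f′ ∋ B) → (∀ {A B} → A ⋖ B → g ∋ A → g′ ∋ B) →
  (∀ A → g ∋ A → f′ ∋ A) → ∀ {A B} → A ⋖ B → adjoin f g ∋ A → adjoin f′ g′ ∋ B
adjoin-up {zero}  p q r {outside ∷ []} add m = r [] m
adjoin-up {zero}  p q r (keep ()) m
adjoin-up {suc n} {f} {g} {f′} {g′} p q r {outside ∷ A} add m =
  adjoin-mono {f = λ B → f (outside ∷ B)} {λ B → g (outside ∷ B)} {λ B → f′ (inside ∷ B)} {λ B → g′ (inside ∷ B)}
    (λ B → p add) (λ B → q add) A m
adjoin-up {suc n} {f} {g} {f′} {g′} p q r {s ∷ A} (keep c) m =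
  adjoin-up {n} {λ B → f (s ∷ B)} {λ B → g (s ∷ B)} {λ B → f′ (s ∷ B)} {λ B → g′ (s ∷ B)}
    (λ d → p (keep d)) (λ d → q (keep d)) (λ B → r (s ∷ B)) c m

shifted-adjoin : ∀ {n} {f g : Fam n} → Shifted f → Shifted g → (∀ {A B} → A ⋖ B → g ∋ B → f ∋ A) → Shifted (adjoin f g)
shifted-adjoin {zero}          _             _             _ = tt , tt , λ ()
shifted-adjoin {suc n} {f} {g} (s₀ , s₁ , u) (t₀ , t₁ , v) p =
  shifted-adjoin {n} {lo f} {lo g} s₀ t₀ (λ c → p (keep c)) ,
  shifted-adjoin {n} {hi f} {hi g} s₁ t₁ (λ c → p (keep c)) ,
  adjoin-up {n} {hi f} {hi g} {lo f} {lo g} u v (λ A → p add)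

low-out : ∀ {n} r (A : Subset n) → low r (outside ∷ A) ≡ low r A
low-out {n} r A with n <ᵇ r
... | true  = refl
... | false = refl

low-mono : ∀ {n} r {A B : Subset n} → A ⋖ B → low r A ≤ low r B
low-mono {suc n} r {outside ∷ A} add with n <ᵇ r
... | true  = n≤1+n _
... | false = ≤-refl
low-mono {suc n} r {s ∷ A} (keep c) = +-monoʳ-≤ ⟦ (n <ᵇ r) ∧ s ⟧ (low-mono r c)

low-suc : ∀ {n} r {A B : Subset n} → A ⋖ B → low r B ≤ suc (low r A)
low-suc {suc n} r {outside ∷ A} add with n <ᵇ r
... | true  = ≤-refl
... | false = n≤1+n _
low-suc {suc n} r {s ∷ A} (keep c) = ≤-trans (+-monoʳ-≤ ⟦ (n <ᵇ r) ∧ s ⟧ (low-suc r c)) (≤-reflexive (+-suc _ _))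

low-up : ∀ {n} r {A B : Subset n} → A ⋖ B → ⟦ (n <ᵇ r) ∧ true ⟧ + low r A ≤ low r B
low-up {n} r {A} {B} c with n <? r
... | yes p rewrite <ᵇ-true p | low-full A (<⇒≤ p) | low-full B (<⇒≤ p) = ≤-reflexive (sym (⋖-size c))
... | no ¬p with n <ᵇ r | <ᵇ⇒< n r
...   | false | _ = low-mono r c
...   | true  | q = contradiction (q tt) ¬p

-- Replacing the largest element by a smaller one keeps the size and cannot lower the number of
-- elements among the `r` smallest, which is `low-up`.
shifted-by-low : ∀ {n} r {f : Fam n} (φ : ℕ → ℕ → Bool) → (∀ {s l l′} → l ≤ l′ → φ s l ≡ true → φ s l′ ≡ true) →
  (∀ A → f A ≡ φ ∣ A ∣ (low r A)) → Shifted f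
shifted-by-low {zero}      r φ mono e = tt
shifted-by-low {suc n} r {f} φ mono e =
  shifted-by-low {n} r φ mono (λ A → trans (e (outside ∷ A)) (cong (φ ∣ A ∣) (low-out r A))) ,
  shifted-by-low {n} r (λ s l → φ (suc s) (⟦ (n <ᵇ r) ∧ true ⟧ + l)) (λ p → mono (+-monoʳ-≤ ⟦ (n <ᵇ r) ∧ true ⟧ p)) (λ A → e (inside ∷ A)) ,
  λ {A} {B} c m → trans (e (outside ∷ B)) (trans (cong (φ ∣ B ∣) (low-out r B))
    (mono (low-up r c) (subst (λ x → φ x (⟦ (n <ᵇ r) ∧ true ⟧ + low r A) ≡ true) (sym (⋖-size c)) (trans (sym (e (inside ∷ A))) m))))

bottom hitting : ∀ {n} → ℕ → ℕ → Fam n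
bottom  r k A = (∣ A ∣ ≡ᵇ k) ∧ (k ≤ᵇ low r A)
hitting r k A = (∣ A ∣ ≡ᵇ k) ∧ (1 ≤ᵇ low r A)

shifted-bottom : ∀ n r k → Shifted {n} (bottom r k)
shifted-bottom n r k = shifted-by-low r (λ s l → (s ≡ᵇ k) ∧ (k ≤ᵇ l))
  (λ {s} {l} p e → cong₂ _∧_ (proj₁ (∧-true {s ≡ᵇ k} e)) (≤ᵇ-true (≤-trans (true-≤ᵇ k l (proj₂ (∧-true {s ≡ᵇ k} e))) p))) (λ A → refl)

shifted-hitting : ∀ n r k → Shifted {n} (hitting r k)
shifted-hitting n r k = shifted-by-low r (λ s l → (s ≡ᵇ k) ∧ (1 ≤ᵇ l))
  (λ {s} {l} p e → cong₂ _∧_ (proj₁ (∧-true {s ≡ᵇ k} e)) (≤ᵇ-true (≤-trans (true-≤ᵇ 1 l (proj₂ (∧-true {s ≡ᵇ k} e))) p))) (λ A → refl)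

bottom-nonempty : ∀ m r → ∃[ A ] bottom {m + r} r r ∋ A
bottom-nonempty m r with set m
  where
  full : ∀ n → ∃[ A ] ∣_∣ {n} A ≡ n
  full zero    = [] , refl
  full (suc n) with full n
  ... | A , e = inside ∷ A , cong suc e
  set : ∀ m → ∃[ A ] (∣ A ∣ ≡ r × low {m + r} r A ≡ r)
  set zero    with full r
  ... | A , e = A , e , trans (low-full A ≤-refl) e
  set (suc m) with set m
  ... | A , e , e′ = outside ∷ A , e , trans (low-skip m r A) e′
... | A , e , e′ = A , cong₂ _∧_ (≡ᵇ-true e) (≤ᵇ-true (≤-reflexive (sym e′)))

meet-full : ∀ {n} (A B : Subset n) → ∣ A ∣ ≡ n → 1 ≤ ∣ B ∣ → Meet A B
meet-full []            []            e ()
meet-full (outside ∷ A) B             e p = contradiction (≤-trans (≤-reflexive (sym e)) (∣p∣≤n A)) 1+n≰n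
meet-full (inside ∷ A)  (inside ∷ B)  e p = here
meet-full (inside ∷ A)  (outside ∷ B) e p = there (meet-full A B (suc-injective e) p)

meet-low : ∀ m r (A B : Subset (m + r)) → r ≤ low r A → 1 ≤ low r B → Meet A B
meet-low zero    r A B p q = meet-full A B (≤-antisym (∣p∣≤n A)
  (≤-trans p (low≤size r A))) (≤-trans q (low≤size r B))
meet-low (suc m) r (s ∷ A) (t ∷ B) p q = there (meet-low m r A B (subst (r ≤_) (low-skip m r A) p) (subst (1 ≤_) (low-skip m r B) q))

low-subsets : ∀ m k {f : Fam (m + suc k)} → Shifted f → Uni k f → Avoids₁ f → ∀ A → ∣ A ∣ ≡ k → k ≤ low (suc k) A → f ∋ A
low-subsets zero    k sf uf nf A e _ = all-subsets k sf uf nf A e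
low-subsets (suc m) k sf uf nf (outside ∷ A) e p =
  low-subsets m k (proj₁ sf) (uni-lo uf) (avoids₁-lo sf uf (m≤n+m (suc k) m) nf) A e (subst (k ≤_) (low-skip m (suc k) A) p)
low-subsets (suc m) k sf uf nf (inside ∷ A)  e p =
  contradiction (≤-trans (≤-reflexive e) (subst (k ≤_) (low-skip m (suc k) A) p)) (<⇒≱ (s≤s (low≤size (suc k) A)))

count-avoiding-low : ∀ m r j {f : Fam (m + r)} → (∀ A → f ∋ A → ∣ A ∣ ≡ j × low r A ≡ 0) → count f ≤ binom m j
count-avoiding-low zero    r zero    {f} p = ≤-trans (count-mono {f = f} {g = size 0} (λ A m → ≡ᵇ-true (proj₁ (p A m)))) (≤-reflexive (count-size r 0))
count-avoiding-low zero    r (suc j) {f} p = ≤-reflexive (count-empty {f = f} λ A m →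
  contradiction (trans (sym (proj₁ (p A m))) (trans (sym (low-full A ≤-refl)) (proj₂ (p A m)))) λ ())
count-avoiding-low (suc m) r zero    {f} p = +-mono-≤ (count-avoiding-low m r zero (λ A q → proj₁ (p _ q) , trans (sym (low-skip m r A)) (proj₂ (p _ q))))
  (≤-reflexive (count-empty {f = hi f} λ A q → contradiction (proj₁ (p _ q)) λ ()))
count-avoiding-low (suc m) r (suc j) {f} p = ≤-trans (≤-reflexive (+-comm (count (lo f)) _))
  (+-mono-≤ (count-avoiding-low m r j {hi f} (λ A q → suc-injective (proj₁ (p _ q)) , trans (sym (low-skip m r A)) (proj₂ (p _ q))))
            (count-avoiding-low m r (suc j) {lo f} (λ A q → proj₁ (p _ q) , trans (sym (low-skip m r A)) (proj₂ (p _ q)))))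

count-hitting : ∀ m r j → binom (m + r) j ≤ count {m + r} (hitting r j) + binom m j
count-hitting m r j = begin
  binom (m + r) j                            ≡⟨ sym (count-size (m + r) j) ⟩
  count {m + r} (size j)                     ≤⟨ ∑-mono pointwise ⟩
  ∑ (λ A → ⟦ hitting r j A ⟧ + ⟦ rest A ⟧)   ≡⟨ ∑-+ (λ A → ⟦ hitting r j A ⟧) (λ A → ⟦ rest A ⟧) ⟩
  count {m + r} (hitting r j) + count rest   ≤⟨ +-monoʳ-≤ (count {m + r} (hitting r j)) (count-avoiding-low m r j λ A q →
                                                  true-≡ᵇ ∣ A ∣ j (proj₁ (∧-true {size j A} q)) , true-≡ᵇ (low r A) 0 (proj₂ (∧-true {size j A} q))) ⟩
  count {m + r} (hitting r j) + binom m j    ∎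
  where
  open ≤-Reasoning
  rest : Fam (m + r)
  rest A = size j A ∧ (low r A ≡ᵇ 0)
  pointwise : ∀ A → ⟦ size j A ⟧ ≤ ⟦ hitting r j A ⟧ + ⟦ rest A ⟧
  pointwise A with size j A | low r A
  ... | false | _     = z≤n
  ... | true  | zero  = ≤-refl
  ... | true  | suc _ = ≤-refl

count-containing₁ : ∀ n j {f : Fam (suc n)} → Uni (suc j) f → (∀ A → f ∋ A → ¬ low 1 A ≡ 0) → count f ≤ binom n j
count-containing₁ zero    zero    {f} u p = ≤-trans (count-mono {f = f} {g = size 1} (λ A m → ≡ᵇ-true (u A m))) ≤-refl
count-containing₁ zero    (suc j) {f} u p = ≤-reflexive (count-empty {f = f} λ { (true ∷ []) m → contradiction (u _ m) λ () ; (false ∷ []) m → contradiction (u _ m) λ () })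
count-containing₁ (suc n) zero    {f} u p = +-mono-≤ (count-containing₁ n zero {lo f} (uni-lo u) (λ A → p _))
  (≤-reflexive (count-empty {f = hi f} λ A m → p _ m (n≤0⇒n≡0 (≤-trans (low≤size 1 A) (≤-reflexive (uni-hi u A m))))))
count-containing₁ (suc n) (suc j) {f} u p = ≤-trans (≤-reflexive (+-comm (count (lo f)) _))
  (+-mono-≤ (count-containing₁ n j {hi f} (uni-hi u) (λ A → p _)) (count-containing₁ n (suc j) {lo f} (uni-lo u) (λ A → p _)))

-- The threshold `binom n j` is the size of a full star of (j+1)-sets; in `pair-bound-shifted` it is
-- d.
avoids₁-of-count : ∀ n j {f : Fam (suc n)} → Uni (suc j) f → binom n j < count f → Avoids₁ f
avoids₁-of-count n j {f} u p with search (λ A → f A ∧ (low 1 A ≡ᵇ 0))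
... | inj₁ (A , m) = A , proj₁ (∧-true {f A} m) , true-≡ᵇ (low 1 A) 0 (proj₂ (∧-true {f A} m))
... | inj₂ none    = contradiction (count-containing₁ n j u λ A m e →
  contradiction (trans (sym (cong₂ _∧_ m (≡ᵇ-true e))) (none A)) λ ()) (<⇒≱ p)

binom-mono : ∀ {n n′} k → n ≤ n′ → binom n k ≤ binom n′ k
binom-mono zero    _       = ≤-refl
binom-mono (suc k) z≤n     = z≤n
binom-mono (suc k) (s≤s p) = +-mono-≤ (binom-mono k p) (binom-mono (suc k) p)

bothOf-room : ∀ m k → suc k ≤ m → binom m (suc k) + bothOf (suc (m + (2 + k))) (2 + k) + 1 ≤ binom (m + (2 + k)) (suc k)
bothOf-room (suc m) k (s≤s k≤m) =
  lin 0 (+-mono-≤ (binom-pos (m≤n⇒m≤1+n k≤m)) (binom-mono (suc k) q)) (eq (binom (suc m) k) (binom (suc m) (suc k)) (binom N k) (binom N (suc k)))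
  where
  N = m + (2 + k)
  q : suc (suc m) ≤ N
  q = subst (_≤ N) (+-comm m 2) (+-monoʳ-≤ m (s≤s (s≤s z≤n)))
  eq : ∀ y x b z → x + b + 1 + (y + z) + 0 ≡ (b + z) + (1 + (y + x))
  eq = solve-∀

sum-bound-top′ : ∀ {n} m k → n ≡ m + suc (2 + k) → {f g : Fam n} → 1 ≤ k → suc k ≤ m →
  Shifted f → Shifted g → Uni (2 + k) f → Uni (2 + k) g → Avoids₁ f → Avoids₁ g → Cross f g →
  bothOf n (2 + k) + 2 ≤ count f → bothOf n (2 + k) + 2 ≤ count g →
  count f + count g + 2 * binom m (suc k) ≤ 2 * binom (m + (2 + k)) (suc k) + 2
sum-bound-top′ m k refl = sum-bound-top m k

-- Let r = k + 2 and let R be the set of the r smallest elements.  After adjoining a new smallest element 1,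
-- the bound for shifted families is applied to {1} ∪ P together with R, and to Q together with all
-- r-sets that contain 1 and meet R.
pair-bound-shifted : ∀ m k {p q : Fam (m + (2 + k))} → 1 ≤ k → suc k ≤ m → Shifted p → Shifted q →
  Uni (suc k) p → Uni (2 + k) q → Cross p q → 1 ≤ count q → bothOf (suc (m + (2 + k))) (2 + k) < count p →
  count p + count q + binom m (suc k) ≤ binom (m + (2 + k)) (suc k) + 1
-- From `top`, a bound on `|p| + |R| + |S| + |q| + 2G`, the adjoined families are subtracted by
-- means of `|R| ≥ 1` and `|S| + G ≥ M`.
pair-bound-shifted m@(suc m₁) k {p} {q} 1≤k k<m sp sq up uq c 1≤q b<p = lin 0
  (+-mono-≤ top (+-mono-≤ (count-pos {f = R} (proj₁ R∋) (proj₂ R∋)) (count-hitting m r (suc k)))) (trans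
    (eq (count p) (count q) (count R) (count S) G M)
      (cong₂ (λ x y → M + 1 + (x + y + 2 * G + (1 + M))) (sym (count-adjoin p R)) (sym (count-adjoin S q))))
  where
  r = 2 + k
  N = m + r
  R S : Fam N
  R = bottom r r
  S = hitting r (suc k)
  G = binom m (suc k)
  M = binom N (suc k)
  R∋ = bottom-nonempty m r
  eq : ∀ p q r s g m → p + q + g + (2 * m + 2 + (r + (s + g))) + 0 ≡ m + 1 + ((p + r) + (s + q) + 2 * g + (1 + m))
  eq = solve-∀
  R-size : ∀ A → R ∋ A → ∣ A ∣ ≡ r
  R-size A e = true-≡ᵇ ∣ A ∣ r (proj₁ (∧-true {size r A} e))
  R-low : ∀ A → R ∋ A → r ≤ low r A
  R-low A e = true-≤ᵇ r (low r A) (proj₂ (∧-true {size r A} e))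
  S-low : ∀ A → S ∋ A → 1 ≤ low r A
  S-low A e = true-≤ᵇ 1 (low r A) (proj₂ (∧-true {size (suc k) A} e))
  np : Avoids₁ p
  np = avoids₁-of-count (m₁ + r) k up b<p
  tq : TwoLow (suc k) q
  tq = twoLow-of m (suc k) sp up np c
  below : ∀ {A B : Subset N} {j} → A ⋖ B → ∣ B ∣ ≡ suc j → ∣ A ∣ ≡ j
  below d e = suc-injective (trans (sym (⋖-size d)) e)
  -- Trading an element of a member of `R` for the new point must lead into `p`: what remains is a
  -- (k+1)-subset of the k + 2 smallest points, so `low-subsets` applies. For `sg`, a member of `q`
  -- has two low elements, and after deleting one point it still meets the low ones.
  sf : Shifted (adjoin p R)
  sf = shifted-adjoin sp (shifted-bottom N r r) λ {A} {B} d e →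
    low-subsets m (suc k) sp up np A (below d (R-size B e)) (≤-pred (≤-trans (R-low B e) (low-suc r d)))
  sg : Shifted (adjoin S q)
  sg = shifted-adjoin (shifted-hitting N r (suc k)) sq λ {A} {B} d e →
    cong₂ _∧_ (≡ᵇ-true (below d (uq B e))) (≤ᵇ-true (≤-pred (≤-trans (tq B e) (low-suc r d))))
  q∋ : ∃[ B ] q ∋ B
  q∋ = count-witness {f = q} 1≤q
  -- This serves the threshold d + 2 of `sum-bound-top`: `S` has at least d + 1 members, and `q`
  -- contributes one more.
  room : bothOf (suc N) r + 1 ≤ count S
  room = +-cancelˡ-≤ G _ _ (≤-trans (≤-reflexive (sym (+-assoc G (bothOf (suc N) r) 1)))
    (≤-trans (bothOf-room m k k<m) (≤-trans (count-hitting m r (suc k)) (≤-reflexive (+-comm (count S) G)))))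
  large-f : bothOf (suc N) r + 2 ≤ count (adjoin p R)
  large-f = begin
    bothOf (suc N) r + 2      ≡⟨ sym (+-assoc (bothOf (suc N) r) 1 1) ⟩
    bothOf (suc N) r + 1 + 1  ≤⟨ +-mono-≤ (≤-trans (≤-reflexive (+-comm (bothOf (suc N) r) 1)) b<p)
                                          (count-pos {f = R} (proj₁ R∋) (proj₂ R∋)) ⟩
    count p + count R         ≡⟨ sym (count-adjoin p R) ⟩
    count (adjoin p R)        ∎
    where open ≤-Reasoning
  large-g : bothOf (suc N) r + 2 ≤ count (adjoin S q)
  large-g = begin
    bothOf (suc N) r + 2      ≡⟨ sym (+-assoc (bothOf (suc N) r) 1 1) ⟩
    bothOf (suc N) r + 1 + 1  ≤⟨ +-mono-≤ room 1≤q ⟩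
    count S + count q         ≡⟨ sym (count-adjoin S q) ⟩
    count (adjoin S q)        ∎
    where open ≤-Reasoning
  top : count (adjoin p R) + count (adjoin S q) + 2 * G ≤ 2 * M + 2
  top = sum-bound-top′ m k (sym (+-suc m r)) 1≤k k<m sf sg
    (uni-adjoin up R-size) (uni-adjoin (λ A e → true-≡ᵇ ∣ A ∣ (suc k) (proj₁ (∧-true {size (suc k) A} e))) uq)
    (avoids₁-adjoin {f = p} {R} (proj₁ R∋) (proj₂ R∋)) (avoids₁-adjoin {f = S} {q} (proj₁ q∋) (proj₂ q∋))
    (cross-adjoin c (λ A B a b → meet-low m r A B (R-low A a) (S-low B b))
                    (λ A B a b → meet-low m r A B (R-low A a) (<⇒≤ (tq B b))))
    large-f large-g

record Pair {n : ℕ} (j k a b : ℕ) (f g : Fam n) : Set where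
  constructor pair
  field
    uniˡ   : Uni j f
    uniʳ   : Uni k g
    cross  : Cross f g
    countˡ : count f ≡ a
    countʳ : count g ≡ b

pair-shift : ∀ {n j k a b} (p : Pos n) f g → Pair j k a b f g → Pair j k a b (shift p f) (shift p g)
pair-shift p f g (pair u v c e e′) =
  pair (uni-shift p {f} u) (uni-shift p {g} v) (cross-shift p {f} {g} c) (trans (count-shift p f) e) (trans (count-shift p g) e′)

-- Uniformity, sizes and cross-intersection survive every shift, and that `p` is not a star at 1 is
-- recovered afterwards from its size; hence the exit is `⊥`.
pair-bound : ∀ m k {p q : Fam (m + (2 + k))} → 1 ≤ k → suc k ≤ m →
  Uni (suc k) p → Uni (2 + k) q → Cross p q → 1 ≤ count q → bothOf (suc (m + (2 + k))) (2 + k) < count p →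
  count p + count q + binom m (suc k) ≤ binom (m + (2 + k)) (suc k) + 1
pair-bound m@(suc (suc m₂)) k {p} {q} 1≤k k<m up uq c 1≤q b<p
  with shift-until (Pair (suc k) (2 + k) (count p) (count q)) {⊥} (λ s f g x → inj₁ (pair-shift s f g x)) p q (pair up uq c refl refl)
... | inj₁ (f , g , pair uf ug d e e′ , sf , sg) =
  subst₂ (λ x y → x + y + binom m (suc k) ≤ binom (m + (2 + k)) (suc k) + 1) e e′
    (pair-bound-shifted m k 1≤k k<m (stable-shifted {f = f} sf) (stable-shifted {f = g} sg) uf ug d
      (subst (1 ≤_) (sym e′) 1≤q) (subst (bothOf (suc (m + (2 + k))) (2 + k) <_) (sym e) b<p))
pair-bound (suc zero) (suc k) _ (s≤s ())
pair-bound zero       k       _ ()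
pair-bound (suc zero) zero    ()

pair-bound′ : ∀ {n} m k → n ≡ m + (2 + k) → {p q : Fam n} → 1 ≤ k → suc k ≤ m →
  Uni (suc k) p → Uni (2 + k) q → Cross p q → 1 ≤ count q → bothOf (suc n) (2 + k) < count p →
  count p + count q + binom m (suc k) ≤ binom n (suc k) + 1
pair-bound′ m k refl = pair-bound m k

join : ∀ {n} → Fam n → Fam n → Fam (suc n)
join f g (false ∷ A) = f A
join f g (true ∷ A)  = g A

-- A new point z is added: `p` together with all {z} ∪ K for k-sets K, against all {z} ∪ B with B in
-- `q`. The sets K number `binom n k`, which is the extra summand and, with one member of `p`,
-- enough for the size condition of `pair-bound`.
balanced-bound : ∀ {n} m k → suc n ≡ m + (2 + k) → {p q : Fam n} → 1 ≤ k → suc k ≤ m →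
  Uni (suc k) p → Uni (suc k) q → Cross p q → 1 ≤ count p → 1 ≤ count q →
  count p + count q + bothOf (2 + n) (2 + k) + binom m (suc k) ≤ binom (suc n) (suc k) + 1
balanced-bound {n} m k e {p} {q} 1≤k k<m up uq c 1≤p 1≤q =
  ≤-trans (≤-reflexive count-eq) (pair-bound′ m k e {join p (size k)} {join (λ _ → false) q} 1≤k k<m up′ uq′ c′
    (≤-trans 1≤q (m≤n+m (count q) (count {n} (λ _ → false)))) large)
  where
  up′ : Uni (suc k) (join p (size k))
  up′ (false ∷ A) m = up A m
  up′ (true ∷ A)  m = cong suc (true-≡ᵇ ∣ A ∣ k m)
  uq′ : Uni (2 + k) (join (λ _ → false) q)
  uq′ (true ∷ A)  m = cong suc (uq A m)
  c′ : Cross (join p (size k)) (join (λ _ → false) q)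
  c′ (false ∷ A) (true ∷ B) a b = there (c A B a b)
  c′ (true ∷ A)  (true ∷ B) a b = here
  none : count {n} (λ _ → false) ≡ 0
  none = count-none {n} {λ _ → false} (λ _ → refl)
  large : binom n k < count (join p (size k))
  large = +-mono-≤ 1≤p (≤-reflexive (sym (count-size n k)))
  eq : ∀ a b c g → a + b + c + g ≡ (a + c) + (0 + b) + g
  eq = solve-∀
  count-eq : count p + count q + binom n k + binom m (suc k) ≡
    count (join p (size k)) + count (join (λ _ → false) q) + binom m (suc k)
  count-eq = trans (eq (count p) (count q) (binom n k) (binom m (suc k)))
    (cong₂ (λ x y → (count p + x) + (y + count q) + binom m (suc k)) (sym (count-size n k)) (sym none))

-- Log-concavity and sums of consecutive binomial coefficients

binom-one : ∀ n → binom n 1 ≡ n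
binom-one zero    = refl
binom-one (suc n) = cong suc (binom-one n)

binom-absorb : ∀ n k → binom n (suc k) * suc k ≡ binom n k * (n ∸ k)
binom-absorb zero    k       rewrite 0∸n≡0 k = sym (*-zeroʳ (binom 0 k))
binom-absorb (suc n) zero    = trans (*-identityʳ _) (trans (cong suc (binom-one n)) (sym (+-identityʳ (suc n))))
binom-absorb (suc n) (suc k) = begin
  (binom n (suc k) + binom n (suc (suc k))) * suc (suc k)
    ≡⟨ *-distribʳ-+ (suc (suc k)) (binom n (suc k)) _ ⟩
  binom n (suc k) * suc (suc k) + binom n (suc (suc k)) * suc (suc k)
    ≡⟨ cong (binom n (suc k) * suc (suc k) +_) (binom-absorb n (suc k)) ⟩
  binom n (suc k) * suc (suc k) + binom n (suc k) * (n ∸ suc k)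
    ≡⟨ middle ⟩
  binom n (suc k) * suc k + binom n (suc k) * (n ∸ k)
    ≡⟨ cong (_+ binom n (suc k) * (n ∸ k)) (binom-absorb n k) ⟩
  binom n k * (n ∸ k) + binom n (suc k) * (n ∸ k)
    ≡⟨ sym (*-distribʳ-+ (n ∸ k) (binom n k) _) ⟩
  (binom n k + binom n (suc k)) * (n ∸ k)  ∎
  where
  open ≡-Reasoning
  eq : ∀ b k x → b * suc (suc k) + b * x ≡ b * suc k + b * suc x
  eq = solve-∀
  middle : binom n (suc k) * suc (suc k) + binom n (suc k) * (n ∸ suc k) ≡ binom n (suc k) * suc k + binom n (suc k) * (n ∸ k)
  middle with suc k ≤? n
  ... | yes p = trans (eq (binom n (suc k)) k (n ∸ suc k)) (cong (λ x → binom n (suc k) * suc k + binom n (suc k) * x) (sym (+-∸-assoc 1 p)))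
  ... | no ¬p rewrite binom-zero {n} {suc k} (≰⇒> ¬p) = refl

binom-ratio : ∀ {x y} c → x ≤ y → binom (suc y) c * binom x c ≤ binom (suc x) c * binom y c
binom-ratio zero x≤y = ≤-refl
binom-ratio {x} {y} (suc c) x≤y = begin
  (binom y c + binom y (suc c)) * binom x (suc c)                    ≡⟨ *-distribʳ-+ (binom x (suc c)) (binom y c) _ ⟩
  binom y c * binom x (suc c) + binom y (suc c) * binom x (suc c)    ≤⟨ +-mono-≤ cross-ratio (≤-reflexive (*-comm (binom y (suc c)) _)) ⟩
  binom x c * binom y (suc c) + binom x (suc c) * binom y (suc c)    ≡⟨ sym (*-distribʳ-+ (binom y (suc c)) (binom x c) _) ⟩
  (binom x c + binom x (suc c)) * binom y (suc c)                    ∎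
  where
  open ≤-Reasoning
  assoc′ : ∀ a b c → a * (b * c) ≡ b * (a * c)
  assoc′ = solve-∀
  cross-ratio : binom y c * binom x (suc c) ≤ binom x c * binom y (suc c)
  cross-ratio = *-cancelʳ-≤ _ _ (suc c) (begin
    binom y c * binom x (suc c) * suc c    ≡⟨ *-assoc (binom y c) _ _ ⟩
    binom y c * (binom x (suc c) * suc c)  ≡⟨ cong (binom y c *_) (binom-absorb x c) ⟩
    binom y c * (binom x c * (x ∸ c))      ≤⟨ *-monoʳ-≤ (binom y c) (*-monoʳ-≤ (binom x c) (∸-monoˡ-≤ c x≤y)) ⟩
    binom y c * (binom x c * (y ∸ c))      ≡⟨ assoc′ (binom y c) (binom x c) (y ∸ c) ⟩
    binom x c * (binom y c * (y ∸ c))      ≡⟨ cong (binom x c *_) (sym (binom-absorb y c)) ⟩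
    binom x c * (binom y (suc c) * suc c)  ≡⟨ sym (*-assoc (binom x c) _ _) ⟩
    binom x c * binom y (suc c) * suc c    ∎)

-- The ratio inequality `binom-ratio` is multiplied over `b` steps. Each step cancels the factor
-- `X`, which is positive for `c ≤ x`; otherwise the left side is 0.
binom-log-concave : ∀ c x a b → binom (x + a + b) c * binom x c ≤ binom (x + a) c * binom (x + b) c
binom-log-concave c x a zero    = ≤-reflexive (cong₂ (λ y z → binom y c * binom z c) (+-identityʳ (x + a)) (sym (+-identityʳ x)))
binom-log-concave c x a (suc b) with c ≤? x
... | no ¬p rewrite binom-zero (≰⇒> ¬p) | *-zeroʳ (binom (x + a + suc b) c) = z≤n
... | yes c≤x rewrite +-suc (x + a) b | +-suc x b = *-cancelʳ-≤ _ _ X (begin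
  binom (suc y) c * binom x c * X                ≡⟨ eq₁ (binom (suc y) c) (binom x c) X ⟩
  (binom (suc y) c * X) * binom x c              ≤⟨ *-monoˡ-≤ (binom x c) (binom-ratio c (+-monoˡ-≤ b (m≤m+n x a))) ⟩
  (X⁺ * binom y c) * binom x c                   ≡⟨ *-assoc X⁺ _ _ ⟩
  X⁺ * (binom y c * binom x c)                   ≤⟨ *-monoʳ-≤ X⁺ (binom-log-concave c x a b) ⟩
  X⁺ * (binom (x + a) c * X)                     ≡⟨ eq₂ X⁺ (binom (x + a) c) X ⟩
  binom (x + a) c * X⁺ * X                       ∎)
  where
  open ≤-Reasoning
  y = x + a + b
  X = binom (x + b) c
  X⁺ = binom (suc (x + b)) c
  instance
    X≢0 : NonZero X
    X≢0 = >-nonZero (binom-pos (≤-trans c≤x (m≤m+n x b)))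
  eq₁ : ∀ a b c → a * b * c ≡ (a * c) * b
  eq₁ = solve-∀
  eq₂ : ∀ a b c → a * (b * c) ≡ b * a * c
  eq₂ = solve-∀

-- binom m c + … + binom (m + s - 1) c
window : ℕ → ℕ → ℕ → ℕ
window c m zero    = 0
window c m (suc s) = window c m s + binom (m + s) c

-- With `c = k - 2` and `m = n - k - 1` this gives `h - 1 = window c m k`, a sum of k binomials with
-- d as its largest term.
hockey-stick : ∀ c m s → binom (m + s) (suc c) ≡ binom m (suc c) + window c m s
hockey-stick c m zero    = trans (cong (λ x → binom x (suc c)) (+-identityʳ m)) (sym (+-identityʳ _))
hockey-stick c m (suc s) rewrite +-suc m s | hockey-stick c m s = eq (binom (m + s) c) (binom m (suc c)) (window c m s)
  where
  eq : ∀ a b w → a + (b + w) ≡ b + (w + a)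
  eq = solve-∀

window-split : ∀ c m s t → window c m (s + t) ≡ window c m s + window c (m + s) t
window-split c m s zero    = trans (cong (window c m) (+-identityʳ s)) (sym (+-identityʳ _))
window-split c m s (suc t) rewrite +-suc s t | window-split c m s t | +-assoc m s t = +-assoc (window c m s) _ _

binom-log-concave′ : ∀ c {x a b u v w} → u ≡ x + a + b → v ≡ x + a → w ≡ x + b →
  binom u c * binom x c ≤ binom v c * binom w c
binom-log-concave′ c {x} {a} {b} refl refl refl = binom-log-concave c x a b

-- Log-concavity termwise: `(q + k + k) + (q + s + i)` equals `(q + k + s) + (q + k + i)`, and the
-- second pair of indices lies closer together.
window-bound₂ : ∀ c q k {s} t → s ≤ k → t ≤ suc k →
  binom (q + k + k) c * window c (q + s) t ≤ binom (q + k + s) c * window c (q + k) t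
window-bound₂ c q k {s} zero    _   _         = ≤-reflexive (trans (*-zeroʳ (binom (q + k + k) c)) (sym (*-zeroʳ (binom (q + k + s) c))))
window-bound₂ c q k {s} (suc t) s≤k (s≤s t≤k) = begin
  d * (window c (q + s) t + binom (q + s + t) c)                      ≡⟨ *-distribˡ-+ d _ _ ⟩
  d * window c (q + s) t + d * binom (q + s + t) c                    ≤⟨ +-mono-≤ (window-bound₂ c q k t s≤k (m≤n⇒m≤1+n t≤k)) term ⟩
  b * window c (q + k) t + b * binom (q + k + t) c                    ≡⟨ sym (*-distribˡ-+ b _ _) ⟩
  b * (window c (q + k) t + binom (q + k + t) c)                      ∎
  where
  open ≤-Reasoning
  d = binom (q + k + k) c
  b = binom (q + k + s) c
  s+ : s + (k ∸ s) ≡ k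
  s+ = m+[n∸m]≡n s≤k
  t+ : t + (k ∸ t) ≡ k
  t+ = m+[n∸m]≡n t≤k
  e₁ : ∀ q s t x y → q + (s + y) + (t + x) ≡ q + s + t + x + y
  e₁ = solve-∀
  e₂ : ∀ q s t x → q + (t + x) + s ≡ q + s + t + x
  e₂ = solve-∀
  e₃ : ∀ q s t y → q + (s + y) + t ≡ q + s + t + y
  e₃ = solve-∀
  term : d * binom (q + s + t) c ≤ b * binom (q + k + t) c
  term = binom-log-concave′ c {q + s + t} {k ∸ t} {k ∸ s}
    (trans (cong₂ (λ y z → q + y + z) (sym s+) (sym t+)) (e₁ q s t (k ∸ t) (k ∸ s)))
    (trans (cong (λ y → q + y + s) (sym t+)) (e₂ q s t (k ∸ t)))
    (trans (cong (λ y → q + y + t) (sym s+)) (e₃ q s t (k ∸ s)))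

window-bound₁ : ∀ c m s e t → t ≤ suc s →
  binom (m + (s + e)) c * window c m t ≤ binom (m + s) c * window c (m + e) t
window-bound₁ c m s e zero    _         = ≤-reflexive (trans (*-zeroʳ (binom (m + (s + e)) c)) (sym (*-zeroʳ (binom (m + s) c))))
window-bound₁ c m s e (suc t) (s≤s t≤s) = begin
  d * (window c m t + binom (m + t) c)                    ≡⟨ *-distribˡ-+ d _ _ ⟩
  d * window c m t + d * binom (m + t) c                  ≤⟨ +-mono-≤ (window-bound₁ c m s e t (m≤n⇒m≤1+n t≤s)) term ⟩
  b * window c (m + e) t + b * binom (m + e + t) c        ≡⟨ sym (*-distribˡ-+ b _ _) ⟩
  b * (window c (m + e) t + binom (m + e + t) c)          ∎
  where
  open ≤-Reasoning
  d = binom (m + (s + e)) c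
  b = binom (m + s) c
  t+ : t + (s ∸ t) ≡ s
  t+ = m+[n∸m]≡n t≤s
  e₁ : ∀ m t x e → m + ((t + x) + e) ≡ m + t + x + e
  e₁ = solve-∀
  e₂ : ∀ m t x → m + (t + x) ≡ m + t + x
  e₂ = solve-∀
  e₃ : ∀ m e t → m + e + t ≡ m + t + e
  e₃ = solve-∀
  term : d * binom (m + t) c ≤ b * binom (m + e + t) c
  term = binom-log-concave′ c {m + t} {s ∸ t} {e}
    (trans (cong (λ y → m + (y + e)) (sym t+)) (e₁ m t (s ∸ t) e))
    (trans (cong (m +_) (sym t+)) (e₂ m t (s ∸ t)))
    (e₃ m e t)

window-length : ∀ {c m} s → c ≤ m → s ≤ window c m s
window-length         zero    _   = z≤n
window-length {c} {m} (suc s) c≤m = subst (_≤ window c m (suc s)) (+-comm s 1)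
  (+-mono-≤ (window-length s c≤m) (binom-pos (≤-trans c≤m (m≤m+n m s))))

-- The long window splits into its first `e` terms and a window of length `s + 1`. Log-concavity
-- handles the latter; the former, with terms at least 1, give the surplus `e * binom (m + s) c`.
window-bound : ∀ c m s e → c ≤ m →
  binom (m + (s + e)) c * window c m (suc s) + e * binom (m + s) c ≤ binom (m + s) c * window c m (suc (s + e))
window-bound c m s e c≤m = begin
  d * window c m (suc s) + e * b                       ≤⟨ +-mono-≤ (window-bound₁ c m s e (suc s) ≤-refl) (*-monoˡ-≤ b (window-length e c≤m)) ⟩
  b * window c (m + e) (suc s) + window c m e * b      ≡⟨ eq b (window c (m + e) (suc s)) (window c m e) ⟩
  b * (window c m e + window c (m + e) (suc s))        ≡⟨ cong (b *_) (sym (window-split c m e (suc s))) ⟩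
  b * window c m (e + suc s)                           ≡⟨ cong (λ x → b * window c m x) (trans (+-suc e s) (cong suc (+-comm e s))) ⟩
  b * window c m (suc (s + e))                         ∎
  where
  open ≤-Reasoning
  d = binom (m + (s + e)) c
  b = binom (m + s) c
  eq : ∀ b x y → b * x + y * b ≡ b * (y + x)
  eq = solve-∀

-- By `binom-window₂` this is the number of (c+2)-subsets of `m + s + 1` points with at least two
-- elements among the `s + 1` smallest.
window₂ : ℕ → ℕ → ℕ → ℕ
window₂ c m zero    = 0
window₂ c m (suc s) = window₂ c m s + window c m (suc s)

window-weighted : ℕ → ℕ → ℕ → ℕ → ℕ
window-weighted c m k zero    = 0
window-weighted c m k (suc s) = window-weighted c m k s + (k ∸ s) * binom (m + s) c

-- Summing `window-bound` over the prefixes collects the surpluses in `window-weighted`. For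
-- `s = k + 1` they amount, by `window₂-count`, to `window₂` minus one full window, which allows the
-- factor d + 1 instead of d.
window₂-bound : ∀ c m k s → c ≤ m → s ≤ suc k →
  binom (m + k) c * window₂ c m s + window-weighted c m k s ≤ window c m s * window c m (suc k)
window₂-bound c m k zero    c≤m _ = ≤-reflexive (trans (+-identityʳ _) (*-zeroʳ (binom (m + k) c)))
window₂-bound c m k (suc s) c≤m (s≤s s≤k) = begin
  d * (w₂ + window c m (suc s)) + (v + (k ∸ s) * b)            ≡⟨ eq d w₂ (window c m (suc s)) v ((k ∸ s) * b) ⟩
  (d * w₂ + v) + (d * window c m (suc s) + (k ∸ s) * b)        ≤⟨ +-mono-≤ (window₂-bound c m k s c≤m (m≤n⇒m≤1+n s≤k)) step ⟩
  window c m s * H + b * H                                     ≡⟨ sym (*-distribʳ-+ H (window c m s) b) ⟩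
  (window c m s + b) * H                                       ∎
  where
  open ≤-Reasoning
  d = binom (m + k) c
  b = binom (m + s) c
  H = window c m (suc k)
  w₂ = window₂ c m s
  v = window-weighted c m k s
  eq : ∀ d a b v x → d * (a + b) + (v + x) ≡ (d * a + v) + (d * b + x)
  eq = solve-∀
  step : d * window c m (suc s) + (k ∸ s) * b ≤ b * H
  step = subst (λ x → binom (m + x) c * window c m (suc s) + (k ∸ s) * b ≤ b * window c m (suc x)) (m+[n∸m]≡n s≤k)
           (window-bound c m s (k ∸ s) c≤m)

window₂-count : ∀ c m k s → s ≤ suc k → window₂ c m s + (suc k ∸ s) * window c m s ≡ window c m s + window-weighted c m k s
window₂-count c m k zero    _         = *-zeroʳ k
window₂-count c m k (suc s) (s≤s s≤k) = begin
  (w₂ + (w + b)) + (k ∸ s) * (w + b)           ≡⟨ eq₁ w₂ w b (k ∸ s) ⟩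
  w₂ + suc (k ∸ s) * w + (b + (k ∸ s) * b)     ≡⟨ cong (λ x → w₂ + x * w + (b + (k ∸ s) * b)) (sym (+-∸-assoc 1 s≤k)) ⟩
  w₂ + (suc k ∸ s) * w + (b + (k ∸ s) * b)     ≡⟨ cong (_+ (b + (k ∸ s) * b)) (window₂-count c m k s (m≤n⇒m≤1+n s≤k)) ⟩
  w + v + (b + (k ∸ s) * b)                    ≡⟨ eq₂ w v b ((k ∸ s) * b) ⟩
  (w + b) + (v + (k ∸ s) * b)                  ∎
  where
  open ≡-Reasoning
  w₂ = window₂ c m s
  w = window c m s
  b = binom (m + s) c
  v = window-weighted c m k s
  eq₁ : ∀ a w b x → (a + (w + b)) + x * (w + b) ≡ a + suc x * w + (b + x * b)
  eq₁ = solve-∀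
  eq₂ : ∀ w v b x → w + v + (b + x) ≡ (w + b) + (v + x)
  eq₂ = solve-∀

count-twoLow : ∀ m r j {f : Fam (m + suc r)} → Uni (suc j) f → TwoLow r f →
  count f + binom m (suc j) + suc r * binom m j ≤ binom (m + suc r) (suc j)
count-twoLow m r zero {f} u t rewrite twoLow-empty {f = f} u t | binom-one m | binom-one (m + suc r) =
  ≤-reflexive (cong (m +_) (*-identityʳ (suc r)))
count-twoLow zero r (suc j) {f} u t = begin
  count f + 0 + suc r * 0             ≡⟨ cong₂ _+_ (+-identityʳ (count f)) (*-zeroʳ (suc r)) ⟩
  count f + 0                         ≡⟨ +-identityʳ (count f) ⟩
  count f                             ≤⟨ count-mono {f = f} {g = size (2 + j)} (λ A m → ≡ᵇ-true (u A m)) ⟩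
  count {suc r} (size (2 + j))        ≡⟨ count-size (suc r) (2 + j) ⟩
  binom (suc r) (2 + j)               ∎
  where open ≤-Reasoning
count-twoLow (suc m) r (suc j) {f} u t = lin 0
  (+-mono-≤ (count-twoLow m r (suc j) (uni-lo u) (twoLow-lo m r t)) (count-twoLow m r j {hi f} (uni-hi u) (twoLow-hi m r t)))
  (eq (count (lo f)) (count (hi f)) (binom m j) (binom m (suc j)) (binom m (2 + j)) (binom (m + suc r) (suc j)) (binom (m + suc r) (2 + j)) (suc r))
  where
  eq : ∀ x y a b c u v r → (x + y) + (b + c) + r * (a + b) + (v + u) + 0 ≡ (u + v) + ((x + c + r * b) + (y + b + r * a))
  eq = solve-∀

binom-window₂ : ∀ c m s → binom (suc m + s) (2 + c) ≡ binom m (2 + c) + suc s * binom m (suc c) + window₂ c m s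
binom-window₂ c m zero    = trans (cong (λ x → binom (suc x) (2 + c)) (+-identityʳ m)) (eq (binom m (suc c)) (binom m (2 + c)))
  where
  eq : ∀ a b → a + b ≡ b + 1 * a + 0
  eq = solve-∀
binom-window₂ c m (suc s) rewrite +-suc m s | binom-window₂ c m s | cong (λ x → binom x (suc c)) (sym (+-suc m s)) | hockey-stick c m (suc s) =
  eq (binom m (suc c)) (binom m (2 + c)) (window c m (suc s)) (window₂ c m s) s
  where
  eq : ∀ a b w v s → (a + w) + (b + suc s * a + v) ≡ b + suc (suc s) * a + (v + w)
  eq = solve-∀

-- With `d * w₂ + v ≤ H * H` and `w₂ = H + v`, one more copy of `w₂` costs only `H`. This is the
-- gain of the shifted case over `product-cover`.
product-twoLow : ∀ c m {a} {f : Fam (m + suc (2 + c))} → suc c ≤ m → Uni (2 + c) f → TwoLow (2 + c) f →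
  a ≤ suc (binom (m + suc c) c) → a * count f ≤ window c m (2 + c) * suc (window c m (2 + c))
product-twoLow c m {a} {f} c<m u t a≤ = begin
  a * count f                           ≤⟨ *-mono-≤ a≤ f≤ ⟩
  suc d * w₂                            ≡⟨ +-comm w₂ (d * w₂) ⟩
  d * w₂ + w₂                           ≡⟨ cong (d * w₂ +_) w₂≡ ⟩
  d * w₂ + (H + v)                      ≡⟨ eq (d * w₂) H v ⟩
  d * w₂ + v + H                        ≤⟨ +-monoˡ-≤ H (window₂-bound c m (suc c) (2 + c) (<⇒≤ c<m) ≤-refl) ⟩
  H * H + H                             ≡⟨ +-comm (H * H) H ⟩
  H + H * H                             ≡⟨ sym (*-suc H H) ⟩
  H * suc H                             ∎
  where
  open ≤-Reasoning
  k = 2 + c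
  d = binom (m + suc c) c
  H = window c m k
  w₂ = window₂ c m k
  v = window-weighted c m (suc c) k
  eq : ∀ x y z → x + (y + z) ≡ x + z + y
  eq = solve-∀
  w₂≡ : w₂ ≡ H + v
  w₂≡ = trans (sym (+-identityʳ w₂)) (trans (cong (λ x → w₂ + x * H) (sym (n∸n≡0 k))) (window₂-count c m (suc c) k ≤-refl))
  f≤ : count f ≤ w₂
  f≤ = lin 0 (≤-trans (count-twoLow m k (suc c) u t) (≤-reflexive (trans (cong (λ x → binom x k) (+-suc m k)) (binom-window₂ c m k))))
         (eq′ (count f) w₂ (binom m k) (binom m (suc c)) (suc k))
    where
    eq′ : ∀ f w b g k → f + (b + k * g + w) + 0 ≡ w + (f + b + k * g)
    eq′ = solve-∀

-- Non-trivial families: d |g| ≤ (h - 1)²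

avoids : ∀ {n} → Subset n → Fam n
avoids []      []      = true
avoids (s ∷ E) (t ∷ B) = not (s ∧ t) ∧ avoids E B

avoids-meet : ∀ {n} {E B : Subset n} → Meet E B → avoids E B ≡ false
avoids-meet here = refl
avoids-meet {E = s ∷ E} {t ∷ B} (there m) rewrite avoids-meet m = ∧-zeroʳ (not (s ∧ t))

avoids-insert : ∀ {n} (E : Subset n) x B → avoids (E [ x ]≔ true) B ≡ avoids E B ∧ not (lookup B x)
avoids-insert (true ∷ E)  0F    (true ∷ B)  = refl
avoids-insert (false ∷ E) 0F    (true ∷ B)  = sym (∧-zeroʳ (avoids E B))
avoids-insert (true ∷ E)  0F    (false ∷ B) = sym (∧-identityʳ (avoids E B))
avoids-insert (false ∷ E) 0F    (false ∷ B) = sym (∧-identityʳ (avoids E B))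
avoids-insert (s ∷ E)     (sucF x) (t ∷ B) with s ∧ t
... | true  = refl
... | false = avoids-insert E x B

avoids-∪ : ∀ {n} (E A B : Subset n) → avoids (E ∪ A) B ≡ avoids E B ∧ avoids A B
avoids-∪ []          []          []          = refl
avoids-∪ (true ∷ E)  (_ ∷ A)     (true ∷ B)  = refl
avoids-∪ (false ∷ E) (true ∷ A)  (true ∷ B)  = sym (∧-zeroʳ (avoids E B))
avoids-∪ (false ∷ E) (false ∷ A) (true ∷ B)  = avoids-∪ E A B
avoids-∪ (true ∷ E)  (true ∷ A)  (false ∷ B) = avoids-∪ E A B
avoids-∪ (true ∷ E)  (false ∷ A) (false ∷ B) = avoids-∪ E A B
avoids-∪ (false ∷ E) (true ∷ A)  (false ∷ B) = avoids-∪ E A B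
avoids-∪ (false ∷ E) (false ∷ A) (false ∷ B) = avoids-∪ E A B

avoids-remove : ∀ {n} (D : Subset n) x B → lookup D x ≡ true → avoids D B ≡ avoids (D [ x ]≔ false) B ∧ not (lookup B x)
avoids-remove (true ∷ D) 0F    (true ∷ B)  _ = sym (∧-zeroʳ (avoids D B))
avoids-remove (true ∷ D) 0F    (false ∷ B) _ = sym (∧-identityʳ (avoids D B))
avoids-remove (s ∷ D)    (sucF x) (t ∷ B)     e with s ∧ t
... | true  = refl
... | false = avoids-remove D x B e

size-remove : ∀ {n} (D : Subset n) x → lookup D x ≡ true → ∣ D ∣ ≡ suc ∣ D [ x ]≔ false ∣
size-remove (true ∷ D)  0F    _ = refl
size-remove (true ∷ D)  (sucF x) e = cong suc (size-remove D x e)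
size-remove (false ∷ D) (sucF x) e = size-remove D x e

∁-insert : ∀ {n} (E : Subset n) x → lookup E x ≡ false → ∣ ∁ E ∣ ≡ suc ∣ ∁ (E [ x ]≔ true) ∣
∁-insert (false ∷ E) 0F    _ = refl
∁-insert (true ∷ E)  (sucF x) e = ∁-insert E x e
∁-insert (false ∷ E) (sucF x) e = cong suc (∁-insert E x e)

∁-∪ : ∀ {n} (E A : Subset n) → ∣ ∁ E ∣ ≤ ∣ ∁ (E ∪ A) ∣ + ∣ A ∣
∁-∪ []          []          = z≤n
∁-∪ (true ∷ E)  (true ∷ A)  = ≤-trans (∁-∪ E A) (+-monoʳ-≤ ∣ ∁ (E ∪ A) ∣ (n≤1+n ∣ A ∣))
∁-∪ (true ∷ E)  (false ∷ A) = ∁-∪ E A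
∁-∪ (false ∷ E) (true ∷ A)  = ≤-trans (s≤s (∁-∪ E A)) (≤-reflexive (sym (+-suc ∣ ∁ (E ∪ A) ∣ ∣ A ∣)))
∁-∪ (false ∷ E) (false ∷ A) = s≤s (∁-∪ E A)

lookup-∪ : ∀ {n} (E A : Subset n) x → lookup E x ≡ false → lookup A x ≡ false → lookup (E ∪ A) x ≡ false
lookup-∪ (_ ∷ E) (_ ∷ A) 0F      e e′ = cong₂ _∨_ e e′
lookup-∪ (_ ∷ E) (_ ∷ A) (sucF x) e e′ = lookup-∪ E A x e e′

avoids-lookup : ∀ {n} (E D : Subset n) x → avoids E D ≡ true → lookup D x ≡ true → lookup E x ≡ false
avoids-lookup (false ∷ E) (true ∷ D) 0F    _ _ = refl
avoids-lookup (true ∷ E)  (true ∷ D) 0F    () _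
avoids-lookup (s ∷ E)     (t ∷ D)    (sucF x) e p = avoids-lookup E D x (proj₂ (∧-true {not (s ∧ t)} e)) p

avoids-remove-right : ∀ {n} (E D : Subset n) x → avoids E D ≡ true → avoids E (D [ x ]≔ false) ≡ true
avoids-remove-right (true ∷ E)  (_ ∷ D) 0F    e = proj₂ (∧-true e)
avoids-remove-right (false ∷ E) (_ ∷ D) 0F    e = e
avoids-remove-right (s ∷ E)     (t ∷ D) (sucF x) e = cong₂ _∧_ (proj₁ (∧-true {not (s ∧ t)} e)) (avoids-remove-right E D x (proj₂ (∧-true {not (s ∧ t)} e)))

lookup-remove : ∀ {n} (D : Subset n) x → lookup (D [ x ]≔ false) x ≡ false
lookup-remove (_ ∷ D) 0F    = refl
lookup-remove (_ ∷ D) (sucF x) = lookup-remove D x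

element : ∀ {n s} (D : Subset n) → ∣ D ∣ ≡ suc s → ∃[ x ] lookup D x ≡ true
element (true ∷ D)  e = 0F , refl
element (false ∷ D) e with element D e
... | x , p = sucF x , p

avoids-empty : ∀ {n} (D B : Subset n) → ∣ D ∣ ≡ 0 → avoids D B ≡ true
avoids-empty []          []      _ = refl
avoids-empty (false ∷ D) (t ∷ B) e = avoids-empty D B e

_⊓_ : ∀ {n} → Fam n → Fam n → Fam n
(f ⊓ g) A = f A ∧ g A

count-avoiding : ∀ {n} k (E : Subset n) → count (size k ⊓ avoids E) ≡ binom ∣ ∁ E ∣ k
count-avoiding zero    []          = refl
count-avoiding (suc k) []          = refl
count-avoiding k       (true ∷ E)  = trans (cong₂ _+_ (count-avoiding k E) (count-none {f = hi (size k ⊓ avoids (true ∷ E))} λ A → ∧-zeroʳ (size k (true ∷ A)))) (+-identityʳ _)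
count-avoiding zero    (false ∷ E) = cong₂ _+_ (count-avoiding zero E) (count-none {f = hi (size 0 ⊓ avoids (false ∷ E))} λ A → refl)
count-avoiding (suc k) (false ∷ E) = trans (cong₂ _+_ (count-avoiding (suc k) E) (count-avoiding k E)) (+-comm (binom ∣ ∁ E ∣ (suc k)) _)

-- A member of `g` that avoids `E` and contains `x` also meets `A`, so among the k-sets avoiding `E`
-- and containing `x` those that avoid `A` are discarded. Sets through `x` are counted as
-- differences, whose negative terms are moved to the other side.
count-through : ∀ {n k} {g : Fam n} (E A : Subset n) x → Uni k g → (∀ B → g ∋ B → Meet A B) →
  count (g ⊓ avoids E) + count (size k ⊓ avoids (E [ x ]≔ true)) + count (size k ⊓ avoids (E ∪ A)) ≤
  count (g ⊓ avoids (E [ x ]≔ true)) + count (size k ⊓ avoids E) + count (size k ⊓ avoids ((E ∪ A) [ x ]≔ true))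
count-through {k = k} {g} E A x u m = subst₂ _≤_
  (sums (g ⊓ avoids E) (size k ⊓ avoids (E [ x ]≔ true)) (size k ⊓ avoids (E ∪ A)))
  (sums (g ⊓ avoids (E [ x ]≔ true)) (size k ⊓ avoids E) (size k ⊓ avoids ((E ∪ A) [ x ]≔ true)))
  (∑-mono pointwise)
  where
  sums : ∀ {n} (f g h : Fam n) → ∑ (λ B → ⟦ f B ⟧ + ⟦ g B ⟧ + ⟦ h B ⟧) ≡ count f + count g + count h
  sums f g h = trans (∑-+ (λ B → ⟦ f B ⟧ + ⟦ g B ⟧) (λ B → ⟦ h B ⟧)) (cong (_+ count h) (∑-+ (λ B → ⟦ f B ⟧) (λ B → ⟦ g B ⟧)))
  bits : ∀ g s e b a → (g ≡ true → s ≡ true) → (g ≡ true → a ≡ false) →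
    ⟦ g ∧ e ⟧ + ⟦ s ∧ (e ∧ not b) ⟧ + ⟦ s ∧ (e ∧ a) ⟧ ≤ ⟦ g ∧ (e ∧ not b) ⟧ + ⟦ s ∧ e ⟧ + ⟦ s ∧ ((e ∧ a) ∧ not b) ⟧
  bits false false _     _     _     _ _ = z≤n
  bits false true  false _     _     _ _ = z≤n
  bits false true  true  true  true  _ _ = ≤-refl
  bits false true  true  true  false _ _ = z≤n
  bits false true  true  false true  _ _ = ≤-refl
  bits false true  true  false false _ _ = ≤-refl
  bits true  false _     _     _     p _ = contradiction (p refl) λ ()
  bits true  true  _     _     true  _ q = contradiction (q refl) λ ()
  bits true  true  false _     false _ _ = z≤n
  bits true  true  true  true  false _ _ = ≤-refl
  bits true  true  true  false false _ _ = ≤-refl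
  pointwise : ∀ B →
    ⟦ (g ⊓ avoids E) B ⟧ + ⟦ (size k ⊓ avoids (E [ x ]≔ true)) B ⟧ + ⟦ (size k ⊓ avoids (E ∪ A)) B ⟧ ≤
    ⟦ (g ⊓ avoids (E [ x ]≔ true)) B ⟧ + ⟦ (size k ⊓ avoids E) B ⟧ + ⟦ (size k ⊓ avoids ((E ∪ A) [ x ]≔ true)) B ⟧
  pointwise B rewrite avoids-insert (E ∪ A) x B | avoids-insert E x B | avoids-∪ E A B =
    bits (g B) (size k B) (avoids E B) (lookup B x) (avoids A B) (λ p → ≡ᵇ-true (u B p)) (λ p → avoids-meet (m B p))

-- The members of g that avoid E are sorted by the first element of D that they contain.
cover : ∀ {n} c q {f g : Fam n} → let k = 2 + c ; H = window c (q + suc c) k in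
  NonStar f → Uni k f → Uni k g → Cross f g → ∀ s (E D : Subset n) → s ≤ k →
  avoids E D ≡ true → ∣ D ∣ ≡ s → ∣ ∁ E ∣ ≡ q + k + s → (∀ B → g ∋ B → avoids E B ≡ true → ¬ avoids D B ≡ true) →
  binom (q + suc c + suc c) c * count (g ⊓ avoids E) ≤ window c (q + suc c) s * H
cover c q {f} {g} ns uf ug cr zero E D _ _ e _ hit = ≤-trans (≤-reflexive (trans (cong (binom (q + suc c + suc c) c *_)
  (count-empty {f = g ⊓ avoids E} λ B p → hit B (proj₁ (∧-true {g B} p)) (proj₂ (∧-true {g B} p)) (avoids-empty D B e))) (*-zeroʳ (binom (q + suc c + suc c) c)))) z≤n
cover {n} c q {f} {g} ns uf ug cr (suc s) E D (s≤s s≤k) disj e e′ hit with element D e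
... | x , x∈D with ns x
...   | A , a , x∉A = begin
  -- The members of `g` through `x` that avoid `E` number at most a window of k terms, because `A`
  -- has k elements and avoids `x`. By log-concavity, d times this window is at most `H` times the
  -- single term `binom (m + s) c` of the window in the claim.
  d * count (g ⊓ avoids E)                                   ≤⟨ *-monoʳ-≤ d step ⟩
  d * (count (g ⊓ avoids E′) + window c (q + s) k)           ≡⟨ *-distribˡ-+ d _ _ ⟩
  d * count (g ⊓ avoids E′) + d * window c (q + s) k         ≤⟨ +-mono-≤ rec (window-bound₂ c q (suc c) k s≤k ≤-refl) ⟩
  window c m s * H + binom (m + s) c * H                     ≡⟨ sym (*-distribʳ-+ H (window c m s) _) ⟩
  window c m (suc s) * H                                     ∎
  where
  open ≤-Reasoning
  k = 2 + c
  m = q + suc c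
  d = binom (m + suc c) c
  H = window c m k
  E′ = E [ x ]≔ true
  D′ = D [ x ]≔ false
  x∉E : lookup E x ≡ false
  x∉E = avoids-lookup E D x disj x∈D
  e″ : ∣ ∁ E′ ∣ ≡ q + k + s
  e″ = suc-injective (trans (sym (∁-insert E x x∉E)) (trans e′ (+-suc (q + k) s)))
  disj′ : avoids E′ D′ ≡ true
  disj′ = trans (avoids-insert E x D′) (cong₂ _∧_ (avoids-remove-right E D x disj) (cong not (lookup-remove D x)))
  hit′ : ∀ B → g ∋ B → avoids E′ B ≡ true → ¬ avoids D′ B ≡ true
  hit′ B p q r with ∧-true {avoids E B} (trans (sym (avoids-insert E x B)) q)
  ... | u , v = hit B p u (trans (avoids-remove D x B x∈D) (cong₂ _∧_ r v))
  rec : d * count (g ⊓ avoids E′) ≤ window c m s * H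
  rec = cover c q ns uf ug cr s E′ D′ (m≤n⇒m≤1+n s≤k) disj′ (suc-injective (trans (sym (size-remove D x x∈D)) e)) e″ hit′
  w = ∣ ∁ ((E ∪ A) [ x ]≔ true) ∣
  w≡ : ∣ ∁ (E ∪ A) ∣ ≡ suc w
  w≡ = ∁-insert (E ∪ A) x (lookup-∪ E A x x∉E x∉A)
  large : q + s ≤ w
  large = +-cancelʳ-≤ k (q + s) w (≤-pred (begin
    suc (q + s + k)          ≡⟨ eq q s k ⟩
    q + k + suc s            ≡⟨ sym e′ ⟩
    ∣ ∁ E ∣                  ≤⟨ ∁-∪ E A ⟩
    ∣ ∁ (E ∪ A) ∣ + ∣ A ∣    ≡⟨ cong₂ _+_ w≡ (uf A a) ⟩
    suc w + k                ∎))
    where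
    eq : ∀ q s k → suc (q + s + k) ≡ q + k + suc s
    eq = solve-∀
  through : count (g ⊓ avoids E) + binom (q + k + s) k + binom (suc w) k ≤
            count (g ⊓ avoids E′) + binom (suc (q + k + s)) k + binom w k
  through = subst₂ _≤_
    (cong₂ (λ y z → count (g ⊓ avoids E) + y + z) (trans (count-avoiding k E′) (cong (λ y → binom y k) e″))
      (trans (count-avoiding k (E ∪ A)) (cong (λ y → binom y k) w≡)))
    (cong₂ (λ y z → count (g ⊓ avoids E′) + y + z) (trans (count-avoiding k E) (cong (λ y → binom y k) (trans e′ (+-suc (q + k) s))))
      (count-avoiding k ((E ∪ A) [ x ]≔ true)))
    (count-through E A x ug (λ B p → cr A B a p))
  hockey : binom (q + k + s) (suc c) ≡ binom (q + s) (suc c) + window c (q + s) k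
  hockey = trans (cong (λ y → binom y (suc c)) (eq q s k)) (hockey-stick c (q + s) k)
    where
    eq : ∀ q s k → q + k + s ≡ q + s + k
    eq = solve-∀
  step : count (g ⊓ avoids E) ≤ count (g ⊓ avoids E′) + window c (q + s) k
  step = lin 0 (+-mono-≤ through (+-mono-≤ (≤-reflexive hockey) (binom-mono (suc c) large)))
    (eq (count (g ⊓ avoids E)) (count (g ⊓ avoids E′)) (binom (q + k + s) k) (binom w k) (binom w (suc c)) (binom (q + k + s) (suc c)) (binom (q + s) (suc c)) (window c (q + s) k))
    where
    eq : ∀ g g′ b u t v r s → g + (g′ + (v + b) + u + (r + s + t)) + 0 ≡ (g′ + s) + (g + b + (t + u) + (v + r))
    eq = solve-∀

product-cover : ∀ {n} c q {f g : Fam n} → n ≡ q + (2 + c) + (2 + c) →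
  NonStar f → Uni (2 + c) f → Uni (2 + c) g → Cross f g → 1 ≤ n →
  binom (q + suc c + suc c) c * count g ≤ window c (q + suc c) (2 + c) * window c (q + suc c) (2 + c)
product-cover {suc n} c q {f} {g} n≡ ns uf ug cr _ with ns 0F
... | A , a , _ = ≤-trans (*-monoʳ-≤ (binom (q + suc c + suc c) c) (count-mono {f = g} {g = g ⊓ avoids ∅} λ B p → cong₂ _∧_ p (avoids-empty ∅ B ∅-size)))
  (cover c q ns uf ug cr (2 + c) ∅ A ≤-refl (avoids-empty ∅ A ∅-size) (uf A a) (trans ∅-∁ n≡)
    λ B p _ r → contradiction (trans (sym r) (avoids-meet (cr A B a p))) λ ())
  where
  empty : ∀ n → Subset n
  empty zero    = []
  empty (suc n) = false ∷ empty n
  empty-size : ∀ n → ∣ empty n ∣ ≡ 0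
  empty-size zero    = refl
  empty-size (suc n) = empty-size n
  ∅ = empty (suc n)
  ∅-size = empty-size (suc n)
  ∅-∁ : ∣ ∁ ∅ ∣ ≡ suc n
  ∅-∁ = trans (sym (+-identityʳ _)) (trans (cong (∣ ∁ ∅ ∣ +_) (sym ∅-size)) (∣∁∣ ∅))

-- Numerical estimates

am-gm : ∀ x y → 2 * (x * y) ≤ x * x + y * y
am-gm x y with ≤-total x y
... | inj₁ p = go x (y ∸ x) (m+[n∸m]≡n p)
  where
  go : ∀ x t {y} → x + t ≡ y → 2 * (x * y) ≤ x * x + y * y
  go x t refl = ≤-trans (m≤m+n (2 * (x * (x + t))) (t * t)) (≤-reflexive (eq x t))
    where
    eq : ∀ x t → 2 * (x * (x + t)) + t * t ≡ x * x + (x + t) * (x + t)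
    eq = solve-∀
... | inj₂ p = go y (x ∸ y) (m+[n∸m]≡n p)
  where
  go : ∀ y t {x} → y + t ≡ x → 2 * (x * y) ≤ x * x + y * y
  go y t refl = ≤-trans (m≤m+n (2 * ((y + t) * y)) (t * t)) (≤-reflexive (eq y t))
    where
    eq : ∀ y t → 2 * ((y + t) * y) + t * t ≡ (y + t) * (y + t) + y * y
    eq = solve-∀

product-of-sum : ∀ {a b h} → a + b ≤ h + h → a * b ≤ h * h
product-of-sum {a} {b} {h} p = *-cancelˡ-≤ 4 (begin
  4 * (a * b)                ≤⟨ lin 0 (am-gm a b) (eq₁ a b) ⟩
  (a + b) * (a + b)          ≤⟨ *-mono-≤ p p ⟩
  (h + h) * (h + h)          ≡⟨ eq₂ h ⟩
  4 * (h * h)                ∎)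
  where
  open ≤-Reasoning
  eq₁ : ∀ a b → 4 * (a * b) + (a * a + b * b) + 0 ≡ (a + b) * (a + b) + 2 * (a * b)
  eq₁ = solve-∀
  eq₂ : ∀ h → (h + h) * (h + h) ≡ 4 * (h * h)
  eq₂ = solve-∀

-- With `b ≤ 3h + d - 3a` and `ad ≤ 3a²/4` the product is at most `3ah - 9a²/4 = h² - (h - 3a/2)²`.
product-far : ∀ {a b d h} → 4 * d ≤ 3 * a → b + 3 * a ≤ 3 * h + d → a * b ≤ h * h
product-far {a} {b} {d} {h} p q = *-cancelˡ-≤ 4 (lin 0
  (+-mono-≤ (+-mono-≤ (*-monoʳ-≤ (4 * a) q) (*-monoʳ-≤ a p)) (am-gm (2 * h) (3 * a))) (eq a b d h))
  where
  eq : ∀ a b d h → 4 * (a * b) + (4 * a * (3 * h + d) + a * (3 * a) + (2 * h * (2 * h) + 3 * a * (3 * a))) + 0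
    ≡ 4 * (h * h) + (4 * a * (b + 3 * a) + a * (4 * d) + 2 * (2 * h * (3 * a)))
  eq = solve-∀

product-near-core : ∀ {b h} e t g → 7 * (3 * e + t) + g ≡ 3 * h → b + 3 * (3 * e + t + e) ≤ 3 * h + (3 * e + t) →
  (3 * e + t + e) * b ≤ h * h
product-near-core {b} {h} e t g 3h≡ q = *-cancelˡ-≤ 9 (lin s
  (*-monoʳ-≤ (9 * a) (subst (λ x → b + 3 * a ≤ x + (3 * e + t)) (sym 3h≡) q))
  (trans (eq e t g b) (cong (_+ 9 * a * (b + 3 * a)) (trans (cong (λ x → x * x) 3h≡) (nine h)))))
  where
  a = 3 * e + t + e
  -- The slack has nonnegative coefficients in `e = a - d`, `t = d - 3e` and `g = 3h - 7d`, which is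
  -- the reason for these variables.
  s = 9 * (e * e) + 6 * (e * t) + 4 * (t * t) + 6 * (e * g) + 5 * (t * g) + g * g
  nine : ∀ h → 3 * h * (3 * h) ≡ 9 * (h * h)
  nine = solve-∀
  eq : ∀ e t g b →
    9 * ((3 * e + t + e) * b) + 9 * (3 * e + t + e) * (7 * (3 * e + t) + g + (3 * e + t)) +
      (9 * (e * e) + 6 * (e * t) + 4 * (t * t) + 6 * (e * g) + 5 * (t * g) + g * g)
    ≡ (7 * (3 * e + t) + g) * (7 * (3 * e + t) + g) + 9 * (3 * e + t + e) * (b + 3 * (3 * e + t + e))
  eq = solve-∀

-- For `h` close to `2d` the quadratic `a(3h + d - 3a)` can exceed `h²`: for `d = 1` take `h = 2.1`
-- and `a = 7/6`. Hence the condition `7d ≤ 3h`; the remaining range is left to `product-near′`,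
-- with a different bound on `b`.
product-near : ∀ {a b d h} → 7 * d ≤ 3 * h → d ≤ a → 3 * a ≤ 4 * d → b + 3 * a ≤ 3 * h + d → a * b ≤ h * h
product-near {a} {b} {d} {h} p d≤a 3a≤4d q = go₁ (m+[n∸m]≡n d≤a) 3a≤4d q
  where
  go₂ : ∀ {d e t g} → 3 * e + t ≡ d → 7 * d + g ≡ 3 * h → b + 3 * (d + e) ≤ 3 * h + d → (d + e) * b ≤ h * h
  go₂ {e = e} {t} {g} refl = product-near-core {b} {h} e t g
  go₁ : ∀ {a e} → d + e ≡ a → 3 * a ≤ 4 * d → b + 3 * a ≤ 3 * h + d → a * b ≤ h * h
  go₁ {e = e} refl r q = go₂ {e = e} (m+[n∸m]≡n {3 * e} {d} (lin 0 r (eq d e))) (m+[n∸m]≡n p) q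
    where
    eq : ∀ d e → 3 * e + 4 * d + 0 ≡ d + 3 * (d + e)
    eq = solve-∀

-- Here `ab ≤ a(2h + d/3 - a) = h² - (h - a)² + ad/3`. From `a ≤ 4d/3` and `h ≥ 2d` follow `ad/3 ≤
-- 4d²/9` and `h - a ≥ 2d/3`, which balance exactly; hence the cut at `4d/3`.
product-near′ : ∀ {a b d h M} → 2 * d ≤ h → 3 * M ≤ 3 * h + d → 3 * a ≤ 4 * d → a + b ≤ h + M → a * b ≤ h * h
product-near′ {a} {b} {d} {h} {M} 2d≤h 3M≤ 3a≤4d p = go (m+[n∸m]≡n a≤h) 2d≤h 3M≤ p
  where
  a≤h : a ≤ h
  a≤h = *-cancelˡ-≤ 3 (≤-trans 3a≤4d (lin (2 * d) (*-monoʳ-≤ 3 2d≤h) (eq d h)))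
    where
    eq : ∀ d h → 4 * d + 3 * h + 2 * d ≡ 3 * h + 3 * (2 * d)
    eq = solve-∀
  go : ∀ {t h} → a + t ≡ h → 2 * d ≤ h → 3 * M ≤ 3 * h + d → a + b ≤ h + M → a * b ≤ h * h
  go {t} refl 2d≤h 3M≤ p = *-cancelˡ-≤ 9 (lin 0
    (+-mono-≤ (+-mono-≤ (*-monoʳ-≤ (9 * a) p) (*-monoʳ-≤ (3 * a) 3M≤)) (+-mono-≤ (*-monoʳ-≤ d 3a≤4d) (*-mono-≤ 2d≤3t 2d≤3t)))
    (eq a b d t M))
    where
    2d≤3t : 2 * d ≤ 3 * t
    2d≤3t = lin 0 (+-mono-≤ (*-monoʳ-≤ 3 2d≤h) 3a≤4d) (eq′ a d t)
      where
      eq′ : ∀ a d t → 2 * d + (3 * (a + t) + 4 * d) + 0 ≡ 3 * t + (3 * (2 * d) + 3 * a)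
      eq′ = solve-∀
    eq : ∀ a b d t M → 9 * (a * b) + (9 * a * (a + t + M) + 3 * a * (3 * (a + t) + d) + (d * (4 * d) + 3 * t * (3 * t))) + 0
      ≡ 9 * ((a + t) * (a + t)) + (9 * a * (a + b) + 3 * a * (3 * M) + (d * (3 * a) + 2 * d * (2 * d)))
    eq = solve-∀

product-bound : ∀ {a b d h M} → 2 * d ≤ h → 7 * d ≤ 3 * h ⊎ 3 * M ≤ 3 * h + d → d ≤ a →
  b + 3 * a ≤ 3 * h + d → a + b ≤ h + M → a * b ≤ h * h
product-bound {a} {b} {d} {h} {M} p q d≤a r s with 4 * d ≤? 3 * a
... | yes u = product-far {a} {b} {d = d} {h} u r
... | no ¬u with q
...   | inj₁ v = product-near {a} {b} {d = d} {h} v d≤a (<⇒≤ (≰⇒> ¬u)) r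
...   | inj₂ v = product-near′ {a} {b} {d = d} {h} {M} p v (<⇒≤ (≰⇒> ¬u)) s

binom-step : ∀ y c → y ∸ c ≤ 2 * suc c → binom y (suc c) ≤ 2 * binom y c
binom-step y c p = *-cancelʳ-≤ _ _ (suc c) (begin
  binom y (suc c) * suc c        ≡⟨ binom-absorb y c ⟩
  binom y c * (y ∸ c)            ≤⟨ *-monoʳ-≤ (binom y c) p ⟩
  binom y c * (2 * suc c)        ≡⟨ eq (binom y c) (suc c) ⟩
  2 * binom y c * suc c          ∎)
  where
  open ≤-Reasoning
  eq : ∀ b k → b * (2 * k) ≡ 2 * b * k
  eq = solve-∀

binom-growth : ∀ y c → y ≤ 2 + 3 * c → 3 * binom y (suc c) ≤ 2 * binom (suc y) (suc c)
binom-growth y c p = lin 0 (binom-step y c (≤-trans (∸-monoˡ-≤ c p) (≤-reflexive (trans (cong (_∸ c) (eq c)) (m+n∸m≡n c (2 * suc c)))))) (eq′ (binom y (suc c)) (binom y c))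
  where
  eq : ∀ c → 2 + 3 * c ≡ c + 2 * suc c
  eq = solve-∀
  eq′ : ∀ b a → 3 * b + 2 * a + 0 ≡ 2 * (a + b) + b
  eq′ = solve-∀


binom-decay : ∀ i j y c → i * suc c ≤ j * (y ∸ c) → (i + j) * binom y (suc c) ≥ i * binom (suc y) (suc c)
binom-decay i j y c p = *-cancelʳ-≤ _ _ (suc c) (begin
  i * (a + b) * suc c                   ≡⟨ eq₁ i a b (suc c) ⟩
  i * (b * suc c) + a * (i * suc c)     ≤⟨ +-monoʳ-≤ (i * (b * suc c)) (*-monoʳ-≤ a p) ⟩
  i * (b * suc c) + a * (j * (y ∸ c))   ≡⟨ cong (i * (b * suc c) +_) (trans (eq₂ a j (y ∸ c)) (cong (j *_) (sym (binom-absorb y c)))) ⟩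
  i * (b * suc c) + j * (b * suc c)     ≡⟨ eq₃ i j b (suc c) ⟩
  (i + j) * b * suc c                   ∎)
  where
  open ≤-Reasoning
  a = binom y c
  b = binom y (suc c)
  eq₁ : ∀ i a b c → i * (a + b) * c ≡ i * (b * c) + a * (i * c)
  eq₁ = solve-∀
  eq₂ : ∀ a j x → a * (j * x) ≡ j * (a * x)
  eq₂ = solve-∀
  eq₃ : ∀ i j b c → i * (b * c) + j * (b * c) ≡ (i + j) * b * c
  eq₃ = solve-∀

∸-bound : ∀ {x y c} → x + c ≤ y → x ≤ y ∸ c
∸-bound {x} {y} {c} p = ≤-trans (≤-reflexive (sym (m+n∸n≡m x c))) (∸-monoˡ-≤ c p)

central : ∀ e → suc (binom (suc e + suc e) e) ≤ binom (suc e + suc e) (suc e)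
central e = *-cancelʳ-< (suc e) _ _ (begin-strict
  a * suc e            <⟨ *-monoʳ-< a {{>-nonZero (binom-pos (≤-trans (n≤1+n e) (m≤m+n (suc e) (suc e))))}} (n<1+n (suc e)) ⟩
  a * suc (suc e)      ≡⟨ cong (a *_) (sym (trans (cong (_∸ e) (eq e)) (m+n∸m≡n e (suc (suc e))))) ⟩
  a * (suc e + suc e ∸ e)  ≡⟨ sym (binom-absorb (suc e + suc e) e) ⟩
  binom (suc e + suc e) (suc e) * suc e  ∎)
  where
  open ≤-Reasoning
  a = binom (suc e + suc e) e
  eq : ∀ e → suc e + suc e ≡ e + suc (suc e)
  eq = solve-∀

-- The case q = 0 is the central binomial coefficient; the ratio only improves with q, by log-concavity.
two-top : ∀ c q → 2 * binom (q + suc c + suc c) c ≤ window c (q + suc c) (2 + c)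
two-top c q = ≤-trans (≤-reflexive (cong (d +_) (+-identityʳ d))) (+-monoˡ-≤ d d≤w)
  where
  m = q + suc c
  d = binom (m + suc c) c
  w = window c m (suc c)
  d₀ = binom (suc c + suc c) c
  w₀ = window c (suc c) (suc c)
  d₀≤w₀ : d₀ ≤ w₀
  d₀≤w₀ = +-cancelˡ-≤ 1 _ _ (≤-trans (central c) (≤-reflexive (trans (hockey-stick c (suc c) (suc c)) (cong (_+ w₀) (binom-diag (suc c))))))
  eq : ∀ c q → suc c + (suc c + q) ≡ q + suc c + suc c
  eq = solve-∀
  compare : d * w₀ ≤ d₀ * w
  compare = subst₂ (λ x y → binom x c * w₀ ≤ d₀ * window c y (suc c)) (eq c q) (+-comm (suc c) q)
              (window-bound₁ c (suc c) (suc c) q (suc c) (n≤1+n (suc c)))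
  d≤w : d ≤ w
  d≤w = *-cancelˡ-≤ d₀ {{>-nonZero (binom-pos (≤-trans (n≤1+n c) (m≤m+n (suc c) (suc c))))}}
    (≤-trans (≤-reflexive (*-comm d₀ d)) (≤-trans (*-monoʳ-≤ d d₀≤w₀) compare))

-- The four largest terms of the window are at least 1, 2/3, 4/9 and 4/15 times the top one, and
-- their sum 107/45 exceeds 7/3. The hypothesis on `q` is exactly what the second ratio requires.
many-top : ∀ c q → suc c ≤ q → let m = q + (3 + c) in
  7 * binom (m + (3 + c)) (2 + c) ≤ 3 * window (2 + c) m (4 + c)
many-top c q c<q = *-cancelˡ-≤ 15 (lin (2 * f₀ + 45 * window (2 + c) m c)
  (+-mono-≤ (+-mono-≤ (*-monoʳ-≤ 31 r₁) (*-monoʳ-≤ 24 r₂)) (*-monoʳ-≤ 9 r₃)) (eq f₀ f₁ f₂ f₃ (window (2 + c) m c)))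
  where
  m = q + (3 + c)
  f : ℕ → ℕ
  f i = binom (m + i) (2 + c)
  f₀ = f (3 + c)
  f₁ = f (2 + c)
  f₂ = f (1 + c)
  f₃ = f c
  ratio : ∀ i j l → i * (2 + c) + j * suc c ≤ j * (m + l) → i * f (suc l) ≤ (i + j) * f l
  ratio i j l p = subst (λ x → i * binom x (2 + c) ≤ (i + j) * f l) (sym (+-suc m l))
    (binom-decay i j (m + l) (suc c) (≤-trans (∸-bound p) (≤-reflexive (sym (*-distribˡ-∸ j (m + l) (suc c))))))
  r₁ : 2 * f₀ ≤ 3 * f₁
  r₁ = ratio 2 1 (2 + c) (lin 1 c<q (e c q))
    where
    e : ∀ c q → 2 * (2 + c) + 1 * suc c + q + 1 ≡ 1 * (q + (3 + c) + (2 + c)) + suc c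
    e = solve-∀
  r₂ : 2 * f₁ ≤ 3 * f₂
  r₂ = ratio 2 1 (1 + c) (lin 0 c<q (e c q))
    where
    e : ∀ c q → 2 * (2 + c) + 1 * suc c + q + 0 ≡ 1 * (q + (3 + c) + (1 + c)) + suc c
    e = solve-∀
  r₃ : 3 * f₂ ≤ 5 * f₃
  r₃ = ratio 3 2 c (lin c (*-monoʳ-≤ 2 c<q) (e c q))
    where
    e : ∀ c q → 3 * (2 + c) + 2 * suc c + 2 * q + c ≡ 2 * (q + (3 + c) + c) + 2 * suc c
    e = solve-∀
  eq : ∀ a b c d w → 15 * (7 * a) + (31 * (3 * b) + 24 * (3 * c) + 9 * (5 * d)) + (2 * a + 45 * w)
    ≡ 15 * (3 * (w + d + c + b + a)) + (31 * (2 * a) + 24 * (2 * b) + 9 * (3 * c))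
  eq = solve-∀

-- Lowering the upper index six times, from m + c + 6 to m + c, costs at least a factor 2/3 each time.
few-missing : ∀ c q → q ≤ 2 + c → let m = q + (5 + c) in 3 * binom m (5 + c) ≤ binom (m + (5 + c)) (4 + c)
few-missing c q q≤ = *-cancelˡ-≤ 243 (lin (51 * d)
  (+-mono-≤ (*-monoʳ-≤ 729 (binom-mono (5 + c) (m≤m+n m c))) (+-mono-≤ chain (*-monoʳ-≤ 64 (binom-step (m + (5 + c)) (4 + c) top))))
  (eq (binom m (5 + c)) (binom (m + c) (5 + c)) (binom (m + (5 + c)) (5 + c)) d))
  where
  m = q + (5 + c)
  d = binom (m + (5 + c)) (4 + c)
  b : ℕ → ℕ
  b i = binom (m + i) (5 + c)
  eq : ∀ x y z d → 243 * (3 * x) + (729 * y + (64 * (d + z) + 64 * (2 * d))) + 51 * d ≡ 243 * d + (729 * x + (729 * y + 64 * z))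
  eq = solve-∀
  top : m + (5 + c) ∸ (4 + c) ≤ 2 * (5 + c)
  top = m≤n+o⇒m∸n≤o (m + (5 + c)) (4 + c) (lin 2 q≤ (e c q))
    where
    e : ∀ c q → q + (5 + c) + (5 + c) + (2 + c) + 2 ≡ 4 + c + 2 * (5 + c) + q
    e = solve-∀
  step : ∀ i → i ≤ 5 → 3 * b (i + c) ≤ 2 * b (suc i + c)
  step i i≤5 = subst (λ x → 3 * b (i + c) ≤ 2 * binom x (5 + c)) (sym (+-suc m (i + c)))
    (binom-growth (m + (i + c)) (4 + c) (lin 2 (+-mono-≤ q≤ i≤5) (e c q i)))
    where
    e : ∀ c q i → q + (5 + c) + (i + c) + (2 + c + 5) + 2 ≡ 2 + 3 * (4 + c) + (q + i)
    e = solve-∀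
  scale : ∀ k i → i ≤ 5 → 3 * k * b (i + c) ≤ 2 * k * b (suc i + c)
  scale k i p = subst₂ _≤_ (e k 3 (b (i + c))) (e k 2 (b (suc i + c))) (*-monoʳ-≤ k (step i p))
    where
    e : ∀ k i x → k * (i * x) ≡ i * k * x
    e = solve-∀
  chain : 729 * b c ≤ 64 * (d + b (5 + c))
  chain = begin
    729 * b c             ≤⟨ scale 243 0 z≤n ⟩
    486 * b (1 + c)       ≤⟨ scale 162 1 (s≤s z≤n) ⟩
    324 * b (2 + c)       ≤⟨ scale 108 2 (s≤s (s≤s z≤n)) ⟩
    216 * b (3 + c)       ≤⟨ scale 72 3 (s≤s (s≤s (s≤s z≤n))) ⟩
    144 * b (4 + c)       ≤⟨ scale 48 4 (s≤s (s≤s (s≤s (s≤s z≤n)))) ⟩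
    96 * b (5 + c)        ≤⟨ scale 32 5 ≤-refl ⟩
    64 * b (6 + c)        ≡⟨ cong (λ x → 64 * binom x (5 + c)) (+-suc m (5 + c)) ⟩
    64 * (d + b (5 + c))  ∎
    where open ≤-Reasoning

-- With q = n - 2k and k = c + 2, either h ≥ 7d/3 or C(n-1,k-1) - h ≤ d/3.
regimes : ∀ c q → 1 ≤ c → let m = q + suc c ; d = binom (m + suc c) c in
  7 * d ≤ 3 * suc (window c m (2 + c)) ⊎ 3 * binom m (suc c) ≤ d
-- For `k = 3` the window consists of three consecutive integers, and the first alternative holds
-- for every `q`.
regimes 1 q _ = inj₁ (≤-trans (≤-reflexive lhs) (≤-trans (m≤m+n (7 * (q + 4)) (2 * q + 2)) (≤-reflexive (trans (eq q) rhs))))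
  where
  eq : ∀ q → 7 * (q + 4) + (2 * q + 2) ≡ 3 * suc (q + 2 + 0 + (q + 2 + 1) + (q + 2 + 2))
  eq = solve-∀
  e′ : ∀ q → q + 2 + 2 ≡ q + 4
  e′ = solve-∀
  lhs : 7 * binom (q + 2 + 2) 1 ≡ 7 * (q + 4)
  lhs = cong (7 *_) (trans (binom-one (q + 2 + 2)) (e′ q))
  rhs : 3 * suc (q + 2 + 0 + (q + 2 + 1) + (q + 2 + 2)) ≡ 3 * suc (window 1 (q + 2) 3)
  rhs = cong (λ x → 3 * suc x) (sym (cong₂ _+_ (cong₂ _+_ (binom-one (q + 2 + 0)) (binom-one (q + 2 + 1))) (binom-one (q + 2 + 2))))
regimes (suc (suc c)) q _ with suc c ≤? q
... | yes p = inj₁ (≤-trans (many-top c q p) (*-monoʳ-≤ 3 (n≤1+n _)))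
-- `few-missing` covers `c ≥ 4`; the smaller values leave only the pairs (2,0), (3,0) and (3,1) for
-- (c,q), which are computed.
regimes 2 zero          _ | no _  = inj₂ (from-yes (3 * binom 3 3 ≤? binom 6 2))
regimes 2 (suc q)       _ | no ¬p = contradiction (s≤s z≤n) ¬p
regimes 3 zero          _ | no _  = inj₂ (from-yes (3 * binom 4 4 ≤? binom 8 3))
regimes 3 1             _ | no _  = inj₂ (from-yes (3 * binom 5 4 ≤? binom 9 3))
regimes 3 (suc (suc q)) _ | no ¬p = contradiction (s≤s (s≤s z≤n)) ¬p
regimes (suc (suc (suc (suc c)))) q _ | no ¬p = inj₂ (few-missing c q (≤-pred (≰⇒> ¬p)))

-- Families that a shift turns into a star

_⊔_ : ∀ {n} → Fam n → Fam n → Fam n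
(f ⊔ g) A = f A ∨ g A

uni-⊔ : ∀ {n k} {f g : Fam n} → Uni k f → Uni k g → Uni k (f ⊔ g)
uni-⊔ {f = f} u v A m with ∨-true {f A} m
... | inj₁ p = u A p
... | inj₂ p = v A p

cross-⊔ : ∀ {n} {f f′ g : Fam n} → Cross f g → Cross f′ g → Cross (f ⊔ f′) g
cross-⊔ {f = f} c c′ A B a b with ∨-true {f A} a
... | inj₁ p = c A B p b
... | inj₂ p = c′ A B p b

uni-⊓ : ∀ {n k} {f g : Fam n} → Uni k f → Uni k (f ⊓ g)
uni-⊓ {f = f} u A m = u A (proj₁ (∧-true {f A} m))

cross-⊓ˡ : ∀ {n} {f g g′ : Fam n} → Cross f g → Cross f (g ⊓ g′)
cross-⊓ˡ {g = g} c A B a b = c A B a (proj₁ (∧-true {g B} b))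

cross-⊓ʳ : ∀ {n} {f g g′ : Fam n} → Cross f g′ → Cross f (g ⊓ g′)
cross-⊓ʳ {g = g} c A B a b = c A B a (proj₂ (∧-true {g B} b))

uni-join : ∀ {n k} {f g : Fam n} → Uni (suc k) f → Uni k g → Uni (suc k) (join f g)
uni-join u v (false ∷ A) m = u A m
uni-join u v (true ∷ A)  m = cong suc (v A m)

cross-join : ∀ {n} {f f′ g g′ : Fam n} → Cross f g → Cross f g′ → Cross f′ g → Cross (join f f′) (join g g′)
cross-join c₁ c₂ c₃ (false ∷ A) (false ∷ B) a b = there (c₁ A B a b)
cross-join c₁ c₂ c₃ (false ∷ A) (true ∷ B)  a b = there (c₂ A B a b)
cross-join c₁ c₂ c₃ (true ∷ A)  (false ∷ B) a b = there (c₃ A B a b)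
cross-join c₁ c₂ c₃ (true ∷ A)  (true ∷ B)  a b = here

uni-quad : ∀ {n k} (p : Pos n) s t {f : Fam (2 + n)} → Uni ((⟦ s ⟧ + ⟦ t ⟧) + k) f → Uni k (quad p s t f)
uni-quad p s t u A m = +-cancelˡ-≡ (⟦ s ⟧ + ⟦ t ⟧) _ _ (trans (sym (size-insert p s t A)) (u _ m))

missing-first : ∀ {n} (p : Pos n) {f : Fam (2 + n)} → NonStar f → 1 ≤ count (quad p false false f) + count (quad p false true f)
missing-first p {f} ns with ns (firstIx p)
... | A , a , e with splitAt p A
...   | split true  t     B = contradiction (trans (sym e) (lookup-first p true t B)) λ ()
...   | split false false B = ≤-trans (count-pos {f = quad p false false f} B a) (m≤m+n _ _)
...   | split false true  B = ≤-trans (count-pos {f = quad p false true f} B a) (m≤n+m _ _)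

missing-second : ∀ {n} (p : Pos n) {f : Fam (2 + n)} → NonStar f → 1 ≤ count (quad p false false f) + count (quad p true false f)
missing-second p {f} ns with ns (secondIx p)
... | A , a , e with splitAt p A
...   | split s     true  B = contradiction (trans (sym e) (lookup-second p s true B)) λ ()
...   | split false false B = ≤-trans (count-pos {f = quad p false false f} B a) (m≤m+n _ _)
...   | split true  false B = ≤-trans (count-pos {f = quad p true false f} B a) (m≤n+m _ _)

count≤binom : ∀ {n k} {f : Fam n} → Uni k f → count f ≤ binom n k
count≤binom {n} {k} {f} u = ≤-trans (count-mono {f = f} {g = size k} (λ A m → ≡ᵇ-true (u A m))) (≤-reflexive (count-size n k))

-- Call 1 and 2 the two entries at p; every member of f contains exactly one of 1, 2 or both, and no set
-- A avoiding 1 and 2 has both A ∪ {1} and A ∪ {2} in f.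
module _ {c q : ℕ} (p : Pos (q + suc c + suc c)) {f g : Fam (2 + (q + suc c + suc c))} (1≤c : 1 ≤ c)
         (nf : NonStar f) (ng : NonStar g) (uf : Uni (2 + c) f) (ug : Uni (2 + c) g) (cr : Cross f g) (co : Collapse p f) where

  private
    m = q + suc c
    N = m + suc c
    d = binom N c
    G = binom m (suc c)
    M = binom (suc N) (suc c)
    H = window c m (2 + c)
    hₖ = suc H

    sucN : suc N ≡ m + (2 + c)
    sucN = sym (+-suc m (suc c))

    c<m : suc c ≤ m
    c<m = m≤n+m (suc c) q

    M≡ : M ≡ G + H
    M≡ = trans (cong (λ x → binom x (suc c)) sucN) (hockey-stick c m (2 + c))

    below-h : ∀ {x} → x + G ≤ M + 1 → x ≤ hₖ
    below-h {x} r = +-cancelʳ-≤ G x hₖ (≤-trans r (≤-reflexive (trans (cong (_+ 1) M≡) (eq G H))))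
      where
      eq : ∀ G H → G + H + 1 ≡ suc H + G
      eq = solve-∀

    balanced : ∀ {P Q : Fam N} → Uni (suc c) P → Uni (suc c) Q → Cross P Q → 1 ≤ count P → 1 ≤ count Q →
      count P + count Q + d ≤ hₖ
    balanced u v r s t = below-h (balanced-bound m c sucN 1≤c c<m u v r s t)

    unbalanced : ∀ {P Q : Fam (suc N)} → Uni (suc c) P → Uni (2 + c) Q → Cross P Q → 1 ≤ count Q → d < count P →
      count P + count Q ≤ hₖ
    unbalanced u v r s t = below-h (pair-bound′ m c sucN 1≤c c<m u v r s t)

    X Y A₁₁ B₀₀ B₀₁ B₁₀ B₁₁ : Fam N
    X   = quad p true false f
    Y   = quad p false true f
    A₁₁ = quad p true true f
    B₀₀ = quad p false false g
    B₀₁ = quad p false true g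
    B₁₀ = quad p true false g
    B₁₁ = quad p true true g

    x   = count X
    y   = count Y
    a₁₁ = count A₁₁
    b₀₀ = count B₀₀
    b₀₁ = count B₀₁
    b₁₀ = count B₁₀
    b₁₁ = count B₁₁
    i   = count (B₀₁ ⊓ B₁₀)
    u   = count (B₁₀ ⊔ B₀₁)

    a₀₀≡0 : count (quad p false false f) ≡ 0
    a₀₀≡0 = count-empty {f = quad p false false f} (proj₁ co)

    a≡ : count f ≡ a₁₁ + x + y
    a≡ = trans (count-quad p f) (trans (cong (λ z → (z + y) + (x + a₁₁)) a₀₀≡0) (eq a₁₁ x y))
      where
      eq : ∀ a x y → (0 + y) + (x + a) ≡ a + x + y
      eq = solve-∀

    b≡ : count g ≡ b₀₀ + b₀₁ + b₁₀ + b₁₁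
    b≡ = trans (count-quad p g) (eq b₀₀ b₀₁ b₁₀ b₁₁)
      where
      eq : ∀ a b c d → (a + b) + (c + d) ≡ a + b + c + d
      eq = solve-∀

    u+i : i + u ≡ b₁₀ + b₀₁
    u+i = count-∧∨ B₁₀ B₀₁

    x+y : count (X ⊔ Y) ≡ x + y
    x+y = trans (cong (_+ count (X ⊔ Y)) (sym none)) (count-∧∨ X Y)
      where
      none : count (Y ⊓ X) ≡ 0
      none = count-empty {f = Y ⊓ X} λ A e → proj₂ co A (proj₂ (∧-true {Y A} e)) (proj₁ (∧-true {Y A} e))

    1≤x : 1 ≤ x
    1≤x = subst (λ z → 1 ≤ z + x) a₀₀≡0 (missing-second p nf)

    1≤y : 1 ≤ y
    1≤y = subst (λ z → 1 ≤ z + y) a₀₀≡0 (missing-first p nf)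

    cX₀₁ : Cross X B₀₁
    cX₀₁ = quad-cross p true false false true refl cr
    cX₀₀ : Cross X B₀₀
    cX₀₀ = quad-cross p true false false false refl cr
    cY₁₀ : Cross Y B₁₀
    cY₁₀ = quad-cross p false true true false refl cr
    cY₀₀ : Cross Y B₀₀
    cY₀₀ = quad-cross p false true false false refl cr
    cA₀₀ : Cross A₁₁ B₀₀
    cA₀₀ = quad-cross p true true false false refl cr

    a₁₁≤d : a₁₁ ≤ d
    a₁₁≤d = count≤binom (uni-quad p true true uf)
    b₁₁≤d : b₁₁ ≤ d
    b₁₁≤d = count≤binom (uni-quad p true true ug)

    2d≤h : 2 * d ≤ hₖ
    2d≤h = m≤n⇒m≤1+n (two-top c q)

    d<h : suc d ≤ hₖ
    d<h = s≤s (≤-trans (m≤m+n d (d + 0)) (two-top c q))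

    balancedX : 1 ≤ b₀₁ → x + b₀₁ + d ≤ hₖ
    balancedX r = balanced (uni-quad p true false uf) (uni-quad p false true ug) cX₀₁ 1≤x r
    balancedY : 1 ≤ b₁₀ → y + b₁₀ + d ≤ hₖ
    balancedY r = balanced (uni-quad p false true uf) (uni-quad p true false ug) cY₁₀ 1≤y r

    zero-or-pos : ∀ z → z ≡ 0 ⊎ 1 ≤ z
    zero-or-pos zero    = inj₁ refl
    zero-or-pos (suc z) = inj₂ (s≤s z≤n)

    from-sum : a₁₁ + x + y + (b₀₀ + b₀₁ + b₁₀ + b₁₁) ≤ hₖ + hₖ → count f * count g ≤ hₖ * hₖ
    from-sum r = product-of-sum {count f} {count g} {hₖ} (subst₂ (λ z w → z + w ≤ hₖ + hₖ) (sym a≡) (sym b≡) r)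

    small : count f ≤ d → count f * count g ≤ hₖ * hₖ
    small r = ≤-trans (*-monoˡ-≤ (count g) r) (≤-trans (product-cover c q (eq q c) nf uf ug cr (s≤s z≤n)) (*-mono-≤ (n≤1+n H) (n≤1+n H)))
      where
      eq : ∀ q c → 2 + (q + suc c + suc c) ≡ q + (2 + c) + (2 + c)
      eq = solve-∀

    -- Now `g` is covered by {1,2} as well, and both its mixed parts are nonempty since `g` is not a
    -- star. Each of the two balanced bounds has d to spare, which absorbs the sets containing 1 and
    -- 2.
    covered : b₀₀ ≡ 0 → count f * count g ≤ hₖ * hₖ
    covered e = from-sum (lin 0 (+-mono-≤ (+-mono-≤ (balancedX 1≤b₀₁) (balancedY 1≤b₁₀)) (+-mono-≤ a₁₁≤d b₁₁≤d))
      (trans (cong (λ z → a₁₁ + x + y + (z + b₀₁ + b₁₀ + b₁₁) + (hₖ + hₖ + (d + d)) + 0) e) (eq a₁₁ x y b₀₁ b₁₀ b₁₁ hₖ d)))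
      where
      1≤b₀₁ : 1 ≤ b₀₁
      1≤b₀₁ = subst (λ z → 1 ≤ z + b₀₁) e (missing-first p ng)
      1≤b₁₀ : 1 ≤ b₁₀
      1≤b₁₀ = subst (λ z → 1 ≤ z + b₁₀) e (missing-second p ng)
      eq : ∀ a x y b c e hₖ d → a + x + y + (0 + b + c + e) + (hₖ + hₖ + (d + d)) + 0 ≡ hₖ + hₖ + ((x + b + d) + (y + c + d) + (a + e))
      eq = solve-∀

    -- The first family is the link of the centre of the star into which the shift turns `f`; the
    -- second consists of the members of the shifted `g` that avoid the centre. The collapse makes
    -- `X` and `Y` disjoint, so the link has as many members as `f`.
    shifted-sum : d < a₁₁ + x + y → 1 ≤ b₀₀ + i → a₁₁ + x + y + (b₀₀ + i) ≤ hₖ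
    shifted-sum r s = subst (λ z → z + (b₀₀ + i) ≤ hₖ) e
      (unbalanced {join (X ⊔ Y) A₁₁} {join B₀₀ (B₀₁ ⊓ B₁₀)}
        (uni-join (uni-⊔ {f = X} {Y} (uni-quad p true false uf) (uni-quad p false true uf)) (uni-quad p true true uf))
        (uni-join (uni-quad p false false ug) (uni-⊓ {f = B₀₁} (uni-quad p false true ug)))
        (cross-join (cross-⊔ {f = X} {Y} cX₀₀ cY₀₀)
          (cross-⊔ {f = X} {Y} (cross-⊓ˡ {g = B₀₁} {B₁₀} cX₀₁) (cross-⊓ʳ {g = B₀₁} {B₁₀} cY₁₀)) cA₀₀)
        s (subst (d <_) (sym e) r))
      where
      e : count (X ⊔ Y) + a₁₁ ≡ a₁₁ + x + y
      e = trans (cong (_+ a₁₁) x+y) (eq a₁₁ x y)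
        where
        eq : ∀ a x y → x + y + a ≡ a + x + y
        eq = solve-∀

    one-side : ∀ {s t} → a₁₁ + x + y + (b₀₀ + i) ≤ hₖ → s ≡ 0 → t + d ≤ hₖ →
      a₁₁ + x + y + (b₀₀ + s + t + b₁₁) ≤ hₖ + hₖ
    one-side {t = t} r refl w = lin i (+-mono-≤ (+-mono-≤ r w) b₁₁≤d) (eq (a₁₁ + x + y) b₀₀ i t b₁₁ hₖ d)
      where
      eq : ∀ a b i t e hₖ d → a + (b + 0 + t + e) + (hₖ + hₖ + d) + i ≡ hₖ + hₖ + ((a + (b + i)) + (t + d) + e)
      eq = solve-∀

    near-h : ∀ {z t} → (1 ≤ t → z + t + d ≤ hₖ) → t + d ≤ hₖ
    near-h {z} {zero}  r = <⇒≤ d<h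
    near-h {z} {suc t} r = ≤-trans (+-monoˡ-≤ d (m≤n+m (suc t) z)) (r (s≤s z≤n))

    -- Without any shift, `unbalanced` is applied to the link in `f` of the first point of `p` and
    -- to the members of `g` that avoid this point.
    large-first : d < x + a₁₁ → y + b₁₀ + d ≤ hₖ → a₁₁ + x + y + (b₀₀ + b₀₁ + b₁₀ + b₁₁) ≤ hₖ + hₖ
    large-first r s = lin 0 (+-mono-≤ (+-mono-≤ sum s) b₁₁≤d) (eq a₁₁ x y b₀₀ b₀₁ b₁₀ b₁₁ hₖ d)
      where
      sum : x + a₁₁ + (b₀₀ + b₀₁) ≤ hₖ
      sum = unbalanced {join X A₁₁} {join B₀₀ B₀₁}
        (uni-join (uni-quad p true false uf) (uni-quad p true true uf)) (uni-join (uni-quad p false false ug) (uni-quad p false true ug))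
        (cross-join cX₀₀ cX₀₁ cA₀₀) (missing-first p ng) r
      eq : ∀ a x y b c e k hₖ d → a + x + y + (b + c + e + k) + (hₖ + hₖ + d) + 0 ≡ hₖ + hₖ + ((x + a + (b + c)) + (y + e + d) + k)
      eq = solve-∀

    large-second : d < y + a₁₁ → x + b₀₁ + d ≤ hₖ → a₁₁ + x + y + (b₀₀ + b₀₁ + b₁₀ + b₁₁) ≤ hₖ + hₖ
    large-second r s = lin 0 (+-mono-≤ (+-mono-≤ sum s) b₁₁≤d) (eq a₁₁ x y b₀₀ b₀₁ b₁₀ b₁₁ hₖ d)
      where
      sum : y + a₁₁ + (b₀₀ + b₁₀) ≤ hₖ
      sum = unbalanced {join Y A₁₁} {join B₀₀ B₁₀}
        (uni-join (uni-quad p false true uf) (uni-quad p true true uf)) (uni-join (uni-quad p false false ug) (uni-quad p true false ug))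
        (cross-join cY₀₀ cY₁₀ cA₀₀) (missing-second p ng) r
      eq : ∀ a x y b c e k hₖ d → a + x + y + (b + c + e + k) + (hₖ + hₖ + d) + 0 ≡ hₖ + hₖ + ((y + a + (b + e)) + (x + c + d) + k)
      eq = solve-∀

    regime : 7 * d ≤ 3 * hₖ ⊎ 3 * M ≤ 3 * hₖ + d
    regime with regimes c q 1≤c
    ... | inj₁ r = inj₁ r
    ... | inj₂ r = inj₂ (subst (λ z → 3 * z ≤ 3 * hₖ + d) (sym M≡) (lin 3 r (eq G H d)))
      where
      eq : ∀ G H d → 3 * (G + H) + d + 3 ≡ 3 * suc H + d + 3 * G
      eq = solve-∀

    -- Both links are small now. Adding their bounds to the three bounds by `hₖ` and to `b₁₁ ≤ d`
    -- gives `b + 3a ≤ 3h + d` for the sizes a, b of `f`, `g`; and `b₀₁ + b₁₀ = i + u` with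
    -- `u ≤ C(N,c+1)` gives `a + b ≤ h + M`. The rest is `product-bound`.
    generic : d < a₁₁ + x + y → a₁₁ + x + y + (b₀₀ + i) ≤ hₖ → x + b₀₁ + d ≤ hₖ → y + b₁₀ + d ≤ hₖ →
      x + a₁₁ ≤ d → y + a₁₁ ≤ d → count f * count g ≤ hₖ * hₖ
    generic r s t v w z = subst₂ (λ α β → α * β ≤ hₖ * hₖ) (sym a≡) (sym b≡)
      (product-bound {d = d} {hₖ} {M} 2d≤h regime (<⇒≤ r)
        (lin i (+-mono-≤ (+-mono-≤ (+-mono-≤ s t) (+-mono-≤ v b₁₁≤d)) (+-mono-≤ w z)) (eq₁ a₁₁ x y b₀₀ b₀₁ b₁₀ b₁₁ i hₖ d))
        (lin 0 (+-mono-≤ (+-mono-≤ s b₁₁≤d) (+-mono-≤ u≤ (≤-reflexive (sym u+i)))) (eq₂ (a₁₁ + x + y) b₀₀ b₀₁ b₁₀ b₁₁ i u hₖ d (binom N (suc c)))))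
      where
      u≤ : u ≤ binom N (suc c)
      u≤ = count≤binom (uni-⊔ {f = B₁₀} {B₀₁} (uni-quad p true false ug) (uni-quad p false true ug))
      eq₁ : ∀ a x y b c e k i hₖ d → (b + c + e + k) + 3 * (a + x + y) + ((hₖ + hₖ) + (hₖ + d) + (d + d)) + i
        ≡ 3 * hₖ + d + (((a + x + y) + (b + i) + (x + c + d)) + ((y + e + d) + k) + ((x + a) + (y + a)))
      eq₁ = solve-∀
      eq₂ : ∀ a b c e k i u hₖ d B → a + (b + c + e + k) + ((hₖ + d) + (B + (i + u))) + 0
        ≡ hₖ + (d + B) + ((a + (b + i) + k) + (u + (e + c)))
      eq₂ = solve-∀

  collapse-product : count f * count g ≤ hₖ * hₖ
  collapse-product with d <? count f
  ... | no ¬r = small (≮⇒≥ ¬r)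
  ... | yes r with zero-or-pos (b₀₀ + i)
  ...   | inj₁ e = covered (m+n≡0⇒m≡0 b₀₀ e)
  ...   | inj₂ 1≤Q with zero-or-pos b₀₁ | zero-or-pos b₁₀ | shifted-sum (subst (d <_) a≡ r) 1≤Q
  ...     | inj₁ e | _      | s = from-sum (one-side s e (near-h {y} balancedY))
  ...     | inj₂ v | inj₁ e | s = from-sum (subst (λ z → a₁₁ + x + y + (z + b₁₁) ≤ hₖ + hₖ) (eq b₀₀ b₁₀ b₀₁) (one-side s e (near-h {x} balancedX)))
    where
    eq : ∀ b e c → b + e + c ≡ b + c + e
    eq = solve-∀
  ...     | inj₂ v | inj₂ w | s with d <? x + a₁₁ | d <? y + a₁₁
  ...       | yes t | _     = from-sum (large-first t (balancedY w))
  ...       | no _  | yes t = from-sum (large-second t (balancedX v))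
  ...       | no t  | no t′ = generic (subst (d <_) a≡ r) s (balancedX v) (balancedY w) (≮⇒≥ t) (≮⇒≥ t′)

-- The theorem

bothOf-top : ∀ m c → bothOf (m + suc (2 + c)) (2 + c) ≡ binom (m + suc c) c
bothOf-top m c rewrite +-suc m (2 + c) | +-suc m (suc c) = refl

-- The sum bound starts at d + 2 for both families, because of the surplus of two in
-- `cross-bound-top`; `product-twoLow` reaches d + 1, so no size is left out.
shifted-product : ∀ m c {f g : Fam (m + suc (2 + c))} → 1 ≤ c → suc c ≤ m → Shifted f → Shifted g →
  Uni (2 + c) f → Uni (2 + c) g → Avoids₁ f → Avoids₁ g → Cross f g →
  let h = suc (window c m (2 + c)) in count f * count g ≤ h * h
shifted-product m c {f} {g} 1≤c c<m sf sg uf ug nf ng cr with count f ≤? suc d | count g ≤? suc d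
  where d = binom (m + suc c) c
... | yes p | _     = ≤-trans (product-twoLow c m c<m ug (twoLow-of m (2 + c) sf uf nf cr) p) (*-monoˡ-≤ (suc (window c m (2 + c))) (n≤1+n (window c m (2 + c))))
... | no _  | yes q = ≤-trans (≤-reflexive (*-comm (count f) (count g)))
  (≤-trans (product-twoLow c m c<m uf (twoLow-of m (2 + c) sg ug ng (cross-sym cr)) q) (*-monoˡ-≤ (suc (window c m (2 + c))) (n≤1+n (window c m (2 + c)))))
... | no p  | no q  = product-of-sum {count f} {count g} {suc H} (lin 0
  (≤-trans (sum-bound-top m c 1≤c c<m sf sg uf ug nf ng cr (large p) (large q)) (≤-reflexive (cong (λ x → 2 * x + 2) (hockey-stick c m (2 + c)))))
  (eq (count f) (count g) (binom m (suc c)) H))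
  where
  H = window c m (2 + c)
  large : ∀ {x} → ¬ x ≤ suc (binom (m + suc c) c) → bothOf (m + suc (2 + c)) (2 + c) + 2 ≤ x
  large {x} r = subst (_≤ x) (trans (+-comm 2 (binom (m + suc c) c)) (cong (_+ 2) (sym (bothOf-top m c)))) (≰⇒> r)
  eq : ∀ f g G H → f + g + (2 * (G + H) + 2) + 0 ≡ suc H + suc H + (f + g + 2 * G)
  eq = solve-∀

shifted-product′ : ∀ {n} m c → n ≡ m + suc (2 + c) → {f g : Fam n} → 1 ≤ c → suc c ≤ m → Shifted f → Shifted g →
  Uni (2 + c) f → Uni (2 + c) g → Avoids₁ f → Avoids₁ g → Cross f g →
  let h = suc (window c m (2 + c)) in count f * count g ≤ h * h
shifted-product′ m c refl = shifted-product m c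

low-last : ∀ {n} (A : Subset (suc n)) → lookup A (fromℕ n) ≡ false → low 1 A ≡ 0
low-last (false ∷ [])      _ = refl
low-last (s ∷ A@(_ ∷ _)) e = low-last A e

nonStar-avoids₁ : ∀ {n} {f : Fam (suc n)} → NonStar f → Avoids₁ f
nonStar-avoids₁ {n} ns with ns (fromℕ n)
... | A , a , e = A , a , low-last A e

-- The invariant carries non-triviality along the shifts. A collapse of either family ends the
-- process at once: `collapse-product` bounds the product for the families just before that shift,
-- whose sizes are the original ones.
product-theorem : ∀ c q {f g : Fam (2 + (q + suc c + suc c))} → 1 ≤ c → NonStar f → NonStar g →
  Uni (2 + c) f → Uni (2 + c) g → Cross f g →
  let top = suc (window c (q + suc c) (2 + c)) in count f * count g ≤ top * top
product-theorem c q {f₀} {g₀} 1≤c nf₀ ng₀ uf₀ ug₀ cr₀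
  with shift-until P {count f₀ * count g₀ ≤ top * top} step f₀ g₀ (pair uf₀ ug₀ cr₀ refl refl , nf₀ , ng₀)
  where
  top = suc (window c (q + suc c) (2 + c))
  P : Fam (2 + (q + suc c + suc c)) → Fam (2 + (q + suc c + suc c)) → Set
  P f g = Pair (2 + c) (2 + c) (count f₀) (count g₀) f g × NonStar f × NonStar g
  step : ∀ p f g → P f g → P (shift p f) (shift p g) ⊎ count f₀ * count g₀ ≤ top * top
  step p f g (x@(pair uf ug cr e e′) , nf , ng) with nonStar-shift p f nf | nonStar-shift p g ng
  ... | inj₁ nf′ | inj₁ ng′ = inj₁ (pair-shift p f g x , nf′ , ng′)
  ... | inj₂ co  | _        = inj₂ (subst₂ (λ a b → a * b ≤ top * top) e e′ (collapse-product p 1≤c nf ng uf ug cr co))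
  ... | inj₁ _   | inj₂ co  = inj₂ (subst₂ (λ a b → a * b ≤ top * top) e e′
    (≤-trans (≤-reflexive (*-comm (count f) (count g))) (collapse-product p 1≤c ng nf ug uf (cross-sym cr) co)))
... | inj₂ r = r
... | inj₁ (f , g , (pair uf ug cr e e′ , nf , ng) , sf , sg) =
  subst₂ (λ a b → a * b ≤ top * top) e e′
    (shifted-product′ (q + suc c) c (eq q c) 1≤c (m≤n+m (suc c) q) (stable-shifted {f = f} sf) (stable-shifted {f = g} sg) uf ug
      (nonStar-avoids₁ nf) (nonStar-avoids₁ ng) cr)
  where
  top = suc (window c (q + suc c) (2 + c))
  eq : ∀ q c → 2 + (q + suc c + suc c) ≡ q + suc c + suc (2 + c)
  eq = solve-∀

-- From lists and standard binomials to Boolean families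

binom-C : ∀ n k → binom n k ≡ n C k
binom-C n       zero    = refl
binom-C zero    (suc k) = sym (k>n⇒nCk≡0 (s≤s (z≤n {k})))
binom-C (suc n) (suc k) = trans (cong₂ _+_ (binom-C n k) (binom-C n (suc k))) (nCk+nC[k+1]≡[n+1]C[k+1] n k)

_≟ˢ_ : ∀ {n} (A B : Subset n) → Dec (A ≡ B)
_≟ˢ_ = ≡-dec Bool._≟_

module _ {n : ℕ} where
  open DecMembership (_≟ˢ_ {n}) using (_∈?_)

  member : List (Subset n) → Fam n
  member As A = does (A ∈? As)

  member⁺ : ∀ {As A} → A ∈ˡ As → member As ∋ A
  member⁺ {As} {A} = dec-true (A ∈? As)

  member⁻ : ∀ {As} A → member As ∋ A → A ∈ˡ As
  member⁻ {As} A e with A ∈? As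
  ... | yes p = p

  length≤count : ∀ {As} → Unique As → length As ≤ count (member As)
  length≤count {[]ˡ}     []      = z≤n
  length≤count {A ∷ˡ As} (p ∷ u) = begin
    suc (length As)                              ≤⟨ +-mono-≤ (count-pos {f = λ B → does (B ≟ˢ A)} A (dec-true (A ≟ˢ A) refl)) (length≤count u) ⟩
    count (λ B → does (B ≟ˢ A)) + count (member As)  ≡⟨ sym (∑-+ (λ B → ⟦ does (B ≟ˢ A) ⟧) (λ B → ⟦ member As B ⟧)) ⟩
    ∑ (λ B → ⟦ does (B ≟ˢ A) ⟧ + ⟦ member As B ⟧)    ≤⟨ ∑-mono pointwise ⟩
    count (member (A ∷ˡ As))                     ∎
    where
    open ≤-Reasoning
    pointwise : ∀ B → ⟦ does (B ≟ˢ A) ⟧ + ⟦ member As B ⟧ ≤ ⟦ member (A ∷ˡ As) B ⟧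
    pointwise B with B ≟ˢ A | B ∈? As
    ... | yes refl | yes q = contradiction refl (lookupᴬ p q)
    ... | yes refl | no _  = ≤-refl
    ... | no _     | yes _ = ≤-refl
    ... | no _     | no _  = z≤n

meet-of : ∀ {n} {x : Fin n} {A B : Subset n} → x ∈ A → x ∈ B → Meet A B
meet-of here      here      = here
meet-of (there p) (there q) = there (meet-of p q)

nonTrivial⇒nonStar : ∀ {n k} (𝒜 : Family n k) → NonTrivial 𝒜 → NonStar (member (members 𝒜))
nonTrivial⇒nonStar 𝒜 nt x with search (λ A → member (members 𝒜) A ∧ not (lookup A x))
... | inj₁ (A , m) = A , proj₁ (∧-true {member (members 𝒜) A} m) , not-true (proj₂ (∧-true {member (members 𝒜) A} m))
  where
  not-true : ∀ {b} → not b ≡ true → b ≡ false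
  not-true {false} _ = refl
... | inj₂ none = contradiction (x , λ {A} p → lookup⇒[]= x A (contains A (member⁺ p) (none A))) nt
  where
  contains : ∀ A → member (members 𝒜) ∋ A → member (members 𝒜) A ∧ not (lookup A x) ≡ false → lookup A x ≡ true
  contains A p e with lookup A x
  ... | true  = refl
  ... | false = contradiction (trans (sym e) (cong (_∧ true) p)) λ ()

h-window : ∀ c q → h (2 + (q + suc c + suc c)) (2 + c) ≡ suc (window c (q + suc c) (2 + c))
h-window c q = begin
  (suc N C suc c ∸ (N ∸ c ∸ 1) C suc c) + 1        ≡⟨ cong (λ x → (suc N C suc c ∸ x C suc c) + 1)
                                                      (trans (∸-+-assoc N c 1) (trans (cong (N ∸_) (+-comm c 1)) (m+n∸n≡m m (suc c)))) ⟩
  (suc N C suc c ∸ m C suc c) + 1                  ≡⟨ cong₂ (λ x y → (x ∸ y) + 1) (sym (binom-C (suc N) (suc c))) (sym (binom-C m (suc c))) ⟩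
  (binom (suc N) (suc c) ∸ binom m (suc c)) + 1    ≡⟨ cong (λ x → (x ∸ binom m (suc c)) + 1) (trans (cong (λ x → binom x (suc c)) (sym (+-suc m (suc c)))) (hockey-stick c m (2 + c))) ⟩
  (binom m (suc c) + window c m (2 + c) ∸ binom m (suc c)) + 1  ≡⟨ cong (_+ 1) (m+n∸m≡n (binom m (suc c)) _) ⟩
  window c m (2 + c) + 1                           ≡⟨ +-comm (window c m (2 + c)) 1 ⟩
  suc (window c m (2 + c))                         ∎
  where
  open ≡-Reasoning
  m = q + suc c
  N = m + suc c

theorem-from : ∀ {n} c q → n ≡ 2 + (q + suc c + suc c) → 1 ≤ c → (𝒜 ℬ : Family n (2 + c)) → NonTrivialCrossIntersecting 𝒜 ℬ →
  card 𝒜 * card ℬ ≤ h n (2 + c) ^ 2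
theorem-from c q refl 1≤c 𝒜 ℬ (cr , ntA , ntB) = begin
  card 𝒜 * card ℬ                          ≤⟨ *-mono-≤ (length≤count (unique 𝒜)) (length≤count (unique ℬ)) ⟩
  count f * count g                        ≤⟨ product-theorem c q 1≤c (nonTrivial⇒nonStar 𝒜 ntA) (nonTrivial⇒nonStar ℬ ntB)
                                                (λ A p → uniform 𝒜 (member⁻ A p)) (λ B p → uniform ℬ (member⁻ B p)) cross ⟩
  H * H                                    ≡⟨ cong (H *_) (sym (*-identityʳ H)) ⟩
  H ^ 2                                    ≡⟨ cong (_^ 2) (sym (h-window c q)) ⟩
  h (2 + (q + suc c + suc c)) (2 + c) ^ 2  ∎
  where
  open ≤-Reasoning
  f = member (members 𝒜)
  g = member (members ℬ)
  H = suc (window c (q + suc c) (2 + c))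
  cross : Cross f g
  cross A B p q with cr (member⁻ A p) (member⁻ B q)
  ... | x , x∈A∩B = meet-of (proj₁ (x∈p∩q⁻ A B x∈A∩B)) (proj₂ (x∈p∩q⁻ A B x∈A∩B))

theorem1p4 : (n k : ℕ) → k ≥ 3 → n ≥ 2 * k →
    (𝒜 ℬ : Family n k) → NonTrivialCrossIntersecting 𝒜 ℬ →
    card 𝒜 * card ℬ ≤ h n k ^ 2
-- The parameters are `c = k - 2` and `q = n - 2k`, which turns all indices into sums.
theorem1p4 n (suc (suc c)) (s≤s (s≤s 1≤c)) n≥2k = theorem-from c (n ∸ 2 * (2 + c)) (trans (sym (m∸n+n≡m n≥2k)) (eq (n ∸ 2 * (2 + c)) c)) 1≤c
  where
  eq : ∀ q c → q + 2 * (2 + c) ≡ 2 + (q + suc c + suc c)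
  eq = solve-∀
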